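{- Let $r\ge 3$. There are a constant $C_r>0$ (depending only on $r$) and a function $\varepsilon(n)=\varepsilon_r(n)\to 0$ as $n\to\infty$ such that for every $n\ge1$ and every $r$-coloring of the edges of $K_n$, with $G_i$ denoting the graph of $i$-colored edges for $i\in[r]$, $$n^{\left(\frac12+\varepsilon(n)\right)\log_r n}\le\prod_{i=1}^r k(G_i)\le C_r\, n^{\binom r2}\,2^n .$$ Furthermore, the upper bound is tight up to the constant: there is $c_r>0$ depending only on $r$ such that for every $n\ge 1$ some $r$-coloring of the edges of $K_n$ satisfies $\prod_{i=1}^r k(G_i)\ge c_r\,n^{\binom r2}2^n$. And the lower bound is tight up to a multiple of $3\log_3 r$ in the exponent: there is a function $\delta(n)=\delta_r(n)\to0$ such that for every $n\ge 1$ some $r$-coloring of the edges of $K_n$ satisfies $\prod_{i=1}^r k(G_i)\le n^{(3\log_3 r)\left(\frac12+\delta(n)\right)\log_r n}$ for all sufficiently large $n$.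
   Context: $[r]=\{1,\dots,r\}$. An $r$-coloring assigns each edge of $K_n$ exactly one color in $[r]$ (colors may be unused); each $G_i$ has the full vertex set of $K_n$. $k(G)$ is the number of cliques of $G$, i.e. vertex subsets inducing a complete subgraph; the empty set and all singletons count as cliques. -}

module Defs where

open import Data.Empty using (⊥-elim)
open import Data.Fin.Base using (Fin)
open import Data.Fin.Properties using (all?) renaming (_≟_ to _≟ᶠ_)
open import Data.Fin.Subset using (Subset; inside; outside; _∈_)
open import Data.Fin.Subset.Properties using (_∈?_)
open import Data.Integer.Base as ℤ using (ℤ; +_; -[1+_])
import Data.Integer.Properties as ℤ
import Data.Integer.Solver as ℤ-Solver
open import Data.List.Base using (List; []; _∷_; _++_; map; length; filter; allFin)
open import Data.Nat.Base as ℕ using (ℕ; zero; suc; _^_; z≤n; s≤s; NonZero; NonTrivial)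
open import Data.Nat.ListAction using (product)
import Data.Nat.Properties as ℕ
import Data.Nat.Solver as ℕ-Solver
open import Data.Product.Base using (∃; ∃-syntax; _×_; _,_; proj₁; proj₂)
open import Data.Sum.Base using (inj₁; inj₂)
open import Data.Vec.Base using ([]; _∷_)
open import Relation.Binary.PropositionalEquality
open import Relation.Nullary using (Dec; yes; no; ¬_)
open import Relation.Nullary.Decidable using (_×-dec_; _→-dec_; ¬?)

-- The value is 0 if no k ≤ K with k > 0 satisfies P.
greatest : {P : ℕ → Set} → (∀ k → Dec (P k)) → ℕ → ℕ
greatest P? zero    = zero
greatest P? (suc k) with P? (suc k)
... | yes _ = suc k
... | no  _ = greatest P? k

module ℕ-Lemmas where
  open import Data.Nat.Base
  open import Data.Nat.Properties
  open ℕ-Solver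

  greatest-sound : ∀ {P : ℕ → Set} (P? : ∀ k → Dec (P k)) K → P 0 → P (greatest P? K)
  greatest-sound P? zero    p0 = p0
  greatest-sound P? (suc k) p0 with P? (suc k)
  ... | yes p = p
  ... | no  _ = greatest-sound P? k p0

  greatest-max : ∀ {P : ℕ → Set} (P? : ∀ k → Dec (P k)) K {k} → k ≤ K → P k → k ≤ greatest P? K
  greatest-max P? zero    k≤K _ = k≤K
  greatest-max {P} P? (suc K) {k} k≤K pk with P? (suc K)
  ... | yes _ = k≤K
  ... | no ¬p with m≤n⇒m<n∨m≡n k≤K
  ...   | inj₁ (s≤s k≤K′) = greatest-max P? K k≤K′ pk
  ...   | inj₂ refl = ⊥-elim (¬p pk)

  ^-distribʳ-* : ∀ m n o → (m * n) ^ o ≡ m ^ o * n ^ o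
  ^-distribʳ-* m n zero    = refl
  ^-distribʳ-* m n (suc o) rewrite ^-distribʳ-* m n o =
    solve 4 (λ m n a b → (m :* n) :* (a :* b) := (m :* a) :* (n :* b)) refl m n (m ^ o) (n ^ o)
    where open +-*-Solver

  ^-cancelˡ-≤ : ∀ {m n} o .{{_ : NonZero o}} → m ^ o ≤ n ^ o → m ≤ n
  ^-cancelˡ-≤ {m} {n} o h with m ≤? n
  ... | yes m≤n = m≤n
  ... | no  m≰n = ⊥-elim (<⇒≱ (^-monoˡ-< o (≰⇒> m≰n)) h)

  ^-cancelʳ-< : ∀ b .{{_ : NonZero b}} {m n} → b ^ m < b ^ n → m < n
  ^-cancelʳ-< b {m} {n} h with m <? n
  ... | yes m<n = m<n
  ... | no  m≮n = ⊥-elim (<⇒≱ h (^-monoʳ-≤ b (≮⇒≥ m≮n)))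

  k≤b^k : ∀ b → 2 ≤ b → ∀ k → suc k ≤ b ^ k
  k≤b^k b 2≤b zero = s≤s z≤n
  k≤b^k b 2≤b (suc k) = begin
    suc (suc k)          ≤⟨ +-monoʳ-≤ (suc 0) (m≤n+m (suc k) k) ⟩
    suc (k + suc k)      ≡⟨ solve 1 (λ k → con 1 :+ (k :+ (con 1 :+ k)) := con 2 :* (con 1 :+ k)) refl k ⟩
    2 * suc k            ≤⟨ *-mono-≤ 2≤b (k≤b^k b 2≤b k) ⟩
    b * b ^ k            ∎
    where open ≤-Reasoning
          open +-*-Solver

  bernoulli : ∀ M c j → M ^ j * (M + j * c) ≤ (M + c) ^ j * M
  bernoulli M c zero = ≤-reflexive (solve 1 (λ M → con 1 :* (M :+ con 0) := con 1 :* M) refl M)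
    where open +-*-Solver
  bernoulli M c (suc j) = begin
    M * M ^ j * (M + (c + j * c))            ≤⟨ m≤m+n _ _ ⟩
    M * M ^ j * (M + (c + j * c)) + M ^ j * (c * (j * c))
      ≡⟨ solve 4 (λ M c P d → M :* P :* (M :+ (c :+ d)) :+ P :* (c :* d) := (M :+ c) :* (P :* (M :+ d))) refl M c (M ^ j) (j * c) ⟩
    (M + c) * (M ^ j * (M + j * c))          ≤⟨ *-monoʳ-≤ (M + c) (bernoulli M c j) ⟩
    (M + c) * ((M + c) ^ j * M)              ≡⟨ *-assoc (M + c) _ M ⟨
    (M + c) * (M + c) ^ j * M                ∎
    where open ≤-Reasoning
          open +-*-Solver

  root-bound : ∀ b M .{{_ : NonZero M}} → b * M ^ M ≤ (M + b) ^ M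
  root-bound b M = *-cancelʳ-≤ (b * M ^ M) ((M + b) ^ M) M (begin
    b * M ^ M * M               ≤⟨ m≤n+m _ (M ^ M * M) ⟩
    M ^ M * M + b * M ^ M * M   ≡⟨ solve 3 (λ b P M → P :* M :+ b :* P :* M := P :* (M :+ M :* b)) refl b (M ^ M) M ⟩
    M ^ M * (M + M * b)         ≤⟨ bernoulli M b M ⟩
    (M + b) ^ M * M             ∎)
    where open ≤-Reasoning
          open +-*-Solver

  -- If (k/K)^q ≤ b^(x-y), (l/L)^q' ≥ b^(x'-y') and (x-y)/q ≤ (x'-y')/q' + 1/M,
  -- then k/K ≤ (l/L) * (M+b)/M.
  core : ∀ b M .{{_ : NonZero b}} .{{_ : NonZero M}} k K q x y l L q' x' y' .{{_ : NonZero q}} .{{_ : NonZero q'}} →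
    k ^ q * b ^ y ≤ K ^ q * b ^ x →
    L ^ q' * b ^ x' ≤ l ^ q' * b ^ y' →
    x * (q' * M) + y' * (q * M) ≤ y * (q' * M) + x' * (q * M) + q * q' →
    k * L * M ≤ l * K * (M + b)
  core b M k K q x y l L q' x' y' h₁ h₂ h₃ = ^-cancelˡ-≤ D (*-cancelʳ-≤ _ _ (b ^ e) (begin
    (k * L * M) ^ D * b ^ e
      ≡⟨ cong₂ _*_ (trans (^-distribʳ-* (k * L) M D) (cong (_* M ^ D) (^-distribʳ-* k L D)))
           (trans (^-distribˡ-+-* b (y * (q' * M) + x' * (q * M)) (q * q')) (cong (_* b ^ (q * q')) (^-distribˡ-+-* b (y * (q' * M)) (x' * (q * M))))) ⟩
    k ^ D * L ^ D * M ^ D * (b ^ (y * (q' * M)) * b ^ (x' * (q * M)) * b ^ (q * q'))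
      ≡⟨ solve 6 (λ a c d f g h → a :* c :* d :* (f :* g :* h) := (a :* f) :* (c :* g) :* (h :* d)) refl
          (k ^ D) (L ^ D) (M ^ D) (b ^ (y * (q' * M))) (b ^ (x' * (q * M))) (b ^ (q * q')) ⟩
    (k ^ D * b ^ (y * (q' * M))) * (L ^ D * b ^ (x' * (q * M))) * (b ^ (q * q') * M ^ D)
      ≤⟨ *-mono-≤ (*-mono-≤ (raise k K x y (q' * M) q (solve 3 (λ q q' M → q :* (q' :* M) := q :* q' :* M) refl q q' M) h₁)
                            (raise' (q * M) q' (solve 3 (λ q q' M → q' :* (q :* M) := q :* q' :* M) refl q q' M) h₂))
                  bern ⟩
    (K ^ D * b ^ (x * (q' * M))) * (l ^ D * b ^ (y' * (q * M))) * (M + b) ^ D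
      ≡⟨ solve 5 (λ a c d f g → (a :* f) :* (c :* g) :* d := c :* a :* d :* (f :* g)) refl
          (K ^ D) (l ^ D) ((M + b) ^ D) (b ^ (x * (q' * M))) (b ^ (y' * (q * M))) ⟩
    l ^ D * K ^ D * (M + b) ^ D * (b ^ (x * (q' * M)) * b ^ (y' * (q * M)))
      ≡⟨ cong₂ _*_ (trans (^-distribʳ-* (l * K) (M + b) D) (cong (_* (M + b) ^ D) (^-distribʳ-* l K D)))
           (^-distribˡ-+-* b (x * (q' * M)) (y' * (q * M))) ⟨
    (l * K * (M + b)) ^ D * b ^ (x * (q' * M) + y' * (q * M))
      ≤⟨ *-monoʳ-≤ ((l * K * (M + b)) ^ D) (^-monoʳ-≤ b h₃) ⟩
    (l * K * (M + b)) ^ D * b ^ e ∎))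
    where
    open ≤-Reasoning
    open +-*-Solver
    D = q * q' * M
    e = y * (q' * M) + x' * (q * M) + q * q'
    instance
      nzqq' : NonZero (q * q')
      nzqq' = m*n≢0 q q'
      nzD : NonZero D
      nzD = m*n≢0 (q * q') M
      nzb : NonZero (b ^ e)
      nzb = m^n≢0 b e
    raise : ∀ k K x y j q → q * j ≡ D → k ^ q * b ^ y ≤ K ^ q * b ^ x → k ^ D * b ^ (y * j) ≤ K ^ D * b ^ (x * j)
    raise k K x y j q eq h = subst₂ _≤_ (lem k y) (lem K x) (^-monoˡ-≤ j h)
      where
      lem : ∀ k y → (k ^ q * b ^ y) ^ j ≡ k ^ D * b ^ (y * j)
      lem k y = trans (^-distribʳ-* (k ^ q) (b ^ y) j)
                      (cong₂ _*_ (trans (^-*-assoc k q j) (cong (k ^_) eq)) (^-*-assoc b y j))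
    raise' : ∀ j q → q * j ≡ D → L ^ q * b ^ x' ≤ l ^ q * b ^ y' → L ^ D * b ^ (x' * j) ≤ l ^ D * b ^ (y' * j)
    raise' j q = raise L l y' x' j q
    bern : b ^ (q * q') * M ^ D ≤ (M + b) ^ D
    bern = subst₂ _≤_ (trans (^-distribʳ-* b (M ^ M) (q * q')) (cong (b ^ (q * q') *_) (trans (^-*-assoc M M (q * q')) (cong (M ^_) (*-comm M (q * q'))))))
                      (trans (^-*-assoc (M + b) M (q * q')) (cong ((M + b) ^_) (*-comm M (q * q'))))
                      (^-monoˡ-≤ (q * q') (root-bound b M))

open ℕ-Lemmas using (greatest-sound; greatest-max; core; ^-cancelˡ-≤; ^-cancelʳ-<; k≤b^k; ^-distribʳ-*)

open import Data.Rational.Base as ℚ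
  using (ℚ; mkℚ; 0ℚ; 1ℚ; ½; _+_; _*_; _-_; -_; ∣_∣; _≤_; _<_; _/_; 1/_; ↥_; ↧ₙ_; toℚᵘ)
import Data.Rational.Properties as ℚ
import Data.Rational.Solver as ℚ-Solver
open import Data.Rational.Unnormalised.Base as ℚᵘ using (mkℚᵘ)
import Data.Rational.Unnormalised.Properties as ℚᵘ

IsCauchy : (ℕ → ℚ) → Set
IsCauchy x = ∀ ε → 0ℚ < ε → ∃[ N ] ∀ m n → N ℕ.≤ m → N ℕ.≤ n → ∣ x m - x n ∣ ≤ ε

record ℝ : Set where
  constructor mkℝ
  field
    seq    : ℕ → ℚ
    cauchy : IsCauchy seq

open ℝ public

infix 4 _≤ᴿ_ _<ᴿ_

_≤ᴿ_ : ℝ → ℝ → Set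
x ≤ᴿ y = ∀ ε → 0ℚ < ε → ∃[ N ] ∀ n → N ℕ.≤ n → seq x n ≤ seq y n + ε

_<ᴿ_ : ℝ → ℝ → Set
x <ᴿ y = ∃[ ε ] 0ℚ < ε × ∃[ N ] ∀ n → N ℕ.≤ n → seq x n + ε ≤ seq y n

-- ⌊log_b (n ^ M)⌋, for b ≥ 2 and n ≥ 1: M * log_b n up to an error below 1.
logNum : (b n M : ℕ) → ℕ
logNum b n M = greatest (λ a → b ^ a ℕ.≤? n ^ M) (n ^ M)

pos-part neg-part : ℤ → ℕ
pos-part (+ n)    = n
pos-part -[1+ _ ] = 0
neg-part (+ _)    = 0
neg-part -[1+ n ] = suc n

-- (k / K) ^ q ≤ b ^ p where t = p / q, with a negative power of b moved to
-- the left-hand side; that is, k / K ≤ b ^ t.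
Below : (b : ℕ) (t : ℚ) (K k : ℕ) → Set
Below b t K k = k ^ ↧ₙ t ℕ.* b ^ neg-part (↥ t) ℕ.≤ K ^ ↧ₙ t ℕ.* b ^ pos-part (↥ t)

below? : ∀ b t K k → Dec (Below b t K k)
below? b t K k = k ^ ↧ₙ t ℕ.* b ^ neg-part (↥ t) ℕ.≤? K ^ ↧ₙ t ℕ.* b ^ pos-part (↥ t)

-- ⌊K * b ^ t⌋, for b ≥ 1.
powNum : (b : ℕ) (t : ℚ) (K : ℕ) → ℕ
powNum b t K = greatest (below? b t K) (K ℕ.* b ^ pos-part (↥ t))

-- b ^ t up to an error below 1 / (K + 1).
powApprox : ℕ → ℚ → ℕ → ℚ
powApprox b t K = + powNum b t (suc K) / suc K

module ℝ-Lemmas where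

  ⊔-≤ˡ : ∀ m n {o} → m ℕ.⊔ n ℕ.≤ o → m ℕ.≤ o
  ⊔-≤ˡ m n = ℕ.≤-trans (ℕ.m≤m⊔n m n)

  ⊔-≤ʳ : ∀ m n {o} → m ℕ.⊔ n ℕ.≤ o → n ℕ.≤ o
  ⊔-≤ʳ m n = ℕ.≤-trans (ℕ.m≤n⊔m m n)

  0<½ : 0ℚ < ½
  0<½ = ℚ.positive⁻¹ ½

  *-pos : ∀ {p q} → 0ℚ < p → 0ℚ < q → 0ℚ < p * q
  *-pos {p} {q} 0<p 0<q =
    ℚ.positive⁻¹ (p * q) {{ℚ.pos*pos⇒pos p {{ℚ.positive 0<p}} q {{ℚ.positive 0<q}}}}

  halves : ∀ p → ½ * p + ½ * p ≡ p
  halves p = trans (sym (ℚ.*-distribʳ-+ p ½ ½)) (ℚ.*-identityˡ p)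

  oneSided : ∀ x → (∀ ε → 0ℚ < ε → ∃[ N ] ∀ m n → N ℕ.≤ m → N ℕ.≤ n → x m - x n ≤ ε) →
             IsCauchy x
  oneSided x f ε 0<ε with f ε 0<ε
  ... | N , g = N , h
    where
    h : ∀ m n → N ℕ.≤ m → N ℕ.≤ n → ∣ x m - x n ∣ ≤ ε
    h m n N≤m N≤n with ℚ.∣p∣≡p∨∣p∣≡-p (x m - x n)
    ... | inj₁ eq = ℚ.≤-trans (ℚ.≤-reflexive eq) (g m n N≤m N≤n)
    ... | inj₂ eq = ℚ.≤-trans (ℚ.≤-reflexive (trans eq (lem (x m) (x n)))) (g n m N≤n N≤m)
      where
      open ℚ-Solver.+-*-Solver
      lem : ∀ p q → - (p - q) ≡ q - p
      lem = solve 2 (λ p q → :- (p :- q) := q :- p) refl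

  ≤∣∣ : ∀ p → p ≤ ∣ p ∣
  ≤∣∣ p with ℚ.≤-total 0ℚ p
  ... | inj₁ 0≤p = ℚ.≤-reflexive (sym (ℚ.0≤p⇒∣p∣≡p 0≤p))
  ... | inj₂ p≤0 = ℚ.≤-trans p≤0 (ℚ.0≤∣p∣ p)

  shift : ∀ p q {r} → ∣ p - q ∣ ≤ r → ∣ p ∣ ≤ ∣ q ∣ + r
  shift p q {r} h = begin
    ∣ p ∣               ≡⟨ cong ∣_∣ (lem p q) ⟩
    ∣ q + (p - q) ∣     ≤⟨ ℚ.∣p+q∣≤∣p∣+∣q∣ q (p - q) ⟩
    ∣ q ∣ + ∣ p - q ∣   ≤⟨ ℚ.+-monoʳ-≤ ∣ q ∣ h ⟩
    ∣ q ∣ + r           ∎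
    where
    open ℚ.≤-Reasoning
    lem : ∀ p q → p ≡ q + (p - q)
    lem = solve 2 (λ p q → p := q :+ (p :- q)) refl
      where open ℚ-Solver.+-*-Solver

  ≤+⇒-≤ : ∀ p q {r} → p ≤ q + r → p - q ≤ r
  ≤+⇒-≤ p q {r} h = begin
    p - q         ≤⟨ ℚ.+-monoˡ-≤ (- q) h ⟩
    (q + r) - q   ≡⟨ lem q r ⟩
    r             ∎
    where
    open ℚ.≤-Reasoning
    lem : ∀ q r → (q + r) - q ≡ r
    lem = solve 2 (λ q r → (q :+ r) :- q := r) refl
      where open ℚ-Solver.+-*-Solver

  const-cauchy : ∀ q → IsCauchy (λ _ → q)
  const-cauchy q ε 0<ε = 0 , λ _ _ _ _ →
    ℚ.≤-trans (ℚ.≤-reflexive (cong ∣_∣ (ℚ.+-inverseʳ q))) (ℚ.<⇒≤ 0<ε)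

  ∣∣-cauchy : ∀ x → IsCauchy x → IsCauchy (λ n → ∣ x n ∣)
  ∣∣-cauchy x cx = oneSided (λ n → ∣ x n ∣) λ ε 0<ε → let N , f = cx ε 0<ε in
    N , λ m n N≤m N≤n → ≤+⇒-≤ ∣ x m ∣ ∣ x n ∣ (shift (x m) (x n) (f m n N≤m N≤n))

  +-cauchy : ∀ x y → IsCauchy x → IsCauchy y → IsCauchy (λ n → x n + y n)
  +-cauchy x y cx cy ε 0<ε with cx (½ * ε) (*-pos 0<½ 0<ε) | cy (½ * ε) (*-pos 0<½ 0<ε)
  ... | M , f | N , g = M ℕ.⊔ N , λ m n p q → begin
    ∣ (x m + y m) - (x n + y n) ∣       ≡⟨ cong ∣_∣ (lem (x m) (y m) (x n) (y n)) ⟩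
    ∣ (x m - x n) + (y m - y n) ∣       ≤⟨ ℚ.∣p+q∣≤∣p∣+∣q∣ (x m - x n) (y m - y n) ⟩
    ∣ x m - x n ∣ + ∣ y m - y n ∣       ≤⟨ ℚ.+-mono-≤
                                             (f m n (⊔-≤ˡ M N p) (⊔-≤ˡ M N q))
                                             (g m n (⊔-≤ʳ M N p) (⊔-≤ʳ M N q)) ⟩
    ½ * ε + ½ * ε                       ≡⟨ halves ε ⟩
    ε                                   ∎
    where
    open ℚ.≤-Reasoning
    lem : ∀ a b c d → (a + b) - (c + d) ≡ (a - c) + (b - d)
    lem = solve 4 (λ a b c d → (a :+ b) :- (c :+ d) := (a :- c) :+ (b :- d)) refl
      where open ℚ-Solver.+-*-Solver

  bounded : ∀ {x} → IsCauchy x → ∃[ B ] 0ℚ < B × ∃[ N ] ∀ n → N ℕ.≤ n → ∣ x n ∣ ≤ B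
  bounded {x} cx with cx 1ℚ (ℚ.positive⁻¹ 1ℚ)
  ... | N , f = ∣ x N ∣ + 1ℚ
              , ℚ.+-mono-≤-< (ℚ.0≤∣p∣ (x N)) (ℚ.positive⁻¹ 1ℚ)
              , N , λ n N≤n → shift (x n) (x N) (f n N N≤n ℕ.≤-refl)

  -- For positive D, a positive δ with D * δ ≡ ε.
  divide : ∀ D ε → 0ℚ < D → 0ℚ < ε → ∃[ δ ] 0ℚ < δ × D * δ ≡ ε
  divide D ε 0<D 0<ε = 1/D * ε , *-pos (ℚ.positive⁻¹ 1/D {{ℚ.1/pos⇒pos D}}) 0<ε , (begin
    D * (1/D * ε)   ≡⟨ ℚ.*-assoc D 1/D ε ⟨
    (D * 1/D) * ε   ≡⟨ cong (_* ε) (ℚ.*-inverseʳ D) ⟩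
    1ℚ * ε          ≡⟨ ℚ.*-identityˡ ε ⟩
    ε               ∎)
    where
    open ≡-Reasoning
    instance
      D-pos = ℚ.positive 0<D
      D-nonZero = ℚ.pos⇒nonZero D
    1/D = 1/ D

  *-mono-≤ : ∀ {a b c d} → 0ℚ ≤ c → 0ℚ ≤ b → a ≤ b → c ≤ d → a * c ≤ b * d
  *-mono-≤ {a} {b} {c} {d} 0≤c 0≤b a≤b c≤d = ℚ.≤-trans
    (ℚ.*-monoʳ-≤-nonNeg c {{ℚ.nonNegative 0≤c}} a≤b)
    (ℚ.*-monoˡ-≤-nonNeg b {{ℚ.nonNegative 0≤b}} c≤d)

  *-diff : ∀ a b c d {A D δ} → 0ℚ ≤ A → 0ℚ ≤ D → ∣ a ∣ ≤ A → ∣ d ∣ ≤ D →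
           ∣ a - c ∣ ≤ δ → ∣ b - d ∣ ≤ δ → ∣ a * b - c * d ∣ ≤ (A + D) * δ
  *-diff a b c d {A} {D} {δ} 0≤A 0≤D a≤A d≤D ac bd = begin
    ∣ a * b - c * d ∣                      ≡⟨ cong ∣_∣ (lem a b c d) ⟩
    ∣ a * (b - d) + d * (a - c) ∣          ≤⟨ ℚ.∣p+q∣≤∣p∣+∣q∣ (a * (b - d)) (d * (a - c)) ⟩
    ∣ a * (b - d) ∣ + ∣ d * (a - c) ∣      ≡⟨ cong₂ _+_ (ℚ.∣p*q∣≡∣p∣*∣q∣ a (b - d))
                                                        (ℚ.∣p*q∣≡∣p∣*∣q∣ d (a - c)) ⟩
    ∣ a ∣ * ∣ b - d ∣ + ∣ d ∣ * ∣ a - c ∣  ≤⟨ ℚ.+-mono-≤ (*-mono-≤ (ℚ.0≤∣p∣ (b - d)) 0≤A a≤A bd)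
                                                         (*-mono-≤ (ℚ.0≤∣p∣ (a - c)) 0≤D d≤D ac) ⟩
    A * δ + D * δ                          ≡⟨ ℚ.*-distribʳ-+ δ A D ⟨
    (A + D) * δ                            ∎
    where
    open ℚ.≤-Reasoning
    lem : ∀ a b c d → a * b - c * d ≡ a * (b - d) + d * (a - c)
    lem = solve 4 (λ a b c d → a :* b :- c :* d := a :* (b :- d) :+ d :* (a :- c)) refl
      where open ℚ-Solver.+-*-Solver

  *-cauchy : ∀ x y → IsCauchy x → IsCauchy y → IsCauchy (λ n → x n * y n)
  *-cauchy x y cx cy ε 0<ε =
    let B , 0<B , K , p  = bounded {x} cx
        C , 0<C , L , q  = bounded {y} cy
        δ , 0<δ , eq     = divide (B + C) ε (ℚ.+-mono-< 0<B 0<C) 0<ε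
        M , f            = cx δ 0<δ
        N , g            = cy δ 0<δ
        k≤ = λ {n} → ⊔-≤ˡ K (L ℕ.⊔ (M ℕ.⊔ N)) {n}
        t≤ = λ {n} → ⊔-≤ʳ K (L ℕ.⊔ (M ℕ.⊔ N)) {n}
        l≤ = λ {n} h → ⊔-≤ˡ L (M ℕ.⊔ N) {n} (t≤ h)
        m≤ = λ {n} h → ⊔-≤ˡ M N {n} (⊔-≤ʳ L (M ℕ.⊔ N) (t≤ h))
        n≤ = λ {n} h → ⊔-≤ʳ M N {n} (⊔-≤ʳ L (M ℕ.⊔ N) (t≤ h))
    in K ℕ.⊔ (L ℕ.⊔ (M ℕ.⊔ N)) , λ m n h k →
       subst (∣ x m * y m - x n * y n ∣ ≤_) eq
         (*-diff (x m) (y m) (x n) (y n) (ℚ.<⇒≤ 0<B) (ℚ.<⇒≤ 0<C) (p m (k≤ h)) (q n (l≤ k))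
           (f m n (m≤ h) (m≤ k)) (g m n (n≤ h) (n≤ k)))

  /-mono-≤ : ∀ a m c n → a ℕ.* suc n ℕ.≤ c ℕ.* suc m → + a / suc m ≤ + c / suc n
  /-mono-≤ a m c n h = ℚ.toℚᵘ-cancel-≤
    (ℚᵘ.≤-respˡ-≃ (ℚᵘ.≃-sym (ℚ.toℚᵘ-fromℚᵘ (mkℚᵘ (+ a) m)))
      (ℚᵘ.≤-respʳ-≃ (ℚᵘ.≃-sym (ℚ.toℚᵘ-fromℚᵘ (mkℚᵘ (+ c) n)))
        (ℚᵘ.*≤* (subst₂ ℤ._≤_ (ℤ.pos-* a (suc n)) (ℤ.pos-* c (suc m)) (ℤ.+≤+ h)))))

  /-* : ∀ a m c n → (+ a / suc m) * (+ c / suc n) ≡ + (a ℕ.* c) / (suc m ℕ.* suc n)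
  /-* a m c n = ℚ.toℚᵘ-injective (ℚᵘ.≃-trans (ℚ.toℚᵘ-homo-* (+ a / suc m) (+ c / suc n))
    (ℚᵘ.≃-trans (ℚᵘ.*-cong (ℚ.toℚᵘ-fromℚᵘ (mkℚᵘ (+ a) m)) (ℚ.toℚᵘ-fromℚᵘ (mkℚᵘ (+ c) n)))
    (ℚᵘ.≃-trans (ℚᵘ.*≡* (cong (ℤ._* + (suc m ℕ.* suc n)) (sym (ℤ.pos-* a c))))
      (ℚᵘ.≃-sym (ℚ.toℚᵘ-fromℚᵘ (mkℚᵘ (+ (a ℕ.* c)) (n ℕ.+ m ℕ.* suc n)))))))

  /-+ : ∀ a c n → (+ a / suc n) + (+ c / suc n) ≡ + (a ℕ.+ c) / suc n
  /-+ a c n = ℚ.toℚᵘ-injective (ℚᵘ.≃-trans (ℚ.toℚᵘ-homo-+ (+ a / suc n) (+ c / suc n))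
    (ℚᵘ.≃-trans (ℚᵘ.+-cong (ℚ.toℚᵘ-fromℚᵘ (mkℚᵘ (+ a) n)) (ℚ.toℚᵘ-fromℚᵘ (mkℚᵘ (+ c) n)))
    (ℚᵘ.≃-trans (ℚᵘ.*≡* (trans (lem (+ a) (+ c) (+ suc n)) (cong₂ ℤ._*_ (sym (ℤ.pos-+ a c)) (sym (ℤ.pos-* (suc n) (suc n))))))
      (ℚᵘ.≃-sym (ℚ.toℚᵘ-fromℚᵘ (mkℚᵘ (+ (a ℕ.+ c)) n))))))
    where
    lem : ∀ a c n → (a ℤ.* n ℤ.+ c ℤ.* n) ℤ.* n ≡ (a ℤ.+ c) ℤ.* (n ℤ.* n)
    lem = solve 3 (λ a c n → (a :* n :+ c :* n) :* n := (a :+ c) :* (n :* n)) refl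
      where open ℤ-Solver.+-*-Solver

  n/n≡1 : ∀ n → + suc n / suc n ≡ 1ℚ
  n/n≡1 n = ℚ.toℚᵘ-injective (ℚᵘ.≃-trans (ℚ.toℚᵘ-fromℚᵘ (mkℚᵘ (+ suc n) n)) (ℚᵘ.*≡* (ℤ.*-comm (+ suc n) (+ 1))))

  0≤/ : ∀ a m → 0ℚ ≤ + a / suc m
  0≤/ a m = /-mono-≤ 0 0 a m z≤n

  archimedean : ∀ δ → 0ℚ < δ → ∃[ M ] + 1 / suc M ≤ δ
  archimedean δ 0<δ = go δ {{ℚ.positive 0<δ}}
    where
    go : ∀ δ .{{_ : ℚ.Positive δ}} → ∃[ M ] + 1 / suc M ≤ δ
    go δ@(mkℚ ℤ.+[1+ p ] d _) = d ,
      ℚ.≤-trans (/-mono-≤ 1 d (suc p) d (ℕ.*-monoˡ-≤ (suc d) {1} {suc p} (s≤s z≤n))) (ℚ.≤-reflexive (ℚ.↥p/↧p≡p δ))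

  1/-antimono : ∀ {m n} → m ℕ.≤ n → + 1 / suc n ≤ + 1 / suc m
  1/-antimono {m} {n} m≤n = /-mono-≤ 1 n 1 m (ℕ.*-monoʳ-≤ 1 (s≤s m≤n))

  log-step : ∀ b n M N → 2 ℕ.≤ b → 1 ℕ.≤ n →
             logNum b n (suc M) ℕ.* suc N ℕ.≤ suc (logNum b n (suc N)) ℕ.* suc M
  log-step b n M N 2≤b 1≤n = ℕ.<⇒≤ (^-cancelʳ-< b {a ℕ.* suc N} {suc a′ ℕ.* suc M} (begin-strict
    b ^ (a ℕ.* suc N)          ≡⟨ ℕ.^-*-assoc b a (suc N) ⟨
    (b ^ a) ^ suc N            ≤⟨ ℕ.^-monoˡ-≤ (suc N) (greatest-sound (λ a → b ^ a ℕ.≤? n ^ suc M) (n ^ suc M) (ℕ.m^n>0 n (suc M))) ⟩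
    (n ^ suc M) ^ suc N        ≡⟨ trans (ℕ.^-*-assoc n (suc M) (suc N)) (trans (cong (n ^_) (ℕ.*-comm (suc M) (suc N))) (sym (ℕ.^-*-assoc n (suc N) (suc M)))) ⟩
    (n ^ suc N) ^ suc M        <⟨ ℕ.^-monoˡ-< (suc M) (ℕ.≰⇒> above) ⟩
    (b ^ suc a′) ^ suc M       ≡⟨ ℕ.^-*-assoc b (suc a′) (suc M) ⟩
    b ^ (suc a′ ℕ.* suc M)     ∎))
    where
    open ℕ.≤-Reasoning
    instance
      b≢0 : NonZero b
      b≢0 = ℕ.>-nonZero (ℕ.<⇒≤ 2≤b)
      n≢0 : NonZero n
      n≢0 = ℕ.>-nonZero 1≤n
    a a′ : ℕ
    a  = logNum b n (suc M)
    a′ = logNum b n (suc N)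
    above : ¬ (b ^ suc a′ ℕ.≤ n ^ suc N)
    above h = ℕ.1+n≰n (greatest-max (λ a → b ^ a ℕ.≤? n ^ suc N) (n ^ suc N)
                (ℕ.≤-trans (ℕ.<⇒≤ (k≤b^k b 2≤b (suc a′))) h) h)

  pos-neg : ∀ i → i ≡ + pos-part i ℤ.- + neg-part i
  pos-neg (+ n)    = sym (ℤ.+-identityʳ (+ n))
  pos-neg -[1+ n ] = refl

  module _ (b : ℕ) .{{_ : NonZero b}} where

    powNum-below : ∀ t K → Below b t K (powNum b t K)
    powNum-below t@record{} K = greatest-sound (below? b t K) (K ℕ.* b ^ pos-part (↥ t)) z≤n

    powNum-above : ∀ t K → ¬ Below b t K (suc (powNum b t K))
    powNum-above t@record{} K h = ℕ.1+n≰n (greatest-max (below? b t K) (K ℕ.* b ^ x) bound h)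
      where
      x y k : ℕ
      x = pos-part (↥ t)
      y = neg-part (↥ t)
      k = suc (powNum b t K)
      instance
        b^x≢0 : NonZero (b ^ x)
        b^x≢0 = ℕ.m^n≢0 b x
        b^y≢0 : NonZero (b ^ y)
        b^y≢0 = ℕ.m^n≢0 b y
      bound : k ℕ.≤ K ℕ.* b ^ x
      bound = ^-cancelˡ-≤ (↧ₙ t) (begin
        k ^ ↧ₙ t                        ≤⟨ ℕ.m≤m*n (k ^ ↧ₙ t) (b ^ y) ⟩
        k ^ ↧ₙ t ℕ.* b ^ y              ≤⟨ h ⟩
        K ^ ↧ₙ t ℕ.* b ^ x              ≡⟨ cong (K ^ ↧ₙ t ℕ.*_) (ℕ.*-identityʳ (b ^ x)) ⟨
        K ^ ↧ₙ t ℕ.* (b ^ x) ^ 1        ≤⟨ ℕ.*-monoʳ-≤ (K ^ ↧ₙ t) (ℕ.^-monoʳ-≤ (b ^ x) {1} {↧ₙ t} (s≤s z≤n)) ⟩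
        K ^ ↧ₙ t ℕ.* (b ^ x) ^ ↧ₙ t     ≡⟨ ^-distribʳ-* K (b ^ x) (↧ₙ t) ⟨
        (K ℕ.* b ^ x) ^ ↧ₙ t            ∎)
        where open ℕ.≤-Reasoning

    exponents : ∀ s t M → s ≤ t + + 1 / suc M →
      pos-part (↥ s) ℕ.* (↧ₙ t ℕ.* suc M) ℕ.+ neg-part (↥ t) ℕ.* (↧ₙ s ℕ.* suc M) ℕ.≤
      neg-part (↥ s) ℕ.* (↧ₙ t ℕ.* suc M) ℕ.+ pos-part (↥ t) ℕ.* (↧ₙ s ℕ.* suc M) ℕ.+ ↧ₙ s ℕ.* ↧ₙ t
    exponents s@(mkℚ p q-1 _) t@(mkℚ p′ q′-1 _) M h
      with ℚᵘ.drop-*≤* (ℚᵘ.≤-respʳ-≃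
             (ℚᵘ.≃-trans (ℚ.toℚᵘ-homo-+ t (+ 1 / suc M)) (ℚᵘ.+-congʳ (toℚᵘ t) (ℚ.toℚᵘ-fromℚᵘ (mkℚᵘ (+ 1) M))))
             (ℚ.toℚᵘ-mono-≤ h))
    ... | k = ℤ.drop‿+≤+ (subst₂ ℤ._≤_ (sym lhs) (sym rhs) (begin
        + x ℤ.* (q′ ℤ.* m) ℤ.+ + y′ ℤ.* (q ℤ.* m)
          ≡⟨ lem₁ (+ x) (+ y) (+ y′) q q′ m ⟩
        (+ x ℤ.- + y) ℤ.* (q′ ℤ.* m) ℤ.+ (+ y ℤ.* (q′ ℤ.* m) ℤ.+ + y′ ℤ.* (q ℤ.* m))
          ≤⟨ ℤ.+-monoˡ-≤ (+ y ℤ.* (q′ ℤ.* m) ℤ.+ + y′ ℤ.* (q ℤ.* m)) k′ ⟩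
        ((+ x′ ℤ.- + y′) ℤ.* m ℤ.+ + 1 ℤ.* q′) ℤ.* q ℤ.+ (+ y ℤ.* (q′ ℤ.* m) ℤ.+ + y′ ℤ.* (q ℤ.* m))
          ≡⟨ lem₂ (+ x′) (+ y) (+ y′) q q′ m ⟩
        + y ℤ.* (q′ ℤ.* m) ℤ.+ + x′ ℤ.* (q ℤ.* m) ℤ.+ q ℤ.* q′ ∎))
      where
      open ℤ.≤-Reasoning
      x y x′ y′ : ℕ
      x  = pos-part p
      y  = neg-part p
      x′ = pos-part p′
      y′ = neg-part p′
      q q′ m : ℤ
      q  = + suc q-1
      q′ = + suc q′-1
      m  = + suc M
      k′ : (+ x ℤ.- + y) ℤ.* (q′ ℤ.* m) ℤ.≤ ((+ x′ ℤ.- + y′) ℤ.* m ℤ.+ + 1 ℤ.* q′) ℤ.* q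
      k′ = subst₂ (λ i j → i ℤ.* (q′ ℤ.* m) ℤ.≤ (j ℤ.* m ℤ.+ + 1 ℤ.* q′) ℤ.* q) (pos-neg p) (pos-neg p′)
             (subst (λ i → p ℤ.* i ℤ.≤ (p′ ℤ.* m ℤ.+ + 1 ℤ.* q′) ℤ.* q) (ℤ.pos-* (suc q′-1) (suc M)) k)
      tri : ∀ a b c → + (a ℕ.* (b ℕ.* c)) ≡ + a ℤ.* (+ b ℤ.* + c)
      tri a b c = trans (ℤ.pos-* a (b ℕ.* c)) (cong (+ a ℤ.*_) (ℤ.pos-* b c))
      lhs : + (x ℕ.* (suc q′-1 ℕ.* suc M) ℕ.+ y′ ℕ.* (suc q-1 ℕ.* suc M)) ≡ + x ℤ.* (q′ ℤ.* m) ℤ.+ + y′ ℤ.* (q ℤ.* m)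
      lhs = trans (ℤ.pos-+ (x ℕ.* (suc q′-1 ℕ.* suc M)) (y′ ℕ.* (suc q-1 ℕ.* suc M)))
                  (cong₂ ℤ._+_ (tri x (suc q′-1) (suc M)) (tri y′ (suc q-1) (suc M)))
      rhs : + (y ℕ.* (suc q′-1 ℕ.* suc M) ℕ.+ x′ ℕ.* (suc q-1 ℕ.* suc M) ℕ.+ suc q-1 ℕ.* suc q′-1)
            ≡ + y ℤ.* (q′ ℤ.* m) ℤ.+ + x′ ℤ.* (q ℤ.* m) ℤ.+ q ℤ.* q′
      rhs = trans (ℤ.pos-+ (y ℕ.* (suc q′-1 ℕ.* suc M) ℕ.+ x′ ℕ.* (suc q-1 ℕ.* suc M)) (suc q-1 ℕ.* suc q′-1))
              (cong₂ ℤ._+_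
                (trans (ℤ.pos-+ (y ℕ.* (suc q′-1 ℕ.* suc M)) (x′ ℕ.* (suc q-1 ℕ.* suc M)))
                       (cong₂ ℤ._+_ (tri y (suc q′-1) (suc M)) (tri x′ (suc q-1) (suc M))))
                (ℤ.pos-* (suc q-1) (suc q′-1)))
      lem₁ : ∀ x y y′ q q′ m → x ℤ.* (q′ ℤ.* m) ℤ.+ y′ ℤ.* (q ℤ.* m) ≡
               (x ℤ.- y) ℤ.* (q′ ℤ.* m) ℤ.+ (y ℤ.* (q′ ℤ.* m) ℤ.+ y′ ℤ.* (q ℤ.* m))
      lem₁ = solve 6 (λ x y y′ q q′ m → x :* (q′ :* m) :+ y′ :* (q :* m) :=
               (x :- y) :* (q′ :* m) :+ (y :* (q′ :* m) :+ y′ :* (q :* m))) refl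
        where open ℤ-Solver.+-*-Solver
      lem₂ : ∀ x′ y y′ q q′ m →
               ((x′ ℤ.- y′) ℤ.* m ℤ.+ + 1 ℤ.* q′) ℤ.* q ℤ.+ (y ℤ.* (q′ ℤ.* m) ℤ.+ y′ ℤ.* (q ℤ.* m)) ≡
               y ℤ.* (q′ ℤ.* m) ℤ.+ x′ ℤ.* (q ℤ.* m) ℤ.+ q ℤ.* q′
      lem₂ = solve 6 (λ x′ y y′ q q′ m →
               ((x′ :- y′) :* m :+ con (+ 1) :* q′) :* q :+ (y :* (q′ :* m) :+ y′ :* (q :* m)) :=
               y :* (q′ :* m) :+ x′ :* (q :* m) :+ q :* q′) refl
        where open ℤ-Solver.+-*-Solver

    pow-step : ∀ s t K L M → s ≤ t + + 1 / suc M →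
               powApprox b s K ≤ (powApprox b t L + + 1 / suc L) * (1ℚ + + b / suc M)
    pow-step s@record{} t@record{} K L M h = begin
      + k / suc K                                       ≤⟨ /-mono-≤ k K (l ℕ.* (suc M ℕ.+ b)) (M ℕ.+ L ℕ.* suc M) ineq ⟩
      + (l ℕ.* (suc M ℕ.+ b)) / (suc L ℕ.* suc M)       ≡⟨ /-* l L (suc M ℕ.+ b) M ⟨
      (+ l / suc L) * (+ (suc M ℕ.+ b) / suc M)         ≡⟨ cong₂ _*_ eq₁ eq₂ ⟩
      (powApprox b t L + + 1 / suc L) * (1ℚ + + b / suc M) ∎
      where
      open ℚ.≤-Reasoning
      k l : ℕ
      k = powNum b s (suc K)
      l = suc (powNum b t (suc L))
      eq₁ : + l / suc L ≡ powApprox b t L + + 1 / suc L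
      eq₁ = trans (cong (λ i → + i / suc L) (ℕ.+-comm 1 (powNum b t (suc L)))) (sym (/-+ (powNum b t (suc L)) 1 L))
      eq₂ : + (suc M ℕ.+ b) / suc M ≡ 1ℚ + + b / suc M
      eq₂ = trans (sym (/-+ (suc M) b M)) (cong (_+ + b / suc M) (n/n≡1 M))
      ineq : k ℕ.* (suc L ℕ.* suc M) ℕ.≤ l ℕ.* (suc M ℕ.+ b) ℕ.* suc K
      ineq = subst₂ ℕ._≤_ (ℕ.*-assoc k (suc L) (suc M))
        (trans (ℕ.*-assoc l (suc K) (suc M ℕ.+ b)) (trans (cong (l ℕ.*_) (ℕ.*-comm (suc K) (suc M ℕ.+ b)))
          (sym (ℕ.*-assoc l (suc M ℕ.+ b) (suc K)))))
        (core b (suc M) k (suc K) (↧ₙ s) (pos-part (↥ s)) (neg-part (↥ s))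
           l (suc L) (↧ₙ t) (pos-part (↥ t)) (neg-part (↥ t))
           (powNum-below s (suc K)) (ℕ.<⇒≤ (ℕ.≰⇒> (powNum-above t (suc L)))) (exponents s t M h))

    pow-cauchy : ∀ x → IsCauchy x → IsCauchy (λ m → powApprox b (x m) m)
    pow-cauchy x cx = oneSided u λ ε 0<ε →
      let δ , 0<δ , Dδ≡  = divide D (½ * ε) 0<D (*-pos 0<½ 0<ε)
          M , 1/M≤δ      = archimedean δ 0<δ
          K , 1/K≤       = archimedean (½ * ε) (*-pos 0<½ 0<ε)
          N₂ , f         = cx (+ 1 / suc M) (0</ M)
          p₁ = λ {n} → ⊔-≤ˡ N₁ (N₂ ℕ.⊔ K) {n}
          p₂ = λ {n} h → ⊔-≤ˡ N₂ K {n} (⊔-≤ʳ N₁ (N₂ ℕ.⊔ K) h)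
          p₃ = λ {n} h → ⊔-≤ʳ N₂ K {n} (⊔-≤ʳ N₁ (N₂ ℕ.⊔ K) h)
      in N₁ ℕ.⊔ (N₂ ℕ.⊔ K) , λ m n h k →
         final ε δ M m n 0<δ Dδ≡ 1/M≤δ (ℚ.≤-trans (1/-antimono (p₃ k)) 1/K≤) (p₁ k)
           (near (x m) (x n) (f m n (p₂ h) (p₂ k)))
      where
      open ℚ.≤-Reasoning
      u : ℕ → ℚ
      u m = powApprox b (x m) m
      B : ℚ
      B = + b / 1
      0≤B : 0ℚ ≤ B
      0≤B = 0≤/ b 0
      0<1 : 0ℚ < 1ℚ
      0<1 = ℚ.positive⁻¹ 1ℚ
      0</ : ∀ M → 0ℚ < + 1 / suc M
      0</ M = ℚ.positive⁻¹ (+ 1 / suc M) {{ℚ.normalize-pos 1 (suc M)}}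
      near : ∀ p q {r} → ∣ p - q ∣ ≤ r → p ≤ q + r
      near p q {r} h = begin
        p             ≡⟨ lem p q ⟩
        q + (p - q)   ≤⟨ ℚ.+-monoʳ-≤ q (ℚ.≤-trans (≤∣∣ (p - q)) h) ⟩
        q + r         ∎
        where
        lem : ∀ p q → p ≡ q + (p - q)
        lem = solve 2 (λ p q → p := q :+ (p :- q)) refl
          where open ℚ-Solver.+-*-Solver
      c₁ : ∃[ N ] ∀ m n → N ℕ.≤ m → N ℕ.≤ n → ∣ x m - x n ∣ ≤ + 1 / 1
      c₁ = cx (+ 1 / 1) (0</ 0)
      N₁ : ℕ
      N₁ = proj₁ c₁
      W D : ℚ
      W = (u N₁ + + 1 / suc N₁) * (1ℚ + B) + 1ℚ
      D = W * (1ℚ + B)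
      0<1+B : 0ℚ < 1ℚ + B
      0<1+B = ℚ.+-mono-<-≤ 0<1 0≤B
      0<W : 0ℚ < W
      0<W = ℚ.+-mono-< (*-pos (ℚ.+-mono-≤-< (0≤/ (powNum b (x N₁) (suc N₁)) N₁) (0</ N₁)) 0<1+B) 0<1
      0<D : 0ℚ < D
      0<D = *-pos 0<W 0<1+B
      w≤W : ∀ n → N₁ ℕ.≤ n → u n + + 1 / suc n ≤ W
      w≤W n h = ℚ.+-mono-≤
        (pow-step (x n) (x N₁) n N₁ 0 (near (x n) (x N₁) (proj₂ c₁ n N₁ h ℕ.≤-refl)))
        (1/-antimono {0} {n} z≤n)
      split : ∀ M → + b / suc M ≡ B * (+ 1 / suc M)
      split M = sym (trans (/-* b 0 1 M) (cong₂ (λ i j → + i / suc j) (ℕ.*-identityʳ b) (ℕ.+-identityʳ M)))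
      final : ∀ ε δ M m n → 0ℚ < δ → D * δ ≡ ½ * ε → + 1 / suc M ≤ δ → + 1 / suc n ≤ ½ * ε →
              N₁ ℕ.≤ n → x m ≤ x n + + 1 / suc M → u m - u n ≤ ε
      final ε δ M m n 0<δ Dδ≡ 1/M≤δ 1/n≤ N₁≤n h = ≤+⇒-≤ (u m) (u n) (begin
        u m                                 ≤⟨ pow-step (x m) (x n) m n M h ⟩
        w * (1ℚ + + b / suc M)              ≡⟨ trans (ℚ.*-distribˡ-+ w 1ℚ (+ b / suc M)) (cong (_+ w * (+ b / suc M)) (ℚ.*-identityʳ w)) ⟩
        w + w * (+ b / suc M)               ≤⟨ ℚ.+-monoʳ-≤ w (*-mono-≤ (0≤/ b M) (ℚ.<⇒≤ 0<W) (w≤W n N₁≤n) b/M≤) ⟩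
        w + W * ((1ℚ + B) * δ)              ≡⟨ cong (λ i → w + i) (trans (sym (ℚ.*-assoc W (1ℚ + B) δ)) Dδ≡) ⟩
        w + ½ * ε                           ≤⟨ ℚ.+-monoˡ-≤ (½ * ε) (ℚ.+-monoʳ-≤ (u n) 1/n≤) ⟩
        u n + ½ * ε + ½ * ε                 ≡⟨ ℚ.+-assoc (u n) (½ * ε) (½ * ε) ⟩
        u n + (½ * ε + ½ * ε)               ≡⟨ cong (λ i → u n + i) (halves ε) ⟩
        u n + ε                             ∎)
        where
        w : ℚ
        w = u n + + 1 / suc n
        b/M≤ : + b / suc M ≤ (1ℚ + B) * δ
        b/M≤ = begin
          + b / suc M           ≡⟨ split M ⟩
          B * (+ 1 / suc M)     ≤⟨ *-mono-≤ (ℚ.<⇒≤ (0</ M)) (ℚ.<⇒≤ 0<1+B) B≤1+B 1/M≤δ ⟩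
          (1ℚ + B) * δ          ∎
          where
          B≤1+B : B ≤ 1ℚ + B
          B≤1+B = ℚ.≤-trans (ℚ.≤-reflexive (sym (ℚ.+-identityˡ B))) (ℚ.+-monoˡ-≤ B (ℚ.<⇒≤ 0<1))

  log-cauchy : ∀ b n → 2 ℕ.≤ b → 1 ℕ.≤ n → IsCauchy (λ m → + logNum b n (suc m) / suc m)
  log-cauchy b n 2≤b 1≤n = oneSided l λ ε 0<ε → let K , 1/K≤ε = archimedean ε 0<ε in
    K , λ p q _ K≤q → ≤+⇒-≤ (l p) (l q) (begin
      l p                                        ≤⟨ /-mono-≤ (a p) p (suc (a q)) q (log-step b n p q 2≤b 1≤n) ⟩
      + suc (a q) / suc q                        ≡⟨ trans (cong (λ i → + i / suc q) (ℕ.+-comm 1 (a q))) (sym (/-+ (a q) 1 q)) ⟩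
      l q + + 1 / suc q                          ≤⟨ ℚ.+-monoʳ-≤ (l q) (ℚ.≤-trans (1/-antimono K≤q) 1/K≤ε) ⟩
      l q + ε                                    ∎)
    where
    open ℚ.≤-Reasoning
    a : ℕ → ℕ
    a m = logNum b n (suc m)
    l : ℕ → ℚ
    l m = + a m / suc m

open ℝ-Lemmas

fromℚ : ℚ → ℝ
fromℚ q = mkℝ (λ _ → q) (const-cauchy q)

fromℕ : ℕ → ℝ
fromℕ n = fromℚ (+ n / 1)

infixl 6 _+ᴿ_
infixl 7 _*ᴿ_

_+ᴿ_ : ℝ → ℝ → ℝ
x +ᴿ y = mkℝ (λ n → seq x n + seq y n) (+-cauchy (seq x) (seq y) (cauchy x) (cauchy y))

_*ᴿ_ : ℝ → ℝ → ℝ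
x *ᴿ y = mkℝ (λ n → seq x n * seq y n) (*-cauchy (seq x) (seq y) (cauchy x) (cauchy y))

∣_∣ᴿ : ℝ → ℝ
∣ x ∣ᴿ = mkℝ (λ n → ∣ seq x n ∣) (∣∣-cauchy (seq x) (cauchy x))

infix 4 _⟶0

_⟶0 : (ℕ → ℝ) → Set
a ⟶0 = ∀ η → 0ℚ < η → ∃[ N ] ∀ n → N ℕ.≤ n → ∣ a n ∣ᴿ ≤ᴿ fromℚ η

-- Logarithm of n to base b, the limit of ⌊log_b (n ^ (m + 1))⌋ / (m + 1).
log : (b n : ℕ) .{{_ : NonTrivial b}} .{{_ : NonZero n}} → ℝ
log b n = mkℝ (λ m → + logNum b n (suc m) / suc m)
              (log-cauchy b n (ℕ.nonTrivial⇒n>1 b) (ℕ.>-nonZero⁻¹ n))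

infixr 8 _^ᴿ_

-- Real power of a positive integer, the limit of ⌊(m + 1) * b ^ xₘ⌋ / (m + 1).
_^ᴿ_ : (b : ℕ) .{{_ : NonZero b}} → ℝ → ℝ
b ^ᴿ x = mkℝ (λ m → powApprox b (seq x m) m) (pow-cauchy b (seq x) (cauchy x))

record Graph (n : ℕ) : Set₁ where
  field
    Adj     : Fin n → Fin n → Set
    adj?    : ∀ u v → Dec (Adj u v)
    adj-sym : ∀ {u v} → Adj u v → Adj v u
    irrefl  : ∀ {u} → ¬ Adj u u

open Graph

IsClique : ∀ {n} → Graph n → Subset n → Set
IsClique G s = ∀ u v → u ∈ s → v ∈ s → u ≢ v → Adj G u v

isClique? : ∀ {n} (G : Graph n) (s : Subset n) → Dec (IsClique G s)
isClique? G s = all? λ u → all? λ v →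
  (u ∈? s) →-dec (v ∈? s) →-dec ¬? (u ≟ᶠ v) →-dec adj? G u v

subsets : ∀ n → List (Subset n)
subsets zero    = [] ∷ []
subsets (suc n) = map (inside ∷_) (subsets n) ++ map (outside ∷_) (subsets n)

cliqueCount : ∀ {n} → Graph n → ℕ
cliqueCount {n} G = length (filter (isClique? G) (subsets n))

-- The colour of the edge {u , v} is colour u v; the values colour u u are
-- irrelevant, as colourGraph shows.
record Colouring (r n : ℕ) : Set where
  field
    colour     : Fin n → Fin n → Fin r
    colour-sym : ∀ u v → colour u v ≡ colour v u

open Colouring

colourGraph : ∀ {r n} → Colouring r n → Fin r → Graph n
colourGraph c i = record
  { Adj     = λ u v → u ≢ v × colour c u v ≡ i
  ; adj?    = λ u v → ¬? (u ≟ᶠ v) ×-dec (colour c u v ≟ᶠ i)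
  ; adj-sym = λ {u} {v} (u≢v , eq) → (λ v≡u → u≢v (sym v≡u)) , trans (colour-sym c v u) eq
  ; irrefl  = λ (u≢u , _) → u≢u refl
  }

cliqueProduct : ∀ {r n} → Colouring r n → ℕ
cliqueProduct {r} c = product (map (λ i → cliqueCount (colourGraph c i)) (allFin r))

≥3⇒nonTrivial : ∀ {r} → 3 ℕ.≤ r → NonTrivial r
≥3⇒nonTrivial r≥3 = ℕ.n>1⇒nonTrivial (ℕ.<⇒≤ r≥3)

≥3⇒nonZero : ∀ {r} → 3 ℕ.≤ r → NonZero r
≥3⇒nonZero r≥3 = ℕ.>-nonZero (ℕ.<⇒≤ (ℕ.<⇒≤ r≥3))

{-# OPTIONS --safe #-}

-- Lower bound.  If F(V) is the product of the clique counts inside V, then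
-- F(V) ≥ F(V - v) + F(N_j(v)) for every vertex v and colour j, since colour j gains the
-- cliques through v and no other count drops.  A majority colour gives |N_j(v)| ≥ |V - v| / r,
-- so F(V) ≥ r^(1 + 2 + ... + t) as soon as |V| ≥ t r^t.
--
-- Upper bound.  The product counts tuples (S_1, ..., S_r) of cliques, S_i of colour i; group
-- them by their union U.  Fix one tuple S with union U.  Another tuple T with union U meets it
-- in at most one vertex of S_i ∩ T_j for each i ≠ j, and is determined by these vertices and
-- by which of them T_i keeps.  A vertex of S_i that can be in T_j has colour j to all but r
-- vertices of S_j, and double counting shows that for each pair {i , j} one of the two sets of
-- such vertices has at most 2r elements.  So there are O(n^(r C 2)) tuples with union U.
--
-- Tightness of the upper bound.  Take parts A_1, ..., A_r, with A_j a clique of colour j, and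
-- disjoint classes B_kj ⊆ A_k for j < k, such that A_j and all the B_kj with k > j are joined
-- pairwise in colour j.  Then colour j has at least 2^|A_j| ∏_{k > j} |B_kj| cliques.
--
-- Tightness of the lower bound.  Use only three colours; a random colouring has
-- ∑_S 3^-(|S| choose 2) expected cliques of each of them, which is n^((1/2 + o(1)) log_3 n).

module Submission where

open import Defs

open import Data.Bool.Base using (Bool; true; false; if_then_else_; _∧_; _∨_)
import Data.Bool.Properties as Bool
open import Data.Empty using (⊥-elim)
open import Data.Fin.Base as Fin using (Fin; zero; suc; toℕ; _↑ˡ_; remQuot; combine)
import Data.Fin.Properties as Fin
open import Data.Fin.Subset using (Subset; inside; outside; _∈_)
open import Data.Fin.Subset.Properties using (_∈?_)
open import Data.Integer.Base as ℤ using (+_; -[1+_])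
import Data.Integer.Properties as ℤ
open import Data.List.Base as List using (List; []; _∷_; _++_; map; length; filter; allFin; concatMap; cartesianProductWith)
open import Data.List.Membership.Propositional using () renaming (_∈_ to _∈ₗ_)
open import Data.List.Membership.Propositional.Properties
import Data.List.Properties as List
open import Data.List.Relation.Unary.All as All using ([]; _∷_)
open import Data.List.Relation.Unary.AllPairs using ([]; _∷_)
open import Data.List.Relation.Unary.Any as Any using (here; there)
open import Data.List.Relation.Unary.Unique.Propositional using (Unique)
import Data.List.Relation.Unary.Unique.Propositional.Properties as Unique
open import Data.Maybe.Base using (Maybe; just; nothing)
import Data.Maybe.Properties as Maybe
open import Data.Nat.Base as ℕ hiding (_/_; _%_)
open import Data.Nat.Combinatorics using (_C_; nCk+nC[k+1]≡[n+1]C[k+1]; nC1≡n)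
open import Data.Nat.DivMod using (_mod_; m≡m%n+[m/n]*n; m%n<n; m/n*n≤m; [m+n]%n≡m%n; m<n⇒m%n≡m)
open import Data.Nat.ListAction using (product)
open import Data.Nat.Properties as ℕ
open import Data.Nat.Solver using (module +-*-Solver)
open import Data.Product.Base using (∃-syntax; _×_; _,_; proj₁; proj₂)
import Data.Product.Properties as Product
open import Data.Rational.Base as ℚ using (ℚ; mkℚ; 1ℚ; ½; _/_; ↥_; ↧ₙ_)
import Data.Rational.Properties as ℚ
import Data.Rational.Solver as ℚ-Solver
open import Data.Rational.Unnormalised.Base as ℚᵘ using (mkℚᵘ)
import Data.Rational.Unnormalised.Properties as ℚᵘ
open import Data.Sum.Base using (_⊎_; inj₁; inj₂)
open import Data.Unit.Base using (⊤; tt)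
open import Data.Vec.Base as Vec using (Vec; []; _∷_; here; there; lookup; tabulate)
import Data.Vec.Properties as Vec
open import Function.Base using (_∘_; id)
open import Level using (0ℓ)
open import Relation.Binary.Definitions using (tri<; tri≈; tri>)
open import Relation.Binary.PropositionalEquality
open import Relation.Nullary using (Dec; yes; no; ¬_; does)
open import Relation.Nullary.Decidable using (dec-true; dec-false; _×-dec_; _⊎-dec_; ¬?)
open import Relation.Unary using (Pred; Decidable; _≐_)

open import Algebra.Properties.Semiring.Sum +-*-semiring
  using (∑-comm) renaming (sum to ∑; sum-cong-≗ to ∑-cong; sum-replicate-zero to ∑-zero)
open import Algebra.Properties.CommutativeMonoid.Sum *-1-commutativeMonoid
  using () renaming (sum to ∏; sum-cong-≗ to ∏-cong; ∑-distrib-+ to ∏-*)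

open ℝ-Lemmas using (/-mono-≤; /-*; /-+; 1/-antimono; archimedean; powNum-below; powNum-above; ⊔-≤ˡ; ⊔-≤ʳ; ≤+⇒-≤)
open ℕ-Lemmas using (^-distribʳ-*; ^-cancelˡ-≤; k≤b^k; greatest-sound; greatest-max)

-- Real powers and logarithms

-- The combinatorics is about natural numbers, the theorem about Cauchy reals. The error terms are
-- chosen rational for each n, as a fraction minus 1/2, and n ^ x is compared with P through n ^ u
-- and P ^ v for a fraction u / v that bounds x. In the lower bound r ^ (t² / 2) is n ^ (log_r n /
-- 2) when r ^ t is about n; asking for t r ^ t ≤ n instead costs only lower-order terms, which the
-- error term absorbs. In the upper bound the recurring reason is that an edge has only one colour:
-- a clique of colour i and one of colour j share at most one vertex, and a pair x, y cannot be
-- joined in both colours, so in the double counting every pair is missed on one side. Of the two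
-- sets attached to a pair of colours one has at most 2r elements and the other at most n, so each
-- of the r C 2 pairs contributes O(n); the factor 2 ^ n counts the unions. The factor 3 log_3 r
-- arises because three colours have about n ^ (log_3 n / 2) cliques each and log_3 n = log_3 r ·
-- log_r n.

≤/⇒exponent : ∀ x u v → x ℚ.≤ + u / suc v →
  pos-part (↥ x) ℕ.* suc v ℕ.≤ neg-part (↥ x) ℕ.* suc v ℕ.+ u ℕ.* ↧ₙ x
≤/⇒exponent x@(mkℚ (+ p) q _) u v h
  with ℚᵘ.drop-*≤* (ℚᵘ.≤-respʳ-≃ (ℚ.toℚᵘ-fromℚᵘ (mkℚᵘ (+ u) v)) (ℚ.toℚᵘ-mono-≤ h))
... | k = ℤ.drop‿+≤+ (subst₂ ℤ._≤_ (sym (ℤ.pos-* p (suc v))) (sym (ℤ.pos-* u (suc q))) k)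
≤/⇒exponent (mkℚ -[1+ p ] q _) u v h = z≤n

/≤⇒exponent : ∀ x u v → + u / suc v ℚ.≤ x →
  neg-part (↥ x) ℕ.* suc v ℕ.+ u ℕ.* ↧ₙ x ℕ.≤ pos-part (↥ x) ℕ.* suc v
/≤⇒exponent x@(mkℚ (+ p) q _) u v h
  with ℚᵘ.drop-*≤* (ℚᵘ.≤-respˡ-≃ (ℚ.toℚᵘ-fromℚᵘ (mkℚᵘ (+ u) v)) (ℚ.toℚᵘ-mono-≤ h))
... | k = ℤ.drop‿+≤+ (subst₂ ℤ._≤_ (sym (ℤ.pos-* u (suc q))) (sym (ℤ.pos-* p (suc v))) k)
/≤⇒exponent x@(mkℚ -[1+ p ] q _) u v h
  with ℚᵘ.drop-*≤* (ℚᵘ.≤-respˡ-≃ (ℚ.toℚᵘ-fromℚᵘ (mkℚᵘ (+ u) v)) (ℚ.toℚᵘ-mono-≤ h))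
... | k with subst (ℤ._≤ (-[1+ p ] ℤ.* + suc v)) (sym (ℤ.pos-* u (suc q))) k
... | ()

raise : ∀ b k y j e → (k ^ e ℕ.* b ^ y) ^ j ≡ k ^ (e ℕ.* j) ℕ.* b ^ (y ℕ.* j)
raise b k y j e = trans (^-distribʳ-* (k ^ e) (b ^ y) j)
  (cong₂ ℕ._*_ (ℕ.^-*-assoc k e j) (ℕ.^-*-assoc b y j))

power-swap : ∀ m a b → (m ^ a) ^ b ≡ (m ^ b) ^ a
power-swap m a b = trans (ℕ.^-*-assoc m a b) (trans (cong (m ^_) (ℕ.*-comm a b)) (sym (ℕ.^-*-assoc m b a)))

module _ (b : ℕ) .{{_ : NonZero b}} where

  -- Powers of order q (v + 1) are compared, q being the denominator of x: `Below`, raised to v + 1,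
  -- controls the numerator k, and the hypothesis on P is raised to q; then a root is taken.
  powApprox-≤ : ∀ x m u v P → x ℚ.≤ + u / suc v → b ^ u ℕ.≤ P ^ suc v → powApprox b x m ℚ.≤ + P / 1
  powApprox-≤ x@record{} m u v P h g = /-mono-≤ k m P 0
    (subst (ℕ._≤ P ℕ.* suc m) (sym (ℕ.*-identityʳ k)) (^-cancelˡ-≤ (q ℕ.* suc v)
      (ℕ.*-cancelʳ-≤ _ _ (b ^ (y ℕ.* suc v)) (begin
        k ^ (q ℕ.* suc v) ℕ.* b ^ (y ℕ.* suc v)        ≡⟨ raise b k y (suc v) q ⟨
        (k ^ q ℕ.* b ^ y) ^ suc v                      ≤⟨ ℕ.^-monoˡ-≤ (suc v) (powNum-below b x (suc m)) ⟩
        (suc m ^ q ℕ.* b ^ z) ^ suc v                  ≡⟨ raise b (suc m) z (suc v) q ⟩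
        M ℕ.* b ^ (z ℕ.* suc v)                        ≤⟨ ℕ.*-monoʳ-≤ M (ℕ.^-monoʳ-≤ b (≤/⇒exponent x u v h)) ⟩
        M ℕ.* b ^ (y ℕ.* suc v ℕ.+ u ℕ.* q)            ≡⟨ cong (M ℕ.*_) (ℕ.^-distribˡ-+-* b (y ℕ.* suc v) (u ℕ.* q)) ⟩
        M ℕ.* (b ^ (y ℕ.* suc v) ℕ.* b ^ (u ℕ.* q))    ≤⟨ ℕ.*-monoʳ-≤ M (ℕ.*-monoʳ-≤ (b ^ (y ℕ.* suc v)) lem) ⟩
        M ℕ.* (b ^ (y ℕ.* suc v) ℕ.* P ^ (q ℕ.* suc v))
          ≡⟨ solve 3 (λ x y z → x :* (y :* z) := z :* x :* y) refl M (b ^ (y ℕ.* suc v)) (P ^ (q ℕ.* suc v)) ⟩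
        P ^ (q ℕ.* suc v) ℕ.* M ℕ.* b ^ (y ℕ.* suc v)  ≡⟨ cong (ℕ._* b ^ (y ℕ.* suc v)) (^-distribʳ-* P (suc m) (q ℕ.* suc v)) ⟨
        (P ℕ.* suc m) ^ (q ℕ.* suc v) ℕ.* b ^ (y ℕ.* suc v) ∎))))
    where
    open ℕ.≤-Reasoning
    open +-*-Solver
    k q y z M : ℕ
    k = powNum b x (suc m)
    q = ↧ₙ x
    y = neg-part (↥ x)
    z = pos-part (↥ x)
    M = suc m ^ (q ℕ.* suc v)
    instance
      b^≢0 : NonZero (b ^ (y ℕ.* suc v))
      b^≢0 = ℕ.m^n≢0 b (y ℕ.* suc v)
    lem : b ^ (u ℕ.* q) ℕ.≤ P ^ (q ℕ.* suc v)
    lem = subst₂ ℕ._≤_ (ℕ.^-*-assoc b u q)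
      (trans (ℕ.^-*-assoc P (suc v) q) (cong (P ^_) (ℕ.*-comm (suc v) q))) (ℕ.^-monoˡ-≤ q g)

  -- The term 1 / (m + 1) is the rounding of `powNum`: it is k + 1, not k, that violates `Below`.
  ≤-powApprox : ∀ x m u v P → + u / suc v ℚ.≤ x → P ^ suc v ℕ.≤ b ^ u →
                + P / 1 ℚ.≤ powApprox b x m ℚ.+ + 1 / suc m
  ≤-powApprox x@record{} m u v P h g = ℚ.≤-trans (/-mono-≤ P 0 (k ℕ.+ 1) m
    (subst (P ℕ.* suc m ℕ.≤_) (trans (ℕ.+-comm 1 k) (sym (ℕ.*-identityʳ (k ℕ.+ 1)))) (^-cancelˡ-≤ (q ℕ.* suc v)
      (ℕ.*-cancelʳ-≤ _ _ (b ^ (y ℕ.* suc v)) (begin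
        (P ℕ.* suc m) ^ (q ℕ.* suc v) ℕ.* b ^ (y ℕ.* suc v)  ≡⟨ cong (ℕ._* b ^ (y ℕ.* suc v)) (^-distribʳ-* P (suc m) (q ℕ.* suc v)) ⟩
        P ^ (q ℕ.* suc v) ℕ.* M ℕ.* b ^ (y ℕ.* suc v)
          ≡⟨ solve 3 (λ x y z → x :* (y :* z) := z :* x :* y) refl M (b ^ (y ℕ.* suc v)) (P ^ (q ℕ.* suc v)) ⟨
        M ℕ.* (b ^ (y ℕ.* suc v) ℕ.* P ^ (q ℕ.* suc v))  ≤⟨ ℕ.*-monoʳ-≤ M (ℕ.*-monoʳ-≤ (b ^ (y ℕ.* suc v)) lem) ⟩
        M ℕ.* (b ^ (y ℕ.* suc v) ℕ.* b ^ (u ℕ.* q))    ≡⟨ cong (M ℕ.*_) (ℕ.^-distribˡ-+-* b (y ℕ.* suc v) (u ℕ.* q)) ⟨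
        M ℕ.* b ^ (y ℕ.* suc v ℕ.+ u ℕ.* q)            ≤⟨ ℕ.*-monoʳ-≤ M (ℕ.^-monoʳ-≤ b (/≤⇒exponent x u v h)) ⟩
        M ℕ.* b ^ (z ℕ.* suc v)                        ≡⟨ raise b (suc m) z (suc v) q ⟨
        (suc m ^ q ℕ.* b ^ z) ^ suc v                  ≤⟨ ℕ.^-monoˡ-≤ (suc v) (ℕ.<⇒≤ (ℕ.≰⇒> (powNum-above b x (suc m)))) ⟩
        (suc k ^ q ℕ.* b ^ y) ^ suc v                  ≡⟨ raise b (suc k) y (suc v) q ⟩
        suc k ^ (q ℕ.* suc v) ℕ.* b ^ (y ℕ.* suc v)    ∎)))))
    (ℚ.≤-reflexive (sym (/-+ k 1 m)))
    where
    open ℕ.≤-Reasoning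
    open +-*-Solver
    k q y z M : ℕ
    k = powNum b x (suc m)
    q = ↧ₙ x
    y = neg-part (↥ x)
    z = pos-part (↥ x)
    M = suc m ^ (q ℕ.* suc v)
    instance
      b^≢0 : NonZero (b ^ (y ℕ.* suc v))
      b^≢0 = ℕ.m^n≢0 b (y ℕ.* suc v)
    lem : P ^ (q ℕ.* suc v) ℕ.≤ b ^ (u ℕ.* q)
    lem = subst₂ ℕ._≤_ (trans (ℕ.^-*-assoc P (suc v) q) (cong (P ^_) (ℕ.*-comm (suc v) q)))
      (ℕ.^-*-assoc b u q) (ℕ.^-monoˡ-≤ q g)

≤⇒≤ᴿ : ∀ x y → (∀ n → seq x n ℚ.≤ seq y n) → x ≤ᴿ y
≤⇒≤ᴿ x y h ε 0<ε = 0 , λ n _ → ℚ.≤-trans (h n)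
  (ℚ.≤-trans (ℚ.≤-reflexive (sym (ℚ.+-identityʳ (seq y n)))) (ℚ.+-monoʳ-≤ (seq y n) (ℚ.<⇒≤ 0<ε)))

fromℕ-*-≤ : ∀ a k b → a ℕ.≤ k ℕ.* b → fromℕ a ≤ᴿ fromℕ k *ᴿ fromℕ b
fromℕ-*-≤ a k b h = ≤⇒≤ᴿ (fromℕ a) (fromℕ k *ᴿ fromℕ b) λ _ →
  ℚ.≤-trans (/-mono-≤ a 0 (k ℕ.* b) 0 (ℕ.*-monoˡ-≤ 1 h)) (ℚ.≤-reflexive (sym (/-* k 0 b 0)))

1/-*-≤ : ∀ D b a → b ℕ.≤ a ℕ.* suc D → fromℚ (+ 1 / suc D) *ᴿ fromℕ b ≤ᴿ fromℕ a
1/-*-≤ D b a h = ≤⇒≤ᴿ (fromℚ (+ 1 / suc D) *ᴿ fromℕ b) (fromℕ a) λ _ →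
  ℚ.≤-trans (ℚ.≤-reflexive (/-* 1 D b 0)) (/-mono-≤ (1 ℕ.* b) (D ℕ.* 1) a 0
    (subst₂ ℕ._≤_ (solve 1 (λ b → b := con 1 :* b :* con 1) refl b)
       (solve 2 (λ a D → a :* (con 1 :+ D) := a :* (con 1 :+ D :* con 1)) refl a D) h))
  where open +-*-Solver

0<1/ : ∀ D → fromℕ 0 <ᴿ fromℚ (+ 1 / suc D)
0<1/ D = + 1 / suc D , ℚ.positive⁻¹ (+ 1 / suc D) {{ℚ.normalize-pos 1 (suc D)}} ,
  0 , λ _ _ → ℚ.≤-reflexive (ℚ.+-identityˡ (+ 1 / suc D))

0<fromℕ : ∀ k → 1 ℕ.≤ k → fromℕ 0 <ᴿ fromℕ k
0<fromℕ k h = 1ℚ , ℚ.positive⁻¹ 1ℚ , 0 , λ _ _ → /-mono-≤ 1 0 k 0 (ℕ.*-monoˡ-≤ 1 h)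

½+[x-½] : ∀ x → ½ ℚ.+ (x ℚ.- ½) ≡ x
½+[x-½] x = solve 2 (λ h x → h :+ (x :- h) := x) refl ½ x
  where open ℚ-Solver.+-*-Solver

∣x-y∣≤ : ∀ x y {e} → x ℚ.≤ y ℚ.+ e → y ℚ.≤ x ℚ.+ e → ℚ.∣ x ℚ.- y ∣ ℚ.≤ e
∣x-y∣≤ x y h k with ℚ.∣p∣≡p∨∣p∣≡-p (x ℚ.- y)
... | inj₁ eq = ℚ.≤-trans (ℚ.≤-reflexive eq) (≤+⇒-≤ x y h)
... | inj₂ eq = ℚ.≤-trans (ℚ.≤-reflexive (trans eq (solve 2 (λ x y → :- (x :- y) := y :- x) refl x y))) (≤+⇒-≤ y x k)
  where open ℚ-Solver.+-*-Solver

-- One half is `suc w` over the same denominator, so the distance is at most d over it. This serves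
-- both error terms, with w of the order of √(log_r n) and of log_3 n respectively.
near-½ : ∀ u w d M → u ℕ.≤ suc w ℕ.+ d → suc w ℕ.≤ u ℕ.+ d → d ℕ.* suc M ℕ.≤ 2 ℕ.* suc w →
         ℚ.∣ + u / (2 ℕ.* suc w) ℚ.- ½ ∣ ℚ.≤ + 1 / suc M
near-½ u w d M u≤ w≤ d≤ = ∣x-y∣≤ (+ u / suc W) ½
  (begin
    + u / suc W                                   ≤⟨ /-mono-≤ u W (suc w ℕ.+ d) W (ℕ.*-monoˡ-≤ (suc W) u≤) ⟩
    + (suc w ℕ.+ d) / suc W                       ≡⟨ /-+ (suc w) d W ⟨
    + suc w / suc W ℚ.+ + d / suc W               ≤⟨ ℚ.+-mono-≤ half d/W ⟩
    ½ ℚ.+ + 1 / suc M                             ∎)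
  (begin
    ½                                             ≤⟨ half′ ⟩
    + suc w / suc W                               ≤⟨ /-mono-≤ (suc w) W (u ℕ.+ d) W (ℕ.*-monoˡ-≤ (suc W) w≤) ⟩
    + (u ℕ.+ d) / suc W                           ≡⟨ /-+ u d W ⟨
    + u / suc W ℚ.+ + d / suc W                   ≤⟨ ℚ.+-monoʳ-≤ (+ u / suc W) d/W ⟩
    + u / suc W ℚ.+ + 1 / suc M                   ∎)
  where
  open ℚ.≤-Reasoning
  W : ℕ
  W = w ℕ.+ suc (w ℕ.+ 0)
  half : + suc w / suc W ℚ.≤ ½
  half = /-mono-≤ (suc w) W 1 1 (ℕ.≤-reflexive (trans (ℕ.*-comm (suc w) 2) (sym (ℕ.*-identityˡ (suc W)))))
  half′ : ½ ℚ.≤ + suc w / suc W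
  half′ = /-mono-≤ 1 1 (suc w) W (ℕ.≤-reflexive (trans (ℕ.*-identityˡ (suc W)) (ℕ.*-comm 2 (suc w))))
  d/W : + d / suc W ℚ.≤ + 1 / suc M
  d/W = /-mono-≤ d W 1 M (ℕ.≤-trans d≤ (ℕ.≤-reflexive (sym (ℕ.*-identityˡ (suc W)))))

⟶0-from-½ : (x : ℕ → ℚ) → (∀ M → ∃[ N ] ∀ n → N ℕ.≤ n → ℚ.∣ x n ℚ.- ½ ∣ ℚ.≤ + 1 / suc M) →
            (λ n → fromℚ (x n ℚ.- ½)) ⟶0
⟶0-from-½ x h η 0<η with archimedean η 0<η
... | M , M≤ with h M
...   | N , g = N , λ n N≤n → ≤⇒≤ᴿ ∣ fromℚ (x n ℚ.- ½) ∣ᴿ (fromℚ η) λ _ → ℚ.≤-trans (g n N≤n) M≤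

logNum-lower : ∀ b n M .{{_ : NonZero n}} → b ^ logNum b n M ℕ.≤ n ^ M
logNum-lower b n M = greatest-sound (λ a → b ^ a ℕ.≤? n ^ M) (n ^ M) (ℕ.m^n>0 n M)

logNum-upper : ∀ b n M → 2 ℕ.≤ b → n ^ M ℕ.< b ^ suc (logNum b n M)
logNum-upper b n M 2≤b = ℕ.≰⇒> λ h → ℕ.1+n≰n
  (greatest-max (λ a → b ^ a ℕ.≤? n ^ M) (n ^ M) (ℕ.≤-trans (ℕ.<⇒≤ (k≤b^k b 2≤b (suc (logNum b n M)))) h) h)

^-cancelʳ-≤ : ∀ b {m n} → 2 ℕ.≤ b → b ^ m ℕ.≤ b ^ n → m ℕ.≤ n
^-cancelʳ-≤ b {m} {n} 2≤b h with m ℕ.≤? n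
... | yes m≤n = m≤n
... | no  m≰n with () ← ℕ.<⇒≱ (ℕ.^-monoʳ-< b 2≤b (ℕ.≰⇒> m≰n)) h

logNum≤ : ∀ b n M k .{{_ : NonZero n}} → 2 ℕ.≤ b → n ℕ.≤ b ^ k → logNum b n M ℕ.≤ k ℕ.* M
logNum≤ b n M k 2≤b h = ^-cancelʳ-≤ b 2≤b (ℕ.≤-trans (logNum-lower b n M)
  (ℕ.≤-trans (ℕ.^-monoˡ-≤ M h) (ℕ.≤-reflexive (ℕ.^-*-assoc b k M))))

^ᴿ-≤ : ∀ b .{{_ : NonZero b}} x u v P → (∀ m → seq x m ℚ.≤ + u / suc v) → b ^ u ℕ.≤ P ^ suc v →
       b ^ᴿ x ≤ᴿ fromℕ P
^ᴿ-≤ b x u v P h g = ≤⇒≤ᴿ (b ^ᴿ x) (fromℕ P) λ m → powApprox-≤ b (seq x m) m u v P (h m) g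

-- Bounding x from some index on is enough, as `≤ᴿ` only looks at large indices; the rounding 1 / (m
-- + 1) goes into its tolerance.
≤-^ᴿ : ∀ b .{{_ : NonZero b}} x u v P → ∃[ N ] (∀ m → N ℕ.≤ m → + u / suc v ℚ.≤ seq x m) → P ^ suc v ℕ.≤ b ^ u →
       fromℕ P ≤ᴿ b ^ᴿ x
≤-^ᴿ b x u v P (N , h) g ε 0<ε = N ℕ.⊔ proj₁ small , λ m N≤m →
  ℚ.≤-trans (≤-powApprox b (seq x m) m u v P (h m (⊔-≤ˡ N (proj₁ small) N≤m)) g)
    (ℚ.+-monoʳ-≤ (powApprox b (seq x m) m) (ℚ.≤-trans (1/-antimono (⊔-≤ʳ N (proj₁ small) N≤m)) (proj₂ small)))
  where
  small : ∃[ K ] + 1 / suc K ℚ.≤ ε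
  small = archimedean ε 0<ε

seq-log : ∀ b n .{{_ : NonTrivial b}} .{{_ : NonZero n}} m → seq (log b n) m ≡ + logNum b n (suc m) / suc m
seq-log b n m = refl

seq-* : ∀ x y m → seq (x *ᴿ y) m ≡ seq x m ℚ.* seq y m
seq-* x y m = refl

seq-½+ : ∀ e m → seq (fromℚ ½ +ᴿ fromℚ (e ℚ.- ½)) m ≡ e
seq-½+ e m = ½+[x-½] e

-- The error term of the lower bound

module LowerExponent (r : ℕ) (2≤r : 2 ℕ.≤ r) where

  private instance
    r≢0 : NonZero r
    r≢0 = ℕ.>-nonZero (ℕ.<⇒≤ 2≤r)

  -- ⌊√(log_r n)⌋, for n ≥ 1.
  √log : ℕ → ℕ
  √log n = greatest (λ s → r ^ (s ℕ.* s) ℕ.≤? n) n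

  s≤s² : ∀ s → s ℕ.≤ s ℕ.* s
  s≤s² zero    = z≤n
  s≤s² (suc s) = ℕ.m≤m*n (suc s) (suc s)

  s≤r^s² : ∀ s → s ℕ.≤ r ^ (s ℕ.* s)
  s≤r^s² s = ℕ.≤-trans (s≤s² s) (ℕ.<⇒≤ (k≤b^k r 2≤r (s ℕ.* s)))

  √log-max : ∀ n s → r ^ (s ℕ.* s) ℕ.≤ n → s ℕ.≤ √log n
  √log-max n s h = greatest-max (λ s → r ^ (s ℕ.* s) ℕ.≤? n) n (ℕ.≤-trans (s≤r^s² s) h) h

  √log-lower : ∀ n .{{_ : NonZero n}} → r ^ (√log n ℕ.* √log n) ℕ.≤ n
  √log-lower n = greatest-sound (λ s → r ^ (s ℕ.* s) ℕ.≤? n) n (ℕ.>-nonZero⁻¹ n)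

  √log-upper : ∀ n → n ℕ.≤ r ^ (suc (√log n) ℕ.* suc (√log n))
  √log-upper n = ℕ.<⇒≤ (ℕ.≰⇒> λ h → ℕ.1+n≰n (√log-max n (suc (√log n)) h))

  -- For s = √log n, n ≤ r ^ (s + 1)² and t = s² - 2 s satisfies t r ^ t ≤ n, so the lower
  -- bound allows any exponent e with 2 e (s + 1)⁴ ≤ t².
  abstract
    exponent : ℕ → ℚ
    exponent n = + (√log n ∸ 7) / (2 ℕ.* suc (√log n))

    exponent-≡ : ∀ n → exponent n ≡ + (√log n ∸ 7) / (2 ℕ.* suc (√log n))
    exponent-≡ n = refl

  exponent-limit : ∀ M → ∃[ N ] ∀ n → N ℕ.≤ n → ℚ.∣ exponent n ℚ.- ½ ∣ ℚ.≤ + 1 / suc M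
  exponent-limit M = r ^ (S ℕ.* S) , λ n N≤n → subst (λ q → ℚ.∣ q ℚ.- ½ ∣ ℚ.≤ + 1 / suc M) (sym (exponent-≡ n))
    (near-½ (√log n ∸ 7) (√log n) 8 M
      (ℕ.≤-trans (ℕ.m∸n≤m (√log n) 7) (ℕ.≤-trans (ℕ.n≤1+n (√log n)) (ℕ.m≤m+n (suc (√log n)) 8)))
      (ℕ.≤-trans (s≤s (ℕ.m≤n+m∸n (√log n) 7)) (ℕ.≤-reflexive (ℕ.+-comm 8 (√log n ∸ 7))))
      (ℕ.≤-trans (ℕ.≤-reflexive (solve 1 (λ m → con 8 :* m := con 2 :* (con 4 :* m)) refl (suc M)))
        (ℕ.*-monoʳ-≤ 2 (ℕ.m≤n⇒m≤1+n (√log-max n S N≤n)))))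
    where
    open +-*-Solver
    -- `near-½` is used with d = 8, the slack in s + 1 ≤ (s ∸ 7) + 8, and asks for 8 (M + 1) ≤ 2 (s
    -- + 1); s ≥ S is enough.
    S : ℕ
    S = 4 ℕ.* suc M

  ε : ℕ → ℝ
  ε n = fromℚ (exponent n ℚ.- ½)

  ε⟶0 : ε ⟶0
  ε⟶0 = ⟶0-from-½ exponent exponent-limit

  depth : ℕ → ℕ
  depth s = s ℕ.* s ∸ 2 ℕ.* s

  -- For s ≥ 2, t ≤ s² ≤ r ^ (2 s), so t r ^ t ≤ r ^ (2 s + t) = r ^ (s²) ≤ n: the 2 s subtracted in
  -- `depth` pays for the factor t. For s ≤ 1 the depth is 0.
  depth-admissible : ∀ n .{{_ : NonZero n}} → depth (√log n) ℕ.* r ^ depth (√log n) ℕ.≤ n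
  depth-admissible n with √log n | √log-lower n
  ... | 0 | _ = z≤n
  ... | 1 | _ = z≤n
  ... | s@(suc (suc k)) | h = begin
    t ℕ.* r ^ t                      ≤⟨ ℕ.*-monoˡ-≤ (r ^ t) t≤ ⟩
    r ^ (2 ℕ.* s) ℕ.* r ^ t          ≡⟨ ℕ.^-distribˡ-+-* r (2 ℕ.* s) t ⟨
    r ^ (2 ℕ.* s ℕ.+ t)              ≡⟨ cong (r ^_) (ℕ.m+[n∸m]≡n {2 ℕ.* s} {s ℕ.* s} (ℕ.*-monoˡ-≤ s {2} {s} (s≤s (s≤s z≤n)))) ⟩
    r ^ (s ℕ.* s)                    ≤⟨ h ⟩
    n                                ∎
    where
    open ℕ.≤-Reasoning
    t : ℕ
    t = depth s
    s≤ : s ℕ.≤ r ^ s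
    s≤ = ℕ.<⇒≤ (k≤b^k r 2≤r s)
    t≤ : t ℕ.≤ r ^ (2 ℕ.* s)
    t≤ = begin
      t                 ≤⟨ ℕ.m∸n≤m (s ℕ.* s) (2 ℕ.* s) ⟩
      s ℕ.* s           ≤⟨ ℕ.*-mono-≤ s≤ s≤ ⟩
      r ^ s ℕ.* r ^ s   ≡⟨ ℕ.^-distribˡ-+-* r s s ⟨
      r ^ (s ℕ.+ s)     ≡⟨ cong (λ k → r ^ (s ℕ.+ k)) (ℕ.+-identityʳ s) ⟨
      r ^ (2 ℕ.* s)     ∎

  -- As polynomials in s both sides begin with s⁴ - 4 s³; 7 is the least natural number for which
  -- the left-hand side does not win for large s. At s = 7 + k the difference is the polynomial
  -- added in `large`.
  depth-large : ∀ s → (s ∸ 7) ℕ.* (suc s ℕ.* suc s ℕ.* suc s) ℕ.≤ depth s ℕ.* depth s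
  depth-large s with 7 ℕ.≤? s
  ... | no  7≰s rewrite ℕ.m≤n⇒m∸n≡0 (ℕ.<⇒≤ (ℕ.≰⇒> 7≰s)) = z≤n
  ... | yes 7≤s = subst (λ s → (s ∸ 7) ℕ.* (suc s ℕ.* suc s ℕ.* suc s) ℕ.≤ depth s ℕ.* depth s)
                    (ℕ.m+[n∸m]≡n 7≤s) (large (s ∸ 7))
    where
    open ℕ.≤-Reasoning
    open +-*-Solver
    depth-eq : ∀ k → depth (7 ℕ.+ k) ≡ (7 ℕ.+ k) ℕ.* (5 ℕ.+ k)
    depth-eq k = trans (cong (_∸ 2 ℕ.* (7 ℕ.+ k))
      (solve 1 (λ k → (con 7 :+ k) :* (con 7 :+ k) := (con 7 :+ k) :* (con 5 :+ k) :+ con 2 :* (con 7 :+ k)) refl k))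
      (ℕ.m+n∸n≡m ((7 ℕ.+ k) ℕ.* (5 ℕ.+ k)) (2 ℕ.* (7 ℕ.+ k)))
    large : ∀ k → k ℕ.* ((8 ℕ.+ k) ℕ.* (8 ℕ.+ k) ℕ.* (8 ℕ.+ k)) ℕ.≤ depth (7 ℕ.+ k) ℕ.* depth (7 ℕ.+ k)
    large k = begin
      k ℕ.* ((8 ℕ.+ k) ℕ.* (8 ℕ.+ k) ℕ.* (8 ℕ.+ k))
        ≤⟨ ℕ.m≤m+n _ (22 ℕ.* (k ℕ.* k) ℕ.+ 328 ℕ.* k ℕ.+ 1225) ⟩
      k ℕ.* ((8 ℕ.+ k) ℕ.* (8 ℕ.+ k) ℕ.* (8 ℕ.+ k)) ℕ.+ (22 ℕ.* (k ℕ.* k) ℕ.+ 328 ℕ.* k ℕ.+ 1225)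
        ≡⟨ solve 1 (λ k → k :* ((con 8 :+ k) :* (con 8 :+ k) :* (con 8 :+ k)) :+ (con 22 :* (k :* k) :+ con 328 :* k :+ con 1225)
             := (con 7 :+ k) :* (con 5 :+ k) :* ((con 7 :+ k) :* (con 5 :+ k))) refl k ⟩
      (7 ℕ.+ k) ℕ.* (5 ℕ.+ k) ℕ.* ((7 ℕ.+ k) ℕ.* (5 ℕ.+ k))
        ≡⟨ cong₂ ℕ._*_ (depth-eq k) (depth-eq k) ⟨
      depth (7 ℕ.+ k) ℕ.* depth (7 ℕ.+ k) ∎

  -- With q = (s + 1)², n ≤ r ^ q gives log_r n ≤ q, so the exponent is at most u q / (2 (s + 1)).
  -- Bounding the base by r ^ q as well leaves u (s + 1)⁴ ≤ t² (s + 1), which is `depth-large`.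
  power-≤ : ∀ n .{{_ : NonZero n}} P → (∀ t → t ℕ.* r ^ t ℕ.≤ n → r ^ (t ℕ.* t) ℕ.≤ P ℕ.* P) →
    .{{_ : NonTrivial r}} → n ^ᴿ ((fromℚ ½ +ᴿ ε n) *ᴿ log r n) ≤ᴿ fromℕ P
  power-≤ n P h = ^ᴿ-≤ n x (u ℕ.* (suc s ℕ.* suc s)) W P bound n^≤
    where
    x : ℝ
    x = (fromℚ ½ +ᴿ ε n) *ᴿ log r n
    s u t W : ℕ
    s = √log n
    u = s ∸ 7
    t = depth s
    -- `suc W` computes to `2 * suc s`, the denominator in `exponent n`.
    W = s ℕ.+ suc (s ℕ.+ 0)
    bound : ∀ m → seq x m ℚ.≤ + (u ℕ.* (suc s ℕ.* suc s)) / suc W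
    bound m = begin
      seq x m
        ≡⟨ seq-* (fromℚ ½ +ᴿ ε n) (log r n) m ⟩
      seq (fromℚ ½ +ᴿ ε n) m ℚ.* seq (log r n) m
        ≡⟨ cong₂ ℚ._*_ (trans (seq-½+ (exponent n) m) (exponent-≡ n)) (seq-log r n m) ⟩
      (+ u / suc W) ℚ.* (+ B / suc m)                ≡⟨ /-* u W B m ⟩
      + (u ℕ.* B) / (suc W ℕ.* suc m)                ≤⟨ /-mono-≤ (u ℕ.* B) (m ℕ.+ W ℕ.* suc m) (u ℕ.* q) W ineq ⟩
      + (u ℕ.* q) / suc W                            ∎
      where
      open ℚ.≤-Reasoning
      B q : ℕ
      B = logNum r n (suc m)
      q = suc s ℕ.* suc s
      ineq : u ℕ.* B ℕ.* suc W ℕ.≤ u ℕ.* q ℕ.* (suc W ℕ.* suc m)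
      ineq = ℕ.≤-trans (ℕ.*-monoˡ-≤ (suc W) (ℕ.*-monoʳ-≤ u (logNum≤ r n (suc m) q 2≤r (√log-upper n))))
        (ℕ.≤-reflexive (solve 4 (λ u q m w → u :* (q :* m) :* w := u :* q :* (w :* m)) refl u q (suc m) (suc W)))
        where open +-*-Solver
    n^≤ : n ^ (u ℕ.* (suc s ℕ.* suc s)) ℕ.≤ P ^ suc W
    n^≤ = begin
      n ^ (u ℕ.* q)                   ≤⟨ ℕ.^-monoˡ-≤ (u ℕ.* q) (√log-upper n) ⟩
      (r ^ q) ^ (u ℕ.* q)             ≡⟨ ℕ.^-*-assoc r q (u ℕ.* q) ⟩
      r ^ (q ℕ.* (u ℕ.* q))           ≡⟨ cong (r ^_) (solve 2 (λ s u → s :* s :* (u :* (s :* s)) := u :* (s :* s :* s) :* s) refl (suc s) u) ⟩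
      r ^ (u ℕ.* (suc s ℕ.* suc s ℕ.* suc s) ℕ.* suc s)
                                      ≤⟨ ℕ.^-monoʳ-≤ r (ℕ.*-monoˡ-≤ (suc s) (depth-large s)) ⟩
      r ^ (t ℕ.* t ℕ.* suc s)         ≡⟨ ℕ.^-*-assoc r (t ℕ.* t) (suc s) ⟨
      (r ^ (t ℕ.* t)) ^ suc s         ≤⟨ ℕ.^-monoˡ-≤ (suc s) (h t (depth-admissible n)) ⟩
      (P ℕ.* P) ^ suc s               ≡⟨ cong (λ x → (P ℕ.* x) ^ suc s) (ℕ.*-identityʳ P) ⟨
      (P ^ 2) ^ suc s                 ≡⟨ ℕ.^-*-assoc P 2 (suc s) ⟩
      P ^ suc W                       ∎
      where
      open ℕ.≤-Reasoning
      open +-*-Solver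
      q : ℕ
      q = suc s ℕ.* suc s

2≤3 : 2 ≤ 3
2≤3 = s≤s (s≤s z≤n)

-- The error term of the example with few cliques

module UpperExponent where

  -- ⌊log_3 n⌋ - 1, for n ≥ 3.
  ilog : ℕ → ℕ
  ilog n = greatest (λ t → 3 ^ suc t ℕ.≤? n) n

  ilog-max : ∀ n t → 3 ^ suc t ℕ.≤ n → t ℕ.≤ ilog n
  ilog-max n t h = greatest-max (λ t → 3 ^ suc t ℕ.≤? n) n
    (ℕ.≤-trans (ℕ.<⇒≤ (k≤b^k 3 (s≤s (s≤s z≤n)) t)) (ℕ.≤-trans (ℕ.^-monoʳ-≤ 3 (ℕ.n≤1+n t)) h)) h

  ilog-lower : ∀ n → 3 ℕ.≤ n → 3 ^ suc (ilog n) ℕ.≤ n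
  ilog-lower n 3≤n = greatest-sound (λ t → 3 ^ suc t ℕ.≤? n) n 3≤n

  ilog-upper : ∀ n → n ℕ.< 3 ^ suc (suc (ilog n))
  ilog-upper n = ℕ.≰⇒> λ h → ℕ.1+n≰n (ilog-max n (suc (ilog n)) h)

  -- The exponent is 1/2 + D / a for a = `suc (ilog n)`. Multiplied by 3 a² it gives 3 a² / 2 + 3 D
  -- a, and the second term makes room for everything linear in log n.
  module Exponent (D : ℕ) where

    abstract
      exponent : ℕ → ℚ
      exponent n = + (suc (ilog n) ℕ.+ 2 ℕ.* D) / (2 ℕ.* suc (ilog n))

      exponent-≡ : ∀ n → exponent n ≡ + (suc (ilog n) ℕ.+ 2 ℕ.* D) / (2 ℕ.* suc (ilog n))
      exponent-≡ n = refl

    exponent-limit : ∀ M → ∃[ N ] ∀ n → N ℕ.≤ n → ℚ.∣ exponent n ℚ.- ½ ∣ ℚ.≤ + 1 / suc M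
    exponent-limit M = 3 ^ suc T , λ n N≤n → subst (λ q → ℚ.∣ q ℚ.- ½ ∣ ℚ.≤ + 1 / suc M) (sym (exponent-≡ n))
      (near-½ (suc (ilog n) ℕ.+ 2 ℕ.* D) (ilog n) (2 ℕ.* D) M ℕ.≤-refl
        (ℕ.≤-trans (ℕ.m≤m+n _ (2 ℕ.* D)) (ℕ.m≤m+n _ (2 ℕ.* D)))
        (ℕ.≤-trans (ℕ.≤-reflexive (ℕ.*-assoc 2 D (suc M)))
          (ℕ.*-monoʳ-≤ 2 (ℕ.m≤n⇒m≤1+n (ilog-max n T N≤n)))))
      where
      T : ℕ
      T = D ℕ.* suc M

    δ : ℕ → ℝ
    δ n = fromℚ (exponent n ℚ.- ½)

    δ⟶0 : δ ⟶0
    δ⟶0 = ⟶0-from-½ exponent exponent-limit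

    module _ (r n : ℕ) .{{_ : NonZero n}} (2≤r : 2 ℕ.≤ r) (3≤n : 3 ℕ.≤ n) where

      private
        instance
          r≢0 : NonZero r
          r≢0 = ℕ.>-nonZero (ℕ.<⇒≤ 2≤r)

        a : ℕ
        a = suc (ilog n)

        A B : ℕ → ℕ
        A M = logNum 3 r M
        B M = logNum r n M

      -- This is log_3 r · log_r n = log_3 n, with both floors raised by one and with 3 ^ a ≤ n.
      logs-product : ∀ M → a ℕ.* (M ℕ.* M) ℕ.≤ suc (A M) ℕ.* suc (B M)
      logs-product M = ^-cancelʳ-≤ 3 2≤3 (begin
        3 ^ (a ℕ.* (M ℕ.* M))         ≡⟨ ℕ.^-*-assoc 3 a (M ℕ.* M) ⟨
        (3 ^ a) ^ (M ℕ.* M)           ≤⟨ ℕ.^-monoˡ-≤ (M ℕ.* M) (ilog-lower n 3≤n) ⟩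
        n ^ (M ℕ.* M)                 ≡⟨ ℕ.^-*-assoc n M M ⟨
        (n ^ M) ^ M                   ≤⟨ ℕ.^-monoˡ-≤ M (ℕ.<⇒≤ (logNum-upper r n M 2≤r)) ⟩
        (r ^ suc (B M)) ^ M           ≡⟨ power-swap r (suc (B M)) M ⟩
        (r ^ M) ^ suc (B M)           ≤⟨ ℕ.^-monoˡ-≤ (suc (B M)) (ℕ.<⇒≤ (logNum-upper 3 r M 2≤3)) ⟩
        (3 ^ suc (A M)) ^ suc (B M)   ≡⟨ ℕ.^-*-assoc 3 (suc (A M)) (suc (B M)) ⟩
        3 ^ (suc (A M) ℕ.* suc (B M)) ∎)
        where open ℕ.≤-Reasoning

      err : ℕ
      err = suc (r ℕ.+ n)

      -- The rounding costs a multiple of M against a main term of order M², so it disappears in the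
      -- limit.
      logs-bound : ∀ m → let M = suc m in a ℕ.* (M ℕ.* M) ℕ.≤ A M ℕ.* B M ℕ.+ err ℕ.* M
      logs-bound m = begin
        a ℕ.* (M ℕ.* M)                          ≤⟨ logs-product M ⟩
        suc (A M) ℕ.* suc (B M)                  ≡⟨ solve 2 (λ a b → (con 1 :+ a) :* (con 1 :+ b) := a :* b :+ (con 1 :+ a :+ b)) refl (A M) (B M) ⟩
        A M ℕ.* B M ℕ.+ (1 ℕ.+ A M ℕ.+ B M)      ≤⟨ ℕ.+-monoʳ-≤ (A M ℕ.* B M) (ℕ.+-mono-≤ (ℕ.+-mono-≤ (s≤s (z≤n {m}))
                                                      (logNum≤ 3 r M r 2≤3 (ℕ.<⇒≤ (k≤b^k 3 2≤3 r))))
                                                      (logNum≤ r n M n 2≤r (ℕ.<⇒≤ (k≤b^k r 2≤r n)))) ⟩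
        A M ℕ.* B M ℕ.+ (M ℕ.+ r ℕ.* M ℕ.+ n ℕ.* M)
          ≡⟨ cong (A M ℕ.* B M ℕ.+_) (solve 3 (λ m r n → m :+ r :* m :+ n :* m := (con 1 :+ (r :+ n)) :* m) refl M r n) ⟩
        A M ℕ.* B M ℕ.+ err ℕ.* M                  ∎
        where
        open ℕ.≤-Reasoning
        open +-*-Solver
        M : ℕ
        M = suc m

      -- Since P ^ a ≤ (3 ^ a) ^ Q ≤ n ^ Q, the exponent only has to be at least Q / a eventually.
      -- The summand 2 in the hypothesis is slack that absorbs the error of `logs-bound` as soon as
      -- M ≥ W · `err`.
      ≤-power : ∀ P Q → 2 ℕ.* Q ℕ.+ 2 ℕ.≤ 3 ℕ.* (a ℕ.+ 2 ℕ.* D) ℕ.* a → P ℕ.≤ 3 ^ Q →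
        .{{_ : NonTrivial r}} →
        fromℕ P ≤ᴿ n ^ᴿ ((fromℕ 3 *ᴿ log 3 r) *ᴿ (fromℚ ½ +ᴿ δ n) *ᴿ log r n)
      ≤-power P Q Q≤ P≤ = ≤-^ᴿ n x Q (ilog n) P
        (W ℕ.* err , λ m h → bound m (ℕ.m≤n⇒m≤1+n h)) P^≤
        where
        x : ℝ
        x = (fromℕ 3 *ᴿ log 3 r) *ᴿ (fromℚ ½ +ᴿ δ n) *ᴿ log r n
        W Z : ℕ
        W = 3 ℕ.* (a ℕ.+ 2 ℕ.* D)
        Z = ilog n ℕ.+ suc (ilog n ℕ.+ 0)
        P^≤ : P ^ a ℕ.≤ n ^ Q
        P^≤ = begin
          P ^ a         ≤⟨ ℕ.^-monoˡ-≤ a P≤ ⟩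
          (3 ^ Q) ^ a   ≡⟨ power-swap 3 Q a ⟩
          (3 ^ a) ^ Q   ≤⟨ ℕ.^-monoˡ-≤ Q (ilog-lower n 3≤n) ⟩
          n ^ Q         ∎
          where open ℕ.≤-Reasoning
        x≡ : ∀ m → seq x m ≡ + (3 ℕ.* A (suc m) ℕ.* (a ℕ.+ 2 ℕ.* D) ℕ.* B (suc m)) / (1 ℕ.* suc m ℕ.* suc Z ℕ.* suc m)
        x≡ m = begin
          seq x m
            ≡⟨ seq-* (fromℕ 3 *ᴿ log 3 r *ᴿ (fromℚ ½ +ᴿ δ n)) (log r n) m ⟩
          seq (fromℕ 3 *ᴿ log 3 r *ᴿ (fromℚ ½ +ᴿ δ n)) m ℚ.* seq (log r n) m
            ≡⟨ cong₂ ℚ._*_ (seq-* (fromℕ 3 *ᴿ log 3 r) (fromℚ ½ +ᴿ δ n) m) (seq-log r n m) ⟩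
          seq (fromℕ 3 *ᴿ log 3 r) m ℚ.* seq (fromℚ ½ +ᴿ δ n) m ℚ.* (+ B (suc m) / suc m)
            ≡⟨ cong₂ (λ p q → p ℚ.* q ℚ.* (+ B (suc m) / suc m))
                 (trans (seq-* (fromℕ 3) (log 3 r) m) (trans (cong (+ 3 / 1 ℚ.*_) (seq-log 3 r m)) (/-* 3 0 (A (suc m)) m)))
                 (trans (seq-½+ (exponent n) m) (exponent-≡ n)) ⟩
          (+ (3 ℕ.* A (suc m)) / (1 ℕ.* suc m)) ℚ.* (+ (a ℕ.+ 2 ℕ.* D) / suc Z) ℚ.* (+ B (suc m) / suc m)
            ≡⟨ cong (ℚ._* (+ B (suc m) / suc m)) (/-* (3 ℕ.* A (suc m)) (m ℕ.+ 0) (a ℕ.+ 2 ℕ.* D) Z) ⟩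
          (+ (3 ℕ.* A (suc m) ℕ.* (a ℕ.+ 2 ℕ.* D)) / (1 ℕ.* suc m ℕ.* suc Z)) ℚ.* (+ B (suc m) / suc m)
            ≡⟨ /-* (3 ℕ.* A (suc m) ℕ.* (a ℕ.+ 2 ℕ.* D)) (Z ℕ.+ (m ℕ.+ 0) ℕ.* suc Z) (B (suc m)) m ⟩
          + (3 ℕ.* A (suc m) ℕ.* (a ℕ.+ 2 ℕ.* D) ℕ.* B (suc m)) / (1 ℕ.* suc m ℕ.* suc Z ℕ.* suc m) ∎
          where open ≡-Reasoning
        main : ∀ m → W ℕ.* err ℕ.≤ suc m → 2 ℕ.* Q ℕ.* a ℕ.* (suc m ℕ.* suc m) ℕ.≤ W ℕ.* (A (suc m) ℕ.* B (suc m)) ℕ.* a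
        main m h = ℕ.+-cancelʳ-≤ (W ℕ.* (err ℕ.* M) ℕ.* a) _ _ (begin
          2 ℕ.* Q ℕ.* a ℕ.* (M ℕ.* M) ℕ.+ W ℕ.* (err ℕ.* M) ℕ.* a
            ≡⟨ solve 5 (λ q a m w c → con 2 :* q :* a :* (m :* m) :+ w :* (c :* m) :* a := con 2 :* q :* a :* (m :* m) :+ (w :* c) :* (m :* a)) refl Q a M W err ⟩
          2 ℕ.* Q ℕ.* a ℕ.* (M ℕ.* M) ℕ.+ W ℕ.* err ℕ.* (M ℕ.* a)
            ≤⟨ ℕ.+-monoʳ-≤ (2 ℕ.* Q ℕ.* a ℕ.* (M ℕ.* M)) (ℕ.*-monoˡ-≤ (M ℕ.* a) h) ⟩
          2 ℕ.* Q ℕ.* a ℕ.* (M ℕ.* M) ℕ.+ M ℕ.* (M ℕ.* a)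
            ≤⟨ ℕ.m≤m+n _ (M ℕ.* (M ℕ.* a)) ⟩
          2 ℕ.* Q ℕ.* a ℕ.* (M ℕ.* M) ℕ.+ M ℕ.* (M ℕ.* a) ℕ.+ M ℕ.* (M ℕ.* a)
            ≡⟨ solve 3 (λ q a m → con 2 :* q :* a :* (m :* m) :+ m :* (m :* a) :+ m :* (m :* a) := (con 2 :* q :+ con 2) :* (a :* (m :* m))) refl Q a M ⟩
          (2 ℕ.* Q ℕ.+ 2) ℕ.* (a ℕ.* (M ℕ.* M))
            ≤⟨ ℕ.*-mono-≤ Q≤ (logs-bound m) ⟩
          W ℕ.* a ℕ.* (A M ℕ.* B M ℕ.+ err ℕ.* M)
            ≡⟨ solve 4 (λ w a p c → w :* a :* (p :+ c) := w :* p :* a :+ w :* c :* a) refl W a (A M ℕ.* B M) (err ℕ.* M) ⟩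
          W ℕ.* (A M ℕ.* B M) ℕ.* a ℕ.+ W ℕ.* (err ℕ.* M) ℕ.* a ∎)
          where
          open ℕ.≤-Reasoning
          open +-*-Solver
          M : ℕ
          M = suc m
        bound : ∀ m → W ℕ.* err ℕ.≤ suc m → + Q / a ℚ.≤ seq x m
        bound m h = ℚ.≤-trans
          (/-mono-≤ Q (ilog n) (3 ℕ.* A M ℕ.* (a ℕ.+ 2 ℕ.* D) ℕ.* B M) (m ℕ.+ (Z ℕ.+ (m ℕ.+ 0) ℕ.* suc Z) ℕ.* suc m) (begin
            Q ℕ.* (1 ℕ.* M ℕ.* (2 ℕ.* a) ℕ.* M)
              ≡⟨ solve 3 (λ q m a → q :* (con 1 :* m :* (con 2 :* a) :* m) := con 2 :* q :* a :* (m :* m)) refl Q M a ⟩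
            2 ℕ.* Q ℕ.* a ℕ.* (M ℕ.* M)
              ≤⟨ main m h ⟩
            W ℕ.* (A M ℕ.* B M) ℕ.* a
              ≡⟨ cong (ℕ._* a) (solve 3 (λ e p q → con 3 :* e :* (p :* q) := con 3 :* p :* e :* q) refl (a ℕ.+ 2 ℕ.* D) (A M) (B M)) ⟩
            3 ℕ.* A M ℕ.* (a ℕ.+ 2 ℕ.* D) ℕ.* B M ℕ.* a ∎))
          (ℚ.≤-reflexive (sym (x≡ m)))
          where
          open ℕ.≤-Reasoning
          open +-*-Solver
          M : ℕ
          M = suc m

private
  variable
    A B A′ : Set
    n r : ℕ

-- Counting cliques and the lower bound

∑-mono : ∀ {n} {f g : Fin n → ℕ} → (∀ i → f i ≤ g i) → ∑ f ≤ ∑ g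
∑-mono {zero}  h = z≤n
∑-mono {suc n} h = +-mono-≤ (h zero) (∑-mono (h ∘ suc))

∏-mono : ∀ {n} {f g : Fin n → ℕ} → (∀ i → f i ≤ g i) → ∏ f ≤ ∏ g
∏-mono {zero}  h = ≤-refl
∏-mono {suc n} h = *-mono-≤ (h zero) (∏-mono (h ∘ suc))

product-tabulate : ∀ {n} (f : Fin n → ℕ) → product (List.tabulate f) ≡ ∏ f
product-tabulate {zero}  f = refl
product-tabulate {suc n} f = cong (f zero *_) (product-tabulate (f ∘ suc))

product-allFin : ∀ {n} (f : Fin n → ℕ) → product (map f (allFin n)) ≡ ∏ f
product-allFin f = trans (cong product (List.map-tabulate id f)) (product-tabulate f)

does-true : {A : Set} (a? : Dec A) → does a? ≡ true → A
does-true (yes a) _ = a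

⟪_⟫ : Bool → ℕ
⟪ b ⟫ = if b then 1 else 0

size : (Fin n → Bool) → ℕ
size P = ∑ (λ u → ⟪ P u ⟫)

-- The number of cliques contained in P, for the graph with u < v adjacent when R u v.
cliques : (Fin n → Fin n → Bool) → (Fin n → Bool) → ℕ
cliques {zero}  R P = 1
cliques {suc n} R P =
  cliques R′ (P ∘ suc) + (if P zero then cliques R′ (λ v → P (suc v) ∧ R zero (suc v)) else 0)
  where
  R′ : Fin n → Fin n → Bool
  R′ u v = R (suc u) (suc v)

_⊆ᵇ_ : {A : Set} → (A → Bool) → (A → Bool) → Set
P ⊆ᵇ Q = ∀ u → P u ≡ true → Q u ≡ true

∧-introᵇ : ∀ {a b} → a ≡ true → b ≡ true → a ∧ b ≡ true
∧-introᵇ refl refl = refl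

∧-elimˡᵇ : ∀ {a b} → a ∧ b ≡ true → a ≡ true
∧-elimˡᵇ {true} _ = refl

∧-elimʳᵇ : ∀ {a b} → a ∧ b ≡ true → b ≡ true
∧-elimʳᵇ {true} eq = eq

⟪⟫-mono : ∀ {a b} → (a ≡ true → b ≡ true) → ⟪ a ⟫ ≤ ⟪ b ⟫
⟪⟫-mono {false} h = z≤n
⟪⟫-mono {true}  h rewrite h refl = ≤-refl

cliques-mono : ∀ {n} (R : Fin n → Fin n → Bool) {P Q} → P ⊆ᵇ Q → cliques R P ≤ cliques R Q
cliques-mono {zero}  R h = ≤-refl
cliques-mono {suc n} R {P} {Q} h = +-mono-≤ (cliques-mono R′ (h ∘ suc)) (aux (P zero) (Q zero) refl refl)
  where
  R′ : Fin n → Fin n → Bool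
  R′ u v = R (suc u) (suc v)
  aux : ∀ p q → P zero ≡ p → Q zero ≡ q →
        (if p then cliques R′ (λ v → P (suc v) ∧ R zero (suc v)) else 0) ≤
        (if q then cliques R′ (λ v → Q (suc v) ∧ R zero (suc v)) else 0)
  aux false q     ep eq = z≤n
  aux true  true  ep eq = cliques-mono R′ λ v e → ∧-introᵇ (h (suc v) (∧-elimˡᵇ e)) (∧-elimʳᵇ {P (suc v)} e)
  aux true  false ep eq with trans (sym eq) (h zero ep)
  ... | ()

cliques-pos : ∀ {n} R (P : Fin n → Bool) → 1 ≤ cliques R P
cliques-pos {zero}  R P = ≤-refl
cliques-pos {suc n} R P = ≤-trans (cliques-pos _ (P ∘ suc)) (m≤m+n _ _)

cliques-cong : ∀ {n} {R S : Fin n → Fin n → Bool} {P Q} → (∀ u v → R u v ≡ S u v) → (∀ u → P u ≡ Q u) →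
               cliques R P ≡ cliques S Q
cliques-cong {zero}  hR hP = refl
cliques-cong {suc n} {R} {S} {P} {Q} hR hP rewrite hP zero =
  cong₂ _+_ (cliques-cong hR′ (hP ∘ suc))
    (cong (λ m → if Q zero then m else 0) (cliques-cong hR′ (λ v → cong₂ _∧_ (hP (suc v)) (hR zero (suc v)))))
  where
  hR′ : ∀ u v → R (suc u) (suc v) ≡ S (suc u) (suc v)
  hR′ u v = hR (suc u) (suc v)

record Clique (R : Fin n → Fin n → Bool) (P : Fin n → Bool) (s : Subset n) : Set where
  constructor clique
  field
    within   : ∀ u → u ∈ s → P u ≡ true
    adjacent : ∀ u v → u ∈ s → v ∈ s → u ≢ v → R u v ≡ true

open Clique

length-filter-map : ∀ {A B : Set} {P : Pred B 0ℓ} (P? : Decidable P) (f : A → B) xs →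
                    length (filter P? (map f xs)) ≡ length (filter (λ x → P? (f x)) xs)
length-filter-map P? f []       = refl
length-filter-map P? f (x ∷ xs) with does (P? (f x))
... | true  = cong suc (length-filter-map P? f xs)
... | false = length-filter-map P? f xs

-- A clique through the first vertex is a clique inside its neighbourhood, which matches the
-- recursion of `cliques`; symmetry enters because that recursion reads R only at increasing pairs.
-- `Q` is given up to extension because the induction passes to `Q (inside ∷ s)` and
-- `Q (outside ∷ s)`, which do not literally have the form `Clique R P`.
count-cliques : ∀ {n} {R : Fin n → Fin n → Bool} {P} → (∀ u v → R u v ≡ R v u) →
  {Q : Pred (Subset n) 0ℓ} (Q? : Decidable Q) → Q ≐ Clique R P →
  length (filter Q? (subsets n)) ≡ cliques R P
count-cliques {zero} R-sym Q? (_ , Q⊇) =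
  cong length (List.filter-accept Q? {[]} {[]} (Q⊇ (clique (λ ()) (λ ()))))
count-cliques {suc n} {R} {P} R-sym {Q} Q? (Q⊆ , Q⊇) = begin
  length (filter Q? (map (inside ∷_) (subsets n) ++ map (outside ∷_) (subsets n)))
    ≡⟨ cong length (List.filter-++ Q? (map (inside ∷_) (subsets n)) _) ⟩
  length (filter Q? (map (inside ∷_) (subsets n)) ++ filter Q? (map (outside ∷_) (subsets n)))
    ≡⟨ List.length-++ (filter Q? (map (inside ∷_) (subsets n))) ⟩
  length (filter Q? (map (inside ∷_) (subsets n))) + length (filter Q? (map (outside ∷_) (subsets n)))
    ≡⟨ cong₂ _+_ (length-filter-map Q? (inside ∷_) (subsets n)) (length-filter-map Q? (outside ∷_) (subsets n)) ⟩
  length (filter (λ s → Q? (inside ∷ s)) (subsets n)) + length (filter (λ s → Q? (outside ∷ s)) (subsets n))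
    ≡⟨ cong₂ _+_ (ins (P zero) refl) (count-cliques R′-sym (λ s → Q? (outside ∷ s)) ((λ q → out⊆ (Q⊆ q)) , (λ g → Q⊇ (out⊇ g)))) ⟩
  (if P zero then cliques R′ P₀ else 0) + cliques R′ (P ∘ suc)
    ≡⟨ +-comm (if P zero then cliques R′ P₀ else 0) _ ⟩
  cliques R P ∎
  where
  open ≡-Reasoning
  R′ : Fin n → Fin n → Bool
  R′ u v = R (suc u) (suc v)
  P₀ : Fin n → Bool
  P₀ v = P (suc v) ∧ R zero (suc v)
  R′-sym : ∀ u v → R′ u v ≡ R′ v u
  R′-sym u v = R-sym (suc u) (suc v)
  out⊆ : ∀ {s} → Clique R P (outside ∷ s) → Clique R′ (P ∘ suc) s
  out⊆ (clique w a) = clique (λ u u∈s → w (suc u) (there u∈s))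
    (λ u v u∈s v∈s u≢v → a (suc u) (suc v) (there u∈s) (there v∈s) (u≢v ∘ Fin.suc-injective))
  out⊇ : ∀ {s} → Clique R′ (P ∘ suc) s → Clique R P (outside ∷ s)
  out⊇ (clique w a) = clique (λ { (suc u) (there u∈s) → w u u∈s })
    (λ { (suc u) (suc v) (there u∈s) (there v∈s) u≢v → a u v u∈s v∈s (u≢v ∘ cong suc) })
  in⊆ : ∀ {s} → Clique R P (inside ∷ s) → Clique R′ P₀ s
  in⊆ (clique w a) = clique
    (λ u u∈s → ∧-introᵇ (w (suc u) (there u∈s)) (a zero (suc u) here (there u∈s) (λ ())))
    (λ u v u∈s v∈s u≢v → a (suc u) (suc v) (there u∈s) (there v∈s) (u≢v ∘ Fin.suc-injective))
  in⊇ : ∀ {s} → P zero ≡ true → Clique R′ P₀ s → Clique R P (inside ∷ s)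
  in⊇ {s} p (clique w a) = clique
    (λ { zero here → p ; (suc u) (there u∈s) → ∧-elimˡᵇ (w u u∈s) })
    λ { zero zero u∈s v∈s u≢v → ⊥-elim (u≢v refl)
      ; zero (suc v) u∈s (there v∈s) u≢v → ∧-elimʳᵇ {P (suc v)} (w v v∈s)
      ; (suc u) zero (there u∈s) v∈s u≢v → trans (R-sym (suc u) zero) (∧-elimʳᵇ {P (suc u)} (w u u∈s))
      ; (suc u) (suc v) (there u∈s) (there v∈s) u≢v → a u v u∈s v∈s (u≢v ∘ cong suc) }
  ins : ∀ b → P zero ≡ b →
        length (filter (λ s → Q? (inside ∷ s)) (subsets n)) ≡ (if b then cliques R′ P₀ else 0)
  ins true  p = count-cliques R′-sym (λ s → Q? (inside ∷ s)) ((λ q → in⊆ (Q⊆ q)) , (λ g → Q⊇ (in⊇ p g)))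
  ins false p = cong length (List.filter-none (λ s → Q? (inside ∷ s)) {subsets n} (All.universal (λ s q →
    case (trans (sym p) (within (Q⊆ q) zero here))) (subsets n)))
    where
    case : ¬ false ≡ true
    case ()

everything : Fin n → Bool
everything _ = true

edges : (Fin n → Fin n → Fin r) → Fin r → Fin n → Fin n → Bool
edges c j u v = does (c u v Fin.≟ j)

open Colouring

cliqueCount-cliques : (c : Colouring r n) (i : Fin r) →
                      cliqueCount (colourGraph c i) ≡ cliques (edges (colour c) i) everything
cliqueCount-cliques c i = count-cliques
  (λ u v → cong (λ k → does (k Fin.≟ i)) (colour-sym c u v))
  (isClique? (colourGraph c i))
  ( (λ q → clique (λ _ _ → refl) (λ u v u∈s v∈s u≢v → dec-true (colour c u v Fin.≟ i) (proj₂ (q u v u∈s v∈s u≢v))))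
  , (λ g u v u∈s v∈s u≢v → u≢v , does-true (colour c u v Fin.≟ i) (adjacent g u v u∈s v∈s u≢v)) )

cliqueProduct-∏ : (c : Colouring r n) → cliqueProduct c ≡ ∏ (λ i → cliques (edges (colour c) i) everything)
cliqueProduct-∏ c = trans (product-allFin (λ i → cliqueCount (colourGraph c i))) (∏-cong (cliqueCount-cliques c))

-- Strict excess survives the removal of a value below m and is impossible for r = 0, so the
-- recursion may run down to the empty family.
pigeonhole< : ∀ {r} (g : Fin r → ℕ) m → r * m < ∑ g → ∃[ j ] m ≤ g j
pigeonhole< {suc r} g m h with m ≤? g zero
... | yes m≤g = zero , m≤g
... | no  m≰g with pigeonhole< (g ∘ suc) m (+-cancelˡ-< (g zero) _ _ (≤-trans (s≤s (+-monoˡ-≤ (r * m) (<⇒≤ (≰⇒> m≰g)))) h))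
...   | j , m≤g = suc j , m≤g

pigeonhole : ∀ {r} .{{_ : NonZero r}} (g : Fin r → ℕ) m → r * m ≤ ∑ g → ∃[ j ] m ≤ g j
pigeonhole {suc r} g m h with m ≤? g zero
... | yes m≤g = zero , m≤g
... | no  m≰g with pigeonhole< (g ∘ suc) m (+-cancelˡ-< (g zero) _ _ (≤-trans (+-monoˡ-≤ (r * m) (≰⇒> m≰g)) h))
...   | j , m≤g = suc j , m≤g

-- In every factor but the j-th, g may be raised to f; the sum then factors as f j + g j times the
-- remaining values of f.
∏-+-≤ : ∀ {r} (f g h : Fin r → ℕ) j → (∀ i → f i ≤ h i) → (∀ i → g i ≤ f i) → f j + g j ≤ h j →
        ∏ f + ∏ g ≤ ∏ h
∏-+-≤ {suc r} f g h zero f≤h g≤f fg≤h = begin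
  f zero * ∏ (f ∘ suc) + g zero * ∏ (g ∘ suc) ≤⟨ +-monoʳ-≤ _ (*-monoʳ-≤ (g zero) (∏-mono (g≤f ∘ suc))) ⟩
  f zero * ∏ (f ∘ suc) + g zero * ∏ (f ∘ suc) ≡⟨ *-distribʳ-+ (∏ (f ∘ suc)) (f zero) (g zero) ⟨
  (f zero + g zero) * ∏ (f ∘ suc)             ≤⟨ *-mono-≤ fg≤h (∏-mono (f≤h ∘ suc)) ⟩
  h zero * ∏ (h ∘ suc)                        ∎
  where open ≤-Reasoning
∏-+-≤ {suc r} f g h (suc j) f≤h g≤f fg≤h = begin
  f zero * ∏ (f ∘ suc) + g zero * ∏ (g ∘ suc) ≤⟨ +-monoʳ-≤ _ (*-monoˡ-≤ (∏ (g ∘ suc)) (g≤f zero)) ⟩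
  f zero * ∏ (f ∘ suc) + f zero * ∏ (g ∘ suc) ≡⟨ *-distribˡ-+ (f zero) _ _ ⟨
  f zero * (∏ (f ∘ suc) + ∏ (g ∘ suc))        ≤⟨ *-mono-≤ (f≤h zero)
                                                  (∏-+-≤ (f ∘ suc) (g ∘ suc) (h ∘ suc) j (f≤h ∘ suc) (g≤f ∘ suc) fg≤h) ⟩
  h zero * ∏ (h ∘ suc)                        ∎
  where open ≤-Reasoning

∑-edges : ∀ {r} (i : Fin r) → ∑ (λ j → ⟪ does (i Fin.≟ j) ⟫) ≡ 1
∑-edges {suc r} zero    = cong suc (∑-zero r)
∑-edges {suc r} (suc i) = ∑-edges i

neighbours : (Fin (suc n) → Fin (suc n) → Fin r) → (Fin (suc n) → Bool) → Fin r → Fin n → Bool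
neighbours c P j v = P (suc v) ∧ edges c j zero (suc v)

∑-neighbours : (c : Fin (suc n) → Fin (suc n) → Fin r) (P : Fin (suc n) → Bool) →
               ∑ (λ j → size (neighbours c P j)) ≡ size (P ∘ suc)
∑-neighbours {r = r} c P = trans (∑-comm (λ j v → ⟪ neighbours c P j v ⟫))
  (∑-cong λ v → lem v (P (suc v)))
  where
  lem : ∀ v b → ∑ (λ j → ⟪ b ∧ edges c j zero (suc v) ⟫) ≡ ⟪ b ⟫
  lem v true  = ∑-edges (c zero (suc v))
  lem v false = ∑-zero r

cliques∏ : (Fin n → Fin n → Fin r) → (Fin n → Bool) → ℕ
cliques∏ c P = ∏ (λ i → cliques (edges c i) P)

restrict : (Fin (suc n) → Fin (suc n) → Fin r) → Fin n → Fin n → Fin r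
restrict c u v = c (suc u) (suc v)

-- Deleting the first vertex from P keeps every clique count at least as large
-- as that inside a neighbourhood, and colour j gains the cliques through it.
cliques∏-step : (c : Fin (suc n) → Fin (suc n) → Fin r) (P : Fin (suc n) → Bool) (j : Fin r) → P zero ≡ true →
  cliques∏ (restrict c) (P ∘ suc) + cliques∏ (restrict c) (neighbours c P j) ≤ cliques∏ c P
cliques∏-step c P j p = ∏-+-≤ _ _ _ j
  (λ i → m≤m+n _ _)
  (λ i → cliques-mono (edges (restrict c) i) (λ v → ∧-elimˡᵇ))
  through
  where
  through : cliques (edges (restrict c) j) (P ∘ suc) + cliques (edges (restrict c) j) (neighbours c P j) ≤
            cliques (edges c j) P
  through rewrite p = ≤-refl

module Growth {r} .{{_ : NonZero r}} where

  Guaranteed : ℕ → ℕ → Set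
  Guaranteed m b = ∀ {n} (c : Fin n → Fin n → Fin r) P → m ≤ size P → b ≤ cliques∏ c P

  -- While more than r m vertices are left, deleting one leaves a colour neighbourhood of at least m
  -- vertices, which contributes b. Each gain costs one vertex, so a surplus of s vertices yields s
  -- copies of b.
  grow : ∀ {m b} → Guaranteed m b → ∀ s → Guaranteed (r * m + s) (s * b)
  grow {m} g zero c P h = z≤n
  grow {m} g (suc s) {zero}  c P h with subst (_≤ 0) (+-suc (r * m) s) h
  ... | ()
  grow {m} {b} g (suc s) {suc n} c P h = aux (P zero) refl (subst (_≤ size P) (+-suc (r * m) s) h)
    where
    aux : ∀ p → P zero ≡ p → suc (r * m + s) ≤ ⟪ p ⟫ + size (P ∘ suc) → suc s * b ≤ cliques∏ c P
    aux true p h with pigeonhole (λ j → size (neighbours c P j)) m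
         (≤-trans (≤-trans (m≤m+n (r * m) s) (s≤s⁻¹ h)) (≤-reflexive (sym (∑-neighbours c P))))
    ... | j , m≤ = ≤-trans
          (+-mono-≤ (g (restrict c) (neighbours c P j) m≤) (grow g s (restrict c) (P ∘ suc) (s≤s⁻¹ h)))
          (≤-trans (≤-reflexive (+-comm (cliques∏ (restrict c) (neighbours c P j)) _))
                   (cliques∏-step c P j p))
    aux false p h = ≤-trans (grow g (suc s) (restrict c) (P ∘ suc) (subst (_≤ size (P ∘ suc)) (sym (+-suc (r * m) s)) h))
      (∏-mono {f = λ i → cliques (edges (restrict c) i) (P ∘ suc)} {g = λ i → cliques (edges c i) P} λ i → m≤m+n _ _)

-- tri s is s choose 2.
tri : ℕ → ℕ
tri zero    = 0
tri (suc s) = s + tri s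

tri-double : ∀ s → tri (suc s) + tri (suc s) ≡ s * s + s
tri-double zero = refl
tri-double (suc s) = begin
  suc s + tri (suc s) + (suc s + tri (suc s))
    ≡⟨ solve 2 (λ a t → (a :+ t) :+ (a :+ t) := (a :+ a) :+ (t :+ t)) refl (suc s) (tri (suc s)) ⟩
  suc s + suc s + (tri (suc s) + tri (suc s))
    ≡⟨ cong (suc s + suc s ℕ.+_) (tri-double s) ⟩
  suc s + suc s + (s * s + s)
    ≡⟨ solve 1 (λ s → (con 1 :+ s) :+ (con 1 :+ s) :+ (s :* s :+ s) := (con 1 :+ s) :* (con 1 :+ s) :+ (con 1 :+ s)) refl s ⟩
  suc s * suc s + suc s ∎
  where
  open ≡-Reasoning
  open +-*-Solver

-- Growing with surplus r ^ (t + 1) turns the threshold t r ^ t into r (t r ^ t) + r ^ (t + 1) = (t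
-- + 1) r ^ (t + 1) and multiplies the guarantee by r ^ (t + 1), so the exponents sum to 1 + ... +
-- t.
guaranteed : ∀ {r} .{{_ : NonZero r}} t → Growth.Guaranteed {r} (t * r ^ t) (r ^ tri (suc t))
guaranteed {r} zero    c P h = ∏-pos (λ i → cliques-pos (edges c i) P)
  where
  ∏-pos : ∀ {m} {f : Fin m → ℕ} → (∀ i → 1 ≤ f i) → 1 ≤ ∏ f
  ∏-pos {zero}  h = ≤-refl
  ∏-pos {suc m} h = *-mono-≤ (h zero) (∏-pos (h ∘ suc))
guaranteed {r} (suc t) c P h = subst (_≤ cliques∏ c P) (sym (^-distribˡ-+-* r (suc t) (tri (suc t))))
  (Growth.grow {r} (guaranteed t) (r ^ suc t) c P (subst (_≤ size P) eq h))
  where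
  open +-*-Solver
  eq : suc t * r ^ suc t ≡ r * (t * r ^ t) + r ^ suc t
  eq = solve 3 (λ t r p → (con 1 :+ t) :* (r :* p) := r :* (t :* p) :+ r :* p) refl t r (r ^ t)

size-everything : ∀ n → size {n} everything ≡ n
size-everything zero    = refl
size-everything (suc n) = cong suc (size-everything n)

-- Squaring clears the half in t (t + 1) / 2; the linear term is then dropped.
cliqueProduct-lower : ∀ {r n} .{{_ : NonZero r}} (c : Colouring r n) t → t * r ^ t ≤ n →
                      r ^ (t * t) ≤ cliqueProduct c * cliqueProduct c
cliqueProduct-lower {r} {n} c t h = begin
  r ^ (t * t)                         ≤⟨ ^-monoʳ-≤ r (≤-trans (m≤m+n (t * t) t) (≤-reflexive (sym (tri-double t)))) ⟩
  r ^ (tri (suc t) + tri (suc t))     ≡⟨ ^-distribˡ-+-* r (tri (suc t)) (tri (suc t)) ⟩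
  r ^ tri (suc t) * r ^ tri (suc t)   ≤⟨ *-mono-≤ bound bound ⟩
  cliqueProduct c * cliqueProduct c   ∎
  where
  open ≤-Reasoning
  bound : r ^ tri (suc t) ≤ cliqueProduct c
  bound = subst (r ^ tri (suc t) ≤_) (sym (cliqueProduct-∏ c))
    (guaranteed t (colour c) everything (subst (t * r ^ t ≤_) (sym (size-everything n)) h))

-- Tightness of the upper bound

tri≡C : ∀ r → tri r ≡ r C 2
tri≡C zero    = refl
tri≡C (suc r) = trans (cong₂ _+_ (sym (nC1≡n r)) (tri≡C r)) (nCk+nC[k+1]≡[n+1]C[k+1] r 1)

∏-const : ∀ n b → ∏ {n} (λ _ → b) ≡ b ^ n
∏-const zero    b = refl
∏-const (suc n) b = cong (b *_) (∏-const n b)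

-- The empty set and the singletons already give this many.
size-≤-cliques : ∀ {n} R (P : Fin n → Bool) → suc (size P) ≤ cliques R P
size-≤-cliques {zero}  R P = ≤-refl
size-≤-cliques {suc n} R P = aux (P zero)
  where
  R′ : Fin n → Fin n → Bool
  R′ u v = R (suc u) (suc v)
  aux : ∀ p → suc (⟪ p ⟫ + size (P ∘ suc)) ≤
        cliques R′ (P ∘ suc) + (if p then cliques R′ (λ v → P (suc v) ∧ R zero (suc v)) else 0)
  aux false = ≤-trans (size-≤-cliques R′ (P ∘ suc)) (m≤m+n _ 0)
  aux true  = ≤-trans (≤-reflexive (+-comm 1 _)) (+-mono-≤ (size-≤-cliques R′ (P ∘ suc)) (cliques-pos R′ _))

2^size-≤-cliques : ∀ {n} R (P : Fin n → Bool) → (∀ u v → P u ≡ true → P v ≡ true → R u v ≡ true) →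
                   2 ^ size P ≤ cliques R P
2^size-≤-cliques {zero}  R P h = ≤-refl
2^size-≤-cliques {suc n} R P h = aux (P zero) refl
  where
  R′ : Fin n → Fin n → Bool
  R′ u v = R (suc u) (suc v)
  ih : 2 ^ size (P ∘ suc) ≤ cliques R′ (P ∘ suc)
  ih = 2^size-≤-cliques R′ (P ∘ suc) (λ u v → h (suc u) (suc v))
  aux : ∀ p → P zero ≡ p → 2 ^ (⟪ p ⟫ + size (P ∘ suc)) ≤
        cliques R′ (P ∘ suc) + (if p then cliques R′ (λ v → P (suc v) ∧ R zero (suc v)) else 0)
  aux false _ = ≤-trans ih (m≤m+n _ 0)
  aux true  p = +-mono-≤ ih (≤-trans (≤-reflexive (+-identityʳ _)) (≤-trans ih
    (cliques-mono R′ λ v e → ∧-introᵇ e (h zero (suc v) p e))))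

∨-introˡᵇ : ∀ {a b} → a ≡ true → a ∨ b ≡ true
∨-introˡᵇ refl = refl

∨-introʳᵇ : ∀ {a b} → b ≡ true → a ∨ b ≡ true
∨-introʳᵇ {true}  _ = refl
∨-introʳᵇ {false} e = e

∨-elimᵇ : ∀ {a b} → a ∨ b ≡ true → a ≡ true ⊎ b ≡ true
∨-elimᵇ {true}  _ = inj₁ refl
∨-elimᵇ {false} e = inj₂ e

-- A clique in P and a clique in Q unite to a clique, and disjointness lets the pair be recovered.
-- In the recursion the first vertex lies in at most one of the two sets, and if it does, the whole
-- other set survives in its neighbourhood.
cliques-join : ∀ {n} (R : Fin n → Fin n → Bool) (P Q : Fin n → Bool) →
  (∀ u → P u ≡ true → ¬ Q u ≡ true) →
  (∀ u v → P u ≡ true → Q v ≡ true → R u v ≡ true × R v u ≡ true) →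
  cliques R P * cliques R Q ≤ cliques R (λ u → P u ∨ Q u)
cliques-join {zero}  R P Q disj adj = ≤-refl
cliques-join {suc n} R P Q disj adj = aux (P zero) (Q zero) refl refl
  where
  open ≤-Reasoning
  R′ : Fin n → Fin n → Bool
  R′ u v = R (suc u) (suc v)
  P′ Q′ P₀ Q₀ : Fin n → Bool
  P′ = P ∘ suc
  Q′ = Q ∘ suc
  P₀ v = P′ v ∧ R zero (suc v)
  Q₀ v = Q′ v ∧ R zero (suc v)
  PQ′ PQ₀ : Fin n → Bool
  PQ′ v = P′ v ∨ Q′ v
  PQ₀ v = (P′ v ∨ Q′ v) ∧ R zero (suc v)
  ih : cliques R′ P′ * cliques R′ Q′ ≤ cliques R′ PQ′
  ih = cliques-join R′ P′ Q′ (disj ∘ suc) (λ u v → adj (suc u) (suc v))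
  aux : ∀ p q → P zero ≡ p → Q zero ≡ q →
    (cliques R′ P′ + (if p then cliques R′ P₀ else 0)) * (cliques R′ Q′ + (if q then cliques R′ Q₀ else 0)) ≤
    cliques R′ PQ′ + (if p ∨ q then cliques R′ PQ₀ else 0)
  aux true  true  p q = ⊥-elim (disj zero p q)
  aux false false p q = begin
    (cliques R′ P′ + 0) * (cliques R′ Q′ + 0)  ≡⟨ cong₂ _*_ (+-identityʳ (cliques R′ P′)) (+-identityʳ (cliques R′ Q′)) ⟩
    cliques R′ P′ * cliques R′ Q′              ≤⟨ ih ⟩
    cliques R′ PQ′                             ≡⟨ +-identityʳ (cliques R′ PQ′) ⟨
    cliques R′ PQ′ + 0                         ∎
  aux true  false p q = begin
    (cliques R′ P′ + cliques R′ P₀) * (cliques R′ Q′ + 0)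
      ≡⟨ cong ((cliques R′ P′ + cliques R′ P₀) *_) (+-identityʳ (cliques R′ Q′)) ⟩
    (cliques R′ P′ + cliques R′ P₀) * cliques R′ Q′
      ≡⟨ *-distribʳ-+ (cliques R′ Q′) (cliques R′ P′) (cliques R′ P₀) ⟩
    cliques R′ P′ * cliques R′ Q′ + cliques R′ P₀ * cliques R′ Q′
      ≤⟨ +-mono-≤ ih (≤-trans (cliques-join R′ P₀ Q′ (λ u e → disj (suc u) (∧-elimˡᵇ e))
                                 (λ u v e → adj (suc u) (suc v) (∧-elimˡᵇ e)))
                       (cliques-mono R′ λ v e → case v (∨-elimᵇ e))) ⟩
    cliques R′ PQ′ + cliques R′ PQ₀ ∎
    where
    case : ∀ v → P₀ v ≡ true ⊎ Q′ v ≡ true → PQ₀ v ≡ true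
    case v (inj₁ e) = ∧-introᵇ (∨-introˡᵇ (∧-elimˡᵇ {P′ v} e)) (∧-elimʳᵇ {P′ v} e)
    case v (inj₂ e) = ∧-introᵇ (∨-introʳᵇ {P′ v} e) (proj₁ (adj zero (suc v) p e))
  aux false true  p q = begin
    (cliques R′ P′ + 0) * (cliques R′ Q′ + cliques R′ Q₀)
      ≡⟨ cong (_* (cliques R′ Q′ + cliques R′ Q₀)) (+-identityʳ (cliques R′ P′)) ⟩
    cliques R′ P′ * (cliques R′ Q′ + cliques R′ Q₀)
      ≡⟨ *-distribˡ-+ (cliques R′ P′) (cliques R′ Q′) (cliques R′ Q₀) ⟩
    cliques R′ P′ * cliques R′ Q′ + cliques R′ P′ * cliques R′ Q₀
      ≤⟨ +-mono-≤ ih (≤-trans (cliques-join R′ P′ Q₀ (λ u e f → disj (suc u) e (∧-elimˡᵇ f))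
                                 (λ u v e f → adj (suc u) (suc v) e (∧-elimˡᵇ f)))
                       (cliques-mono R′ λ v e → case v (∨-elimᵇ e))) ⟩
    cliques R′ PQ′ + cliques R′ PQ₀ ∎
    where
    case : ∀ v → P′ v ≡ true ⊎ Q₀ v ≡ true → PQ₀ v ≡ true
    case v (inj₁ e) = ∧-introᵇ (∨-introˡᵇ e) (proj₂ (adj (suc v) zero e q))
    case v (inj₂ e) = ∧-introᵇ (∨-introʳᵇ {P′ v} (∧-elimˡᵇ e)) (∧-elimʳᵇ {Q′ v} e)

cliques-joins : ∀ {n} (R : Fin n → Fin n → Bool) {r} (F : Fin r → Fin n → Bool) →
  (∀ k l u → k ≢ l → F k u ≡ true → ¬ F l u ≡ true) →
  (∀ k l u v → k ≢ l → F k u ≡ true → F l v ≡ true → R u v ≡ true) →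
  ∃[ P ] ∏ (λ k → cliques R (F k)) ≤ cliques R P × (∀ u → P u ≡ true → ∃[ k ] F k u ≡ true)
cliques-joins R {zero}  F disj adj = (λ _ → false) , cliques-pos R (λ _ → false) , λ _ ()
cliques-joins R {suc r} F disj adj
  with cliques-joins R (F ∘ suc) (λ k l u k≢l → disj (suc k) (suc l) u (k≢l ∘ Fin.suc-injective))
         (λ k l u v k≢l → adj (suc k) (suc l) u v (k≢l ∘ Fin.suc-injective))
... | P , le , in-F =
  (λ u → F zero u ∨ P u) ,
  ≤-trans (*-monoʳ-≤ (cliques R (F zero)) le)
    (cliques-join R (F zero) P
      (λ u e f → let k , g = in-F u f in disj zero (suc k) u (λ ()) e g)
      (λ u v e f → let k , g = in-F v f in adj zero (suc k) u v (λ ()) e g , adj (suc k) zero v u (λ ()) g e)) ,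
  λ u e → case u (∨-elimᵇ e)
  where
  case : ∀ u → F zero u ≡ true ⊎ P u ≡ true → ∃[ k ] F k u ≡ true
  case u (inj₁ e) = zero , e
  case u (inj₂ e) = let k , g = in-F u e in suc k , g

module Blowup (lab : Fin n → Fin r × Fin r) where

  -- The first label of a vertex is its part.  An edge inside a part is coloured by
  -- the part; an edge between parts by the second label of its end in the later part.
  mix : Fin r × Fin r → Fin r × Fin r → Fin r
  mix (p , q) (p′ , q′) with Fin.<-cmp p p′
  ... | tri< _ _ _ = q′
  ... | tri≈ _ _ _ = p
  ... | tri> _ _ _ = q

  mix-< : ∀ x y → proj₁ x Fin.< proj₁ y → mix x y ≡ proj₂ y
  mix-< (p , q) (p′ , q′) h with Fin.<-cmp p p′
  ... | tri< _ _ _   = refl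
  ... | tri≈ ¬h _ _  = ⊥-elim (¬h h)
  ... | tri> ¬h _ _  = ⊥-elim (¬h h)

  mix-> : ∀ x y → proj₁ y Fin.< proj₁ x → mix x y ≡ proj₂ x
  mix-> (p , q) (p′ , q′) h with Fin.<-cmp p p′
  ... | tri< _ _ ¬h  = ⊥-elim (¬h h)
  ... | tri≈ _ _ ¬h  = ⊥-elim (¬h h)
  ... | tri> _ _ _   = refl

  mix-≡ : ∀ x y → proj₁ x ≡ proj₁ y → mix x y ≡ proj₁ x
  mix-≡ (p , q) (p′ , q′) h with Fin.<-cmp p p′
  ... | tri< _ ¬h _  = ⊥-elim (¬h h)
  ... | tri≈ _ _ _   = refl
  ... | tri> _ ¬h _  = ⊥-elim (¬h h)

  mix-sym : ∀ x y → mix x y ≡ mix y x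
  mix-sym x y with Fin.<-cmp (proj₁ x) (proj₁ y)
  ... | tri< h _ _ = sym (mix-> y x h)
  ... | tri≈ _ h _ = trans h (sym (mix-≡ y x (sym h)))
  ... | tri> _ _ h = sym (mix-< y x h)

  colouring : Colouring r n
  colouring = record { colour = λ u v → mix (lab u) (lab v) ; colour-sym = λ u v → mix-sym (lab u) (lab v) }

  part : Fin r → Fin n → Bool
  part k u = does (proj₁ (lab u) Fin.≟ k)

  class : Fin r → Fin r → Fin n → Bool
  class k j u = does (proj₂ (lab u) Fin.≟ j) ∧ part k u

  -- The vertices of part k that enter cliques of colour j; e and l stand for j ≡ k and j < k.
  block : Bool → Bool → Fin r → Fin r → Fin n → Bool
  block e l j k u = (if e then true else (l ∧ does (proj₂ (lab u) Fin.≟ j))) ∧ part k u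

  F : Fin r → Fin r → Fin n → Bool
  F j k = block (does (j Fin.≟ k)) (does (j Fin.<? k)) j k

  -- The number of cliques guaranteed in a `block`: all subsets of the part, or b, or just the empty
  -- clique. The decisions enter as Booleans, so that they reduce under `suc` in the recursion of
  -- `∏∏-value`.
  value : Bool → Bool → ℕ → ℕ → ℕ
  value e l a b = if e then 2 ^ a else (if l then b else 1)

  F-part : ∀ j k u → F j k u ≡ true → proj₁ (lab u) ≡ k
  F-part j k u e = does-true (proj₁ (lab u) Fin.≟ k)
    (∧-elimʳᵇ {if does (j Fin.≟ k) then true else (does (j Fin.<? k) ∧ does (proj₂ (lab u) Fin.≟ j))} e)

  F-label : ∀ j k u → F j k u ≡ true → j ≡ k ⊎ (j Fin.< k × proj₂ (lab u) ≡ j)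
  F-label j k u e = aux (j Fin.≟ k) (j Fin.<? k) e
    where
    aux : (e : Dec (j ≡ k)) (l : Dec (j Fin.< k)) → block (does e) (does l) j k u ≡ true →
          j ≡ k ⊎ (j Fin.< k × proj₂ (lab u) ≡ j)
    aux (yes j≡k) _ _         = inj₁ j≡k
    aux (no _)    (yes j<k) h = inj₂ (j<k , does-true (proj₂ (lab u) Fin.≟ j) (∧-elimˡᵇ h))

  -- At most one of u, v lies in part j itself, as k ≢ l. Any other end lies in a part after j and
  -- has second label j, and the end in the later part decides the colour.
  adj : ∀ j k l u v → k ≢ l → F j k u ≡ true → F j l v ≡ true → mix (lab u) (lab v) ≡ j
  adj j k l u v k≢l Fu Fv with F-part j k u Fu | F-part j l v Fv | F-label j k u Fu | F-label j l v Fv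
  ... | _  | _  | inj₁ j≡k | inj₁ j≡l = ⊥-elim (k≢l (trans (sym j≡k) j≡l))
  ... | pu | pv | inj₁ j≡k | inj₂ (j<l , q≡) =
    trans (mix-< (lab u) (lab v) (subst₂ Fin._<_ (trans j≡k (sym pu)) (sym pv) j<l)) q≡
  ... | pu | pv | inj₂ (j<k , q≡) | inj₁ j≡l =
    trans (mix-> (lab u) (lab v) (subst₂ Fin._<_ (trans j≡l (sym pv)) (sym pu) j<k)) q≡
  ... | pu | pv | inj₂ (j<k , q≡) | inj₂ (j<l , q′≡) with Fin.<-cmp (proj₁ (lab u)) (proj₁ (lab v))
  ...   | tri< _ _ _ = q′≡
  ...   | tri≈ _ h _ = ⊥-elim (k≢l (trans (sym pu) (trans h pv)))
  ...   | tri> _ _ _ = q≡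

  module _ (b : ℕ) (b≤ : ∀ k j → b ≤ suc (size (class k j))) where

    value-≤ : ∀ j k → value (does (j Fin.≟ k)) (does (j Fin.<? k)) (size (part j)) b ≤
                      cliques (edges (λ u v → mix (lab u) (lab v)) j) (F j k)
    value-≤ j k = aux (j Fin.≟ k) (does (j Fin.<? k))
      where
      R : Fin n → Fin n → Bool
      R = edges (λ u v → mix (lab u) (lab v)) j
      aux : (e : Dec (j ≡ k)) (l : Bool) →
            value (does e) l (size (part j)) b ≤ cliques R (block (does e) l j k)
      aux (yes refl) l = 2^size-≤-cliques R (part j) λ u v Pu Pv →
        let pu = does-true (proj₁ (lab u) Fin.≟ j) Pu
            pv = does-true (proj₁ (lab v) Fin.≟ j) Pv
        in dec-true (mix (lab u) (lab v) Fin.≟ j) (trans (mix-≡ (lab u) (lab v) (trans pu (sym pv))) pu)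
      aux (no _) true  = ≤-trans (b≤ k j) (size-≤-cliques R (class k j))
      aux (no _) false = cliques-pos R (block false false j k)

    colour-count : ∀ j → ∏ (λ k → value (does (j Fin.≟ k)) (does (j Fin.<? k)) (size (part j)) b) ≤
                         cliques (edges (λ u v → mix (lab u) (lab v)) j) everything
    colour-count j with cliques-joins (edges (λ u v → mix (lab u) (lab v)) j) (F j)
        (λ k l u k≢l e f → k≢l (trans (sym (F-part j k u e)) (F-part j l u f)))
        (λ k l u v k≢l e f → dec-true (mix (lab u) (lab v) Fin.≟ j) (adj j k l u v k≢l e f))
    ... | P , le , _ = ≤-trans (∏-mono (value-≤ j)) (≤-trans le (cliques-mono _ {P} (λ _ _ → refl)))

    -- Row j has 2 ^ a j on the diagonal, b at every k > j and 1 at every k < j, so there is one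
    -- factor b for each pair j < k.
    ∏∏-value : ∀ r (a : Fin r → ℕ) →
      ∏ (λ j → ∏ (λ k → value (does (j Fin.≟ k)) (does (j Fin.<? k)) (a j) b)) ≡ 2 ^ ∑ a * b ^ tri r
    ∏∏-value zero    a = refl
    ∏∏-value (suc r) a = begin
      2 ^ a zero * ∏ {r} (λ _ → b) * ∏ (λ j → 1 * ∏ (λ k → value (does (j Fin.≟ k)) (does (j Fin.<? k)) (a (suc j)) b))
        ≡⟨ cong₂ _*_ (cong (2 ^ a zero *_) (∏-const r b)) (trans (∏-cong {r} λ j → *-identityˡ _) (∏∏-value r (a ∘ suc))) ⟩
      2 ^ a zero * b ^ r * (2 ^ ∑ (a ∘ suc) * b ^ tri r)
        ≡⟨ solve 4 (λ x y z w → x :* y :* (z :* w) := x :* z :* (y :* w)) refl (2 ^ a zero) (b ^ r) (2 ^ ∑ (a ∘ suc)) (b ^ tri r) ⟩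
      2 ^ a zero * 2 ^ ∑ (a ∘ suc) * (b ^ r * b ^ tri r)
        ≡⟨ cong₂ _*_ (^-distribˡ-+-* 2 (a zero) _) (^-distribˡ-+-* b r (tri r)) ⟨
      2 ^ ∑ a * b ^ tri (suc r) ∎
      where
      open ≡-Reasoning
      open +-*-Solver

    ∑-part : ∑ (λ j → size (part j)) ≡ n
    ∑-part = trans (∑-comm (λ j u → ⟪ part j u ⟫))
      (trans (∑-cong {n} λ u → ∑-edges (proj₁ (lab u))) (size-everything n))

    cliqueProduct-≥ : 2 ^ n * b ^ tri r ≤ cliqueProduct colouring
    cliqueProduct-≥ = begin
      2 ^ n * b ^ tri r
        ≡⟨ cong (λ m → 2 ^ m * b ^ tri r) ∑-part ⟨
      2 ^ ∑ (λ j → size (part j)) * b ^ tri r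
        ≡⟨ ∏∏-value r (λ j → size (part j)) ⟨
      ∏ (λ j → ∏ (λ k → value (does (j Fin.≟ k)) (does (j Fin.<? k)) (size (part j)) b))
        ≤⟨ ∏-mono colour-count ⟩
      ∏ (λ j → cliques (edges (λ u v → mix (lab u) (lab v)) j) everything)
        ≡⟨ cliqueProduct-∏ colouring ⟨
      cliqueProduct colouring ∎
      where open ≤-Reasoning

count : (ℕ → Bool) → ℕ → ℕ
count P n = size {n} (P ∘ toℕ)

size-mono : ∀ {n} {P Q : Fin n → Bool} → P ⊆ᵇ Q → size P ≤ size Q
size-mono h = ∑-mono (λ u → ⟪⟫-mono (h u))

count-mono : ∀ P {m n} → m ≤ n → count P m ≤ count P n
count-mono P z≤n       = z≤n
count-mono P (s≤s m≤n) = +-monoʳ-≤ ⟪ P 0 ⟫ (count-mono (P ∘ suc) m≤n)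

count-+ : ∀ P m n → count P (m + n) ≡ count P m + count (λ i → P (m + i)) n
count-+ P zero    n = refl
count-+ P (suc m) n = trans (cong (⟪ P 0 ⟫ ℕ.+_) (count-+ (P ∘ suc) m n)) (sym (+-assoc ⟪ P 0 ⟫ _ _))

count-pos : ∀ P x m → x < m → P x ≡ true → 1 ≤ count P m
count-pos P zero    (suc m) x<m Px rewrite Px = s≤s z≤n
count-pos P (suc x) (suc m) x<m Px = ≤-trans (count-pos (P ∘ suc) x m (s≤s⁻¹ x<m) Px) (m≤n+m _ ⟪ P 0 ⟫)

count-periodic : ∀ P x m → x < m → P x ≡ true → (∀ i → P (m + i) ≡ P i) → ∀ q → q ≤ count P (q * m)
count-periodic P x m x<m Px per zero    = z≤n
count-periodic P x m x<m Px per (suc q) = begin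
  1 + q                                         ≤⟨ +-mono-≤ (count-pos P x m x<m Px) (count-periodic P x m x<m Px per q) ⟩
  count P m + count P (q * m)                   ≡⟨ cong (count P m ℕ.+_) (∑-cong {q * m} λ u → cong ⟪_⟫ (per (toℕ u))) ⟨
  count P m + count (λ i → P (m + i)) (q * m)   ≡⟨ count-+ P m (q * m) ⟨
  count P (m + q * m)                           ∎
  where open ≤-Reasoning

-- Labelling the vertices by residues modulo r² gives every class at least ⌊n / r²⌋ vertices. The
-- empty clique adds one more, and ⌊n / r²⌋ + 1 ≥ n / r² also when n is so small that classes are
-- empty.
blowup : ∀ r n .{{_ : NonZero r}} → ∃[ c ] n ^ tri r * 2 ^ n ≤ cliqueProduct {r} {n} c * (r * r) ^ tri r
blowup r n = Blowup.colouring lab , (begin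
  n ^ tri r * 2 ^ n                                ≤⟨ *-monoˡ-≤ (2 ^ n) (^-monoˡ-≤ (tri r) n≤) ⟩
  (suc (n ℕ./ m) * m) ^ tri r * 2 ^ n                ≡⟨ cong (_* 2 ^ n) (ℕ-Lemmas.^-distribʳ-* (suc (n ℕ./ m)) m (tri r)) ⟩
  suc (n ℕ./ m) ^ tri r * m ^ tri r * 2 ^ n
    ≡⟨ solve 3 (λ x y z → x :* y :* z := z :* x :* y) refl (suc (n ℕ./ m) ^ tri r) (m ^ tri r) (2 ^ n) ⟩
  2 ^ n * suc (n ℕ./ m) ^ tri r * m ^ tri r          ≤⟨ *-monoˡ-≤ (m ^ tri r) (Blowup.cliqueProduct-≥ lab (suc (n ℕ./ m)) (λ k j → s≤s (enough k j))) ⟩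
  cliqueProduct (Blowup.colouring lab) * m ^ tri r ∎)
  where
  open ≤-Reasoning
  open +-*-Solver
  m : ℕ
  m = r * r
  instance
    m≢0 : NonZero m
    m≢0 = m*n≢0 r r
  lab : Fin n → Fin r × Fin r
  lab u = remQuot r (toℕ u mod m)
  n≤ : n ≤ suc (n ℕ./ m) * m
  n≤ = ≤-trans (≤-reflexive (m≡m%n+[m/n]*n n m)) (+-monoˡ-≤ (n ℕ./ m * m) (<⇒≤ (m%n<n n m)))
  enough : ∀ k j → n ℕ./ m ≤ size (Blowup.class lab k j)
  enough k j = begin
    n ℕ./ m                    ≤⟨ count-periodic P (toℕ x) m (Fin.toℕ<n x) Px per (n ℕ./ m) ⟩
    count P (n ℕ./ m * m)      ≤⟨ count-mono P (m/n*n≤m n m) ⟩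
    count P n                ≤⟨ size-mono {P = P ∘ toℕ} {Q = Blowup.class lab k j} in-class ⟩
    size (Blowup.class lab k j) ∎
    where
    x : Fin m
    x = combine k j
    P : ℕ → Bool
    P i = does (i mod m Fin.≟ x)
    Px : P (toℕ x) ≡ true
    Px = dec-true (toℕ x mod m Fin.≟ x) (Fin.toℕ-injective
      (trans (Fin.toℕ-fromℕ< (m%n<n (toℕ x) m)) (m<n⇒m%n≡m (Fin.toℕ<n x))))
    per : ∀ i → P (m + i) ≡ P i
    per i = cong (λ y → does (y Fin.≟ x)) (Fin.fromℕ<-cong ((m + i) ℕ.% m) (i ℕ.% m)
      (trans (cong (ℕ._% m) (+-comm m i)) ([m+n]%n≡m%n i m)) (m%n<n (m + i) m) (m%n<n i m))
    in-class : (P ∘ toℕ) ⊆ᵇ Blowup.class lab k j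
    in-class u e = ∧-introᵇ (dec-true (proj₂ (lab u) Fin.≟ j) (cong proj₂ lab≡))
                            (dec-true (proj₁ (lab u) Fin.≟ k) (cong proj₁ lab≡))
      where
      lab≡ : lab u ≡ (k , j)
      lab≡ = trans (cong (remQuot r) (does-true (toℕ u mod m Fin.≟ x) e)) (Fin.remQuot-combine k j)

-- Tightness of the lower bound

∑ₗ : List A → (A → ℕ) → ℕ
∑ₗ []       f = 0
∑ₗ (x ∷ xs) f = f x + ∑ₗ xs f

∑ₗ-cong : ∀ (xs : List A) {f g} → (∀ x → f x ≡ g x) → ∑ₗ xs f ≡ ∑ₗ xs g
∑ₗ-cong []       h = refl
∑ₗ-cong (x ∷ xs) h = cong₂ _+_ (h x) (∑ₗ-cong xs h)

∑ₗ-mono : ∀ (xs : List A) {f g} → (∀ x → f x ≤ g x) → ∑ₗ xs f ≤ ∑ₗ xs g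
∑ₗ-mono []       h = z≤n
∑ₗ-mono (x ∷ xs) h = +-mono-≤ (h x) (∑ₗ-mono xs h)

∑ₗ-++ : ∀ (xs : List A) {ys f} → ∑ₗ (xs ++ ys) f ≡ ∑ₗ xs f + ∑ₗ ys f
∑ₗ-++ []           = refl
∑ₗ-++ (x ∷ xs) {f = f} = trans (cong (f x ℕ.+_) (∑ₗ-++ xs)) (sym (+-assoc (f x) _ _))

∑ₗ-map : ∀ (g : A → B) xs {f} → ∑ₗ (map g xs) f ≡ ∑ₗ xs (f ∘ g)
∑ₗ-map g []           = refl
∑ₗ-map g (x ∷ xs) {f} = cong (f (g x) ℕ.+_) (∑ₗ-map g xs)

∑ₗ-+ : ∀ (xs : List A) f g → ∑ₗ xs (λ x → f x + g x) ≡ ∑ₗ xs f + ∑ₗ xs g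
∑ₗ-+ []       f g = refl
∑ₗ-+ (x ∷ xs) f g = trans (cong (f x + g x ℕ.+_) (∑ₗ-+ xs f g))
  (solve 4 (λ a b c d → (a :+ b) :+ (c :+ d) := (a :+ c) :+ (b :+ d)) refl (f x) (g x) (∑ₗ xs f) (∑ₗ xs g))
  where open +-*-Solver

∑ₗ-0 : ∀ (xs : List A) → ∑ₗ xs (λ _ → 0) ≡ 0
∑ₗ-0 []       = refl
∑ₗ-0 (x ∷ xs) = ∑ₗ-0 xs

∑ₗ-comm : ∀ (xs : List A) (ys : List B) (f : A → B → ℕ) → ∑ₗ xs (λ x → ∑ₗ ys (f x)) ≡ ∑ₗ ys (λ y → ∑ₗ xs (λ x → f x y))
∑ₗ-comm []       ys f = sym (∑ₗ-0 ys)
∑ₗ-comm (x ∷ xs) ys f = trans (cong (∑ₗ ys (f x) ℕ.+_) (∑ₗ-comm xs ys f)) (sym (∑ₗ-+ ys (f x) _))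

∑ₗ-*ˡ : ∀ a (xs : List A) f → ∑ₗ xs (λ x → a * f x) ≡ a * ∑ₗ xs f
∑ₗ-*ˡ a []       f = sym (*-zeroʳ a)
∑ₗ-*ˡ a (x ∷ xs) f = trans (cong (a * f x ℕ.+_) (∑ₗ-*ˡ a xs f)) (sym (*-distribˡ-+ a (f x) (∑ₗ xs f)))

∑ₗ-*ʳ : ∀ (xs : List A) f a → ∑ₗ xs (λ x → f x * a) ≡ ∑ₗ xs f * a
∑ₗ-*ʳ xs f a = trans (∑ₗ-cong xs λ x → *-comm (f x) a) (trans (∑ₗ-*ˡ a xs f) (*-comm a _))

∑ₗ-const : ∀ (xs : List A) a → ∑ₗ xs (λ _ → a) ≡ length xs * a
∑ₗ-const []       a = refl
∑ₗ-const (x ∷ xs) a = cong (a ℕ.+_) (∑ₗ-const xs a)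

∑ₗ-cartesian : ∀ (g : A → B → A′) xs ys {f} → ∑ₗ (cartesianProductWith g xs ys) f ≡ ∑ₗ xs (λ x → ∑ₗ ys (λ y → f (g x y)))
∑ₗ-cartesian g []       ys     = refl
∑ₗ-cartesian g (x ∷ xs) ys {f} = trans (∑ₗ-++ (map (g x) ys)) (cong₂ _+_ (∑ₗ-map (g x) ys) (∑ₗ-cartesian g xs ys))

length-filter-≤ : {P : Pred A 0ℓ} (P? : Decidable P) (b : A → Bool) → (∀ x → P x → b x ≡ true) →
                  ∀ xs → length (filter P? xs) ≤ ∑ₗ xs (λ x → ⟪ b x ⟫)
length-filter-≤ P? b h []       = z≤n
length-filter-≤ P? b h (x ∷ xs) with P? x
... | no  _ = ≤-trans (length-filter-≤ P? b h xs) (m≤n+m _ ⟪ b x ⟫)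
... | yes p rewrite h x p = s≤s (length-filter-≤ P? b h xs)

below-average : ∀ (xs : List A) f b → 1 ≤ length xs → ∑ₗ xs f ≤ length xs * b → ∃[ x ] f x ≤ b
below-average xs f b 1≤ h with search xs
  where
  search : ∀ xs → (∃[ x ] f x ≤ b) ⊎ length xs * suc b ≤ ∑ₗ xs f
  search []       = inj₂ z≤n
  search (x ∷ xs) with f x ≤? b | search xs
  ... | yes fx≤ | _      = inj₁ (x , fx≤)
  ... | no  _   | inj₁ s = inj₁ s
  ... | no  fx≰ | inj₂ s = inj₂ (+-mono-≤ (≰⇒> fx≰) s)
... | inj₁ found = found
... | inj₂ large = ⊥-elim (<⇒≱ (*-monoʳ-< (length xs) {{>-nonZero 1≤}} (n<1+n b)) (≤-trans large h))

rows : ∀ n → List (Vec (Fin 3) n)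
rows zero    = [] ∷ []
rows (suc n) = cartesianProductWith _∷_ (allFin 3) (rows n)

-- Row by row, the colours of the edges from each vertex to the later ones.
Table : ℕ → Set
Table zero    = ⊤
Table (suc n) = Vec (Fin 3) n × Table n

tables : ∀ n → List (Table n)
tables zero    = tt ∷ []
tables (suc n) = cartesianProductWith _,_ (rows n) (tables n)

entry : ∀ {n} → Table n → Fin n → Fin n → Fin 3
-- A dummy value: `colourGraph` ignores the diagonal.
entry (row , t) zero    zero    = zero
entry (row , t) zero    (suc v) = lookup row v
entry (row , t) (suc u) zero    = lookup row u
entry (row , t) (suc u) (suc v) = entry t u v

entry-sym : ∀ {n} (t : Table n) u v → entry t u v ≡ entry t v u
entry-sym (row , t) zero    zero    = refl
entry-sym (row , t) zero    (suc v) = refl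
entry-sym (row , t) (suc u) zero    = refl
entry-sym (row , t) (suc u) (suc v) = entry-sym t u v

colouring₃ : ∀ {n} → Table n → Colouring 3 n
colouring₃ t = record { colour = entry t ; colour-sym = entry-sym t }

constant : ∀ {n} → Fin 3 → Vec (Fin 3) n → Subset n → Bool
constant i []        []            = true
constant i (x ∷ row) (inside ∷ s)  = does (x Fin.≟ i) ∧ constant i row s
constant i (x ∷ row) (outside ∷ s) = constant i row s

monochromatic : ∀ {n} → Fin 3 → Table n → Subset n → Bool
monochromatic i tt        []            = true
monochromatic i (row , t) (inside ∷ s)  = constant i row s ∧ monochromatic i t s
monochromatic i (row , t) (outside ∷ s) = monochromatic i t s

constant-true : ∀ {n} i (row : Vec (Fin 3) n) s → (∀ v → v ∈ s → lookup row v ≡ i) → constant i row s ≡ true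
constant-true i []        []            h = refl
constant-true i (x ∷ row) (inside ∷ s)  h =
  ∧-introᵇ (dec-true (x Fin.≟ i) (h zero here)) (constant-true i row s λ v v∈s → h (suc v) (there v∈s))
constant-true i (x ∷ row) (outside ∷ s) h = constant-true i row s λ v v∈s → h (suc v) (there v∈s)

clique⇒monochromatic : ∀ {n} i (t : Table n) s → IsClique (colourGraph (colouring₃ t) i) s → monochromatic i t s ≡ true
clique⇒monochromatic {zero}  i tt        []            q = refl
clique⇒monochromatic {suc n} i (row , t) (x ∷ s) q = aux x q
  where
  tail-clique : ∀ {x} → IsClique (colourGraph (colouring₃ (row , t)) i) (x ∷ s) → IsClique (colourGraph (colouring₃ t) i) s
  tail-clique q u v u∈s v∈s u≢v = u≢v , proj₂ (q (suc u) (suc v) (there u∈s) (there v∈s) (u≢v ∘ Fin.suc-injective))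
  aux : ∀ x → IsClique (colourGraph (colouring₃ (row , t)) i) (x ∷ s) → monochromatic i (row , t) (x ∷ s) ≡ true
  aux inside  q = ∧-introᵇ
    (constant-true i row s λ v v∈s → proj₂ (q zero (suc v) here (there v∈s) λ ()))
    (clique⇒monochromatic i t s (tail-clique q))
  aux outside q = clique⇒monochromatic i t s (tail-clique q)

-- `cocard` serves to write X ^ n / X ^ card s without division.
card cocard : ∀ {n} → Subset n → ℕ
card []            = 0
card (inside ∷ s)  = suc (card s)
card (outside ∷ s) = card s
cocard []            = 0
cocard (inside ∷ s)  = cocard s
cocard (outside ∷ s) = suc (cocard s)

card+cocard : ∀ {n} (s : Subset n) → card s + cocard s ≡ n
card+cocard []            = refl
card+cocard (inside ∷ s)  = cong suc (card+cocard s)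
card+cocard (outside ∷ s) = trans (+-suc (card s) (cocard s)) (cong suc (card+cocard s))

∑-cocard : ∀ n X → ∑ₗ (subsets n) (λ s → X ^ cocard s) ≡ suc X ^ n
∑-cocard zero    X = refl
∑-cocard (suc n) X = begin
  ∑ₗ (map (inside ∷_) (subsets n) ++ map (outside ∷_) (subsets n)) (λ s → X ^ cocard s)
    ≡⟨ ∑ₗ-++ (map (inside ∷_) (subsets n)) ⟩
  ∑ₗ (map (inside ∷_) (subsets n)) (λ s → X ^ cocard s) + ∑ₗ (map (outside ∷_) (subsets n)) (λ s → X ^ cocard s)
    ≡⟨ cong₂ _+_ (∑ₗ-map (inside ∷_) (subsets n)) (∑ₗ-map (outside ∷_) (subsets n)) ⟩
  ∑ₗ (subsets n) (λ s → X ^ cocard s) + ∑ₗ (subsets n) (λ s → X * X ^ cocard s)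
    ≡⟨ cong₂ _+_ (∑-cocard n X) (trans (∑ₗ-*ˡ X (subsets n) _) (cong (X *_) (∑-cocard n X))) ⟩
  suc X ^ suc n ∎
  where open ≡-Reasoning

⟪∧⟫ : ∀ a b → ⟪ a ∧ b ⟫ ≡ ⟪ a ⟫ * ⟪ b ⟫
⟪∧⟫ false b = refl
⟪∧⟫ true  b = sym (+-identityʳ ⟪ b ⟫)

exactly-one : ∀ (i : Fin 3) → ∑ₗ (allFin 3) (λ x → ⟪ does (x Fin.≟ i) ⟫) ≡ 1
exactly-one zero             = refl
exactly-one (suc zero)       = refl
exactly-one (suc (suc zero)) = refl

-- The entries at s are prescribed and the others are free; the probability 3 ^ (- card s) is stated
-- with the denominator cleared.
∑-constant : ∀ {n} i (s : Subset n) → ∑ₗ (rows n) (λ row → ⟪ constant i row s ⟫) * 3 ^ card s ≡ 3 ^ n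
∑-constant i [] = refl
∑-constant {suc n} i (inside ∷ s) = begin
  ∑ₗ (rows (suc n)) (λ row → ⟪ constant i row (inside ∷ s) ⟫) * (3 * 3 ^ card s)
    ≡⟨ cong (_* (3 * 3 ^ card s)) (∑ₗ-cartesian _∷_ (allFin 3) (rows n)) ⟩
  ∑ₗ (allFin 3) (λ x → ∑ₗ (rows n) (λ row → ⟪ does (x Fin.≟ i) ∧ constant i row s ⟫)) * (3 * 3 ^ card s)
    ≡⟨ cong (_* (3 * 3 ^ card s)) (∑ₗ-cong (allFin 3) λ x →
         trans (∑ₗ-cong (rows n) λ row → ⟪∧⟫ (does (x Fin.≟ i)) (constant i row s)) (∑ₗ-*ˡ ⟪ does (x Fin.≟ i) ⟫ (rows n) _)) ⟩
  ∑ₗ (allFin 3) (λ x → ⟪ does (x Fin.≟ i) ⟫ * Σrows) * (3 * 3 ^ card s)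
    ≡⟨ cong (_* (3 * 3 ^ card s)) (trans (∑ₗ-*ʳ (allFin 3) (λ x → ⟪ does (x Fin.≟ i) ⟫) Σrows) (cong (_* Σrows) (exactly-one i))) ⟩
  1 * Σrows * (3 * 3 ^ card s)
    ≡⟨ solve 2 (λ x y → con 1 :* x :* (con 3 :* y) := con 3 :* (x :* y)) refl Σrows (3 ^ card s) ⟩
  3 * (Σrows * 3 ^ card s)
    ≡⟨ cong (3 *_) (∑-constant i s) ⟩
  3 ^ suc n ∎
  where
  open ≡-Reasoning
  open +-*-Solver
  Σrows : ℕ
  Σrows = ∑ₗ (rows n) (λ row → ⟪ constant i row s ⟫)
∑-constant {suc n} i (outside ∷ s) = begin
  ∑ₗ (rows (suc n)) (λ row → ⟪ constant i row (outside ∷ s) ⟫) * 3 ^ card s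
    ≡⟨ cong (_* 3 ^ card s) (∑ₗ-cartesian _∷_ (allFin 3) (rows n)) ⟩
  ∑ₗ (allFin 3) (λ x → Σrows) * 3 ^ card s
    ≡⟨ cong (_* 3 ^ card s) (∑ₗ-const (allFin 3) Σrows) ⟩
  3 * Σrows * 3 ^ card s
    ≡⟨ *-assoc 3 Σrows (3 ^ card s) ⟩
  3 * (Σrows * 3 ^ card s)
    ≡⟨ cong (3 *_) (∑-constant i s) ⟩
  3 ^ suc n ∎
  where
  open ≡-Reasoning
  Σrows : ℕ
  Σrows = ∑ₗ (rows n) (λ row → ⟪ constant i row s ⟫)

∑-1 : ∀ (xs : List A) → ∑ₗ xs (λ _ → 1) ≡ length xs
∑-1 xs = trans (∑ₗ-const xs 1) (*-identityʳ (length xs))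

length-rows : ∀ n → length (rows n) ≡ 3 ^ n
length-rows zero    = refl
length-rows (suc n) = begin
  length (rows (suc n))             ≡⟨ ∑-1 (rows (suc n)) ⟨
  ∑ₗ (rows (suc n)) (λ _ → 1)       ≡⟨ ∑ₗ-cartesian _∷_ (allFin 3) (rows n) ⟩
  ∑ₗ (allFin 3) (λ _ → ∑ₗ (rows n) (λ _ → 1)) ≡⟨ ∑ₗ-const (allFin 3) (∑ₗ (rows n) (λ _ → 1)) ⟩
  3 * ∑ₗ (rows n) (λ _ → 1)         ≡⟨ cong (3 *_) (trans (∑-1 (rows n)) (length-rows n)) ⟩
  3 ^ suc n                         ∎
  where open ≡-Reasoning

length-tables : ∀ n → length (tables n) ≡ 3 ^ tri n
length-tables zero    = refl
length-tables (suc n) = begin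
  length (tables (suc n))                           ≡⟨ ∑-1 (tables (suc n)) ⟨
  ∑ₗ (tables (suc n)) (λ _ → 1)                     ≡⟨ ∑ₗ-cartesian _,_ (rows n) (tables n) ⟩
  ∑ₗ (rows n) (λ _ → ∑ₗ (tables n) (λ _ → 1))       ≡⟨ ∑ₗ-const (rows n) _ ⟩
  length (rows n) * ∑ₗ (tables n) (λ _ → 1)         ≡⟨ cong₂ _*_ (length-rows n) (trans (∑-1 (tables n)) (length-tables n)) ⟩
  3 ^ n * 3 ^ tri n                                 ≡⟨ ^-distribˡ-+-* 3 n (tri n) ⟨
  3 ^ tri (suc n)                                   ∎
  where open ≡-Reasoning

-- The `tri (card s)` edges inside s are prescribed and all others are free. Rows are independent,
-- so the count factors row by row.
∑-monochromatic : ∀ {n} i (s : Subset n) → ∑ₗ (tables n) (λ t → ⟪ monochromatic i t s ⟫) * 3 ^ tri (card s) ≡ 3 ^ tri n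
∑-monochromatic i [] = refl
∑-monochromatic {suc n} i (inside ∷ s) = begin
  ∑ₗ (tables (suc n)) (λ t → ⟪ monochromatic i t (inside ∷ s) ⟫) * 3 ^ (card s + tri (card s))
    ≡⟨ cong₂ _*_ (∑ₗ-cartesian _,_ (rows n) (tables n)) (^-distribˡ-+-* 3 (card s) (tri (card s))) ⟩
  ∑ₗ (rows n) (λ row → ∑ₗ (tables n) (λ t → ⟪ constant i row s ∧ monochromatic i t s ⟫)) * (3 ^ card s * 3 ^ tri (card s))
    ≡⟨ cong (_* (3 ^ card s * 3 ^ tri (card s))) (trans
         (∑ₗ-cong (rows n) λ row → trans (∑ₗ-cong (tables n) λ t → ⟪∧⟫ (constant i row s) (monochromatic i t s)) (∑ₗ-*ˡ ⟪ constant i row s ⟫ (tables n) _))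
         (∑ₗ-*ʳ (rows n) _ Σtables)) ⟩
  Σrows * Σtables * (3 ^ card s * 3 ^ tri (card s))
    ≡⟨ solve 4 (λ a b c d → a :* b :* (c :* d) := (a :* c) :* (b :* d)) refl Σrows Σtables (3 ^ card s) (3 ^ tri (card s)) ⟩
  (Σrows * 3 ^ card s) * (Σtables * 3 ^ tri (card s))
    ≡⟨ cong₂ _*_ (∑-constant i s) (∑-monochromatic i s) ⟩
  3 ^ n * 3 ^ tri n
    ≡⟨ ^-distribˡ-+-* 3 n (tri n) ⟨
  3 ^ tri (suc n) ∎
  where
  open ≡-Reasoning
  open +-*-Solver
  Σrows Σtables : ℕ
  Σrows   = ∑ₗ (rows n) (λ row → ⟪ constant i row s ⟫)
  Σtables = ∑ₗ (tables n) (λ t → ⟪ monochromatic i t s ⟫)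
∑-monochromatic {suc n} i (outside ∷ s) = begin
  ∑ₗ (tables (suc n)) (λ t → ⟪ monochromatic i t (outside ∷ s) ⟫) * 3 ^ tri (card s)
    ≡⟨ cong (_* 3 ^ tri (card s)) (trans (∑ₗ-cartesian _,_ (rows n) (tables n)) (∑ₗ-const (rows n) Σtables)) ⟩
  length (rows n) * Σtables * 3 ^ tri (card s)
    ≡⟨ *-assoc (length (rows n)) Σtables (3 ^ tri (card s)) ⟩
  length (rows n) * (Σtables * 3 ^ tri (card s))
    ≡⟨ cong₂ _*_ (length-rows n) (∑-monochromatic i s) ⟩
  3 ^ n * 3 ^ tri n
    ≡⟨ ^-distribˡ-+-* 3 n (tri n) ⟨
  3 ^ tri (suc n) ∎
  where
  open ≡-Reasoning
  Σtables : ℕ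
  Σtables = ∑ₗ (tables n) (λ t → ⟪ monochromatic i t s ⟫)

-- This is AM-GM: the maximum over s of a s - s (s - 1) / 2 is attained at s = a.
product-≤-tri : ∀ a s → a * s ≤ tri s + tri (suc a)
product-≤-tri zero    s       = z≤n
product-≤-tri (suc a) zero    = ≤-trans (≤-reflexive (*-zeroʳ a)) z≤n
product-≤-tri (suc a) (suc s) = begin
  suc a * suc s                            ≡⟨ solve 2 (λ a s → (con 1 :+ a) :* (con 1 :+ s) := a :* s :+ (con 1 :+ a :+ s)) refl a s ⟩
  a * s + (1 + a + s)                      ≤⟨ +-monoˡ-≤ (1 + a + s) (product-≤-tri a s) ⟩
  tri s + tri (suc a) + (1 + a + s)        ≡⟨ solve 4 (λ x y a s → x :+ y :+ (con 1 :+ a :+ s) := s :+ x :+ (con 1 :+ a :+ y)) refl (tri s) (tri (suc a)) a s ⟩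
  tri (suc s) + tri (suc (suc a))          ∎
  where
  open ≤-Reasoning
  open +-*-Solver

-- Divided by `suc X ^ suc n`, this is Bernoulli's inequality (1 - 1 / (X + 1)) ^ n ≥ 1 - n / (X +
-- 1).
bernoulli-1 : ∀ X n → suc X ^ suc n ≤ X ^ n * suc X + n * suc X ^ n
bernoulli-1 X zero    = ≤-reflexive (solve 1 (λ x → (con 1 :+ x) :* con 1 := con 1 :* (con 1 :+ x) :+ con 0) refl X)
  where open +-*-Solver
bernoulli-1 X (suc n) = begin
  suc X ^ suc n + X * suc X ^ suc n
    ≤⟨ +-monoʳ-≤ (suc X ^ suc n) (*-monoʳ-≤ X (bernoulli-1 X n)) ⟩
  suc X ^ suc n + X * (X ^ n * suc X + n * suc X ^ n)
    ≤⟨ m≤m+n _ (n * suc X ^ n) ⟩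
  suc X ^ suc n + X * (X ^ n * suc X + n * suc X ^ n) + n * suc X ^ n
    ≡⟨ solve 4 (λ x p n q → (con 1 :+ x) :* q :+ x :* (p :* (con 1 :+ x) :+ n :* q) :+ n :* q :=
         x :* p :* (con 1 :+ x) :+ (con 1 :+ n) :* ((con 1 :+ x) :* q)) refl X (X ^ n) n (suc X ^ n) ⟩
  X ^ suc n * suc X + suc n * suc X ^ suc n ∎
  where
  open ≤-Reasoning
  open +-*-Solver

-- The hypothesis makes the right-hand side of Bernoulli's inequality at least 1/2.
[1+X]^n≤2X^n : ∀ X n → 2 * n ≤ suc X → suc X ^ n ≤ 2 * X ^ n
[1+X]^n≤2X^n X n h = *-cancelʳ-≤ (suc X ^ n) (2 * X ^ n) (suc X) (+-cancelʳ-≤ (suc X * suc X ^ n) _ _ (begin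
  suc X ^ n * suc X + suc X * suc X ^ n
    ≡⟨ solve 2 (λ x q → q :* x :+ x :* q := con 2 :* (x :* q)) refl (suc X) (suc X ^ n) ⟩
  2 * suc X ^ suc n                             ≤⟨ *-monoʳ-≤ 2 (bernoulli-1 X n) ⟩
  2 * (X ^ n * suc X + n * suc X ^ n)
    ≡⟨ solve 4 (λ x p n q → con 2 :* (p :* x :+ n :* q) := con 2 :* p :* x :+ con 2 :* n :* q) refl (suc X) (X ^ n) n (suc X ^ n) ⟩
  2 * X ^ n * suc X + 2 * n * suc X ^ n         ≤⟨ +-monoʳ-≤ (2 * X ^ n * suc X) (*-monoˡ-≤ (suc X ^ n) h) ⟩
  2 * X ^ n * suc X + suc X * suc X ^ n         ∎))
  where
  open ≤-Reasoning
  open +-*-Solver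

-- The expected number of cliques of a random three-colouring

module Average (n a : ℕ) (2n≤ : 2 * n ≤ suc (3 ^ a)) where

  open ≤-Reasoning
  open +-*-Solver

  hits : Fin 3 → Subset n → ℕ
  hits i s = ∑ₗ (tables n) (λ t → ⟪ monochromatic i t s ⟫)

  X bound : ℕ
  X = 3 ^ a
  bound = 3 ^ tri n * 3 ^ tri (suc a)

  -- `product-≤-tri` replaces the quadratic exponent `tri (card s)` by the linear a · `card s`, so
  -- that the sum over all s becomes a binomial one.
  hits-bound : ∀ i s → hits i s * X ^ card s ≤ bound
  hits-bound i s = begin
    hits i s * X ^ card s                              ≡⟨ cong (hits i s *_) (^-*-assoc 3 a (card s)) ⟩
    hits i s * 3 ^ (a * card s)                        ≤⟨ *-monoʳ-≤ (hits i s) (^-monoʳ-≤ 3 (product-≤-tri a (card s))) ⟩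
    hits i s * 3 ^ (tri (card s) + tri (suc a))        ≡⟨ cong (hits i s *_) (^-distribˡ-+-* 3 (tri (card s)) (tri (suc a))) ⟩
    hits i s * (3 ^ tri (card s) * 3 ^ tri (suc a))    ≡⟨ *-assoc (hits i s) _ _ ⟨
    hits i s * 3 ^ tri (card s) * 3 ^ tri (suc a)      ≡⟨ cong (_* 3 ^ tri (suc a)) (∑-monochromatic i s) ⟩
    bound                                              ∎

  -- After multiplication by X ^ n the terms become X ^ `cocard s`, with sum (X + 1) ^ n; a is large
  -- enough for this to be at most 2 X ^ n.
  ∑-hits : ∀ i → ∑ₗ (subsets n) (hits i) ≤ 2 * bound
  ∑-hits i = *-cancelʳ-≤ _ _ (X ^ n) {{m^n≢0 X n {{m^n≢0 3 a}}}} (begin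
    ∑ₗ (subsets n) (hits i) * X ^ n
      ≡⟨ ∑ₗ-*ʳ (subsets n) (hits i) (X ^ n) ⟨
    ∑ₗ (subsets n) (λ s → hits i s * X ^ n)
      ≤⟨ ∑ₗ-mono (subsets n) (λ s → begin
           hits i s * X ^ n                              ≡⟨ cong (λ m → hits i s * X ^ m) (card+cocard s) ⟨
           hits i s * X ^ (card s + cocard s)            ≡⟨ cong (hits i s *_) (^-distribˡ-+-* X (card s) (cocard s)) ⟩
           hits i s * (X ^ card s * X ^ cocard s)        ≡⟨ *-assoc (hits i s) _ _ ⟨
           hits i s * X ^ card s * X ^ cocard s          ≤⟨ *-monoˡ-≤ (X ^ cocard s) (hits-bound i s) ⟩
           bound * X ^ cocard s                          ∎) ⟩
    ∑ₗ (subsets n) (λ s → bound * X ^ cocard s)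
      ≡⟨ trans (∑ₗ-*ˡ bound (subsets n) _) (cong (bound *_) (∑-cocard n X)) ⟩
    bound * suc X ^ n
      ≤⟨ *-monoʳ-≤ bound ([1+X]^n≤2X^n X n 2n≤) ⟩
    bound * (2 * X ^ n)
      ≡⟨ solve 2 (λ b x → b :* (con 2 :* x) := con 2 :* b :* x) refl bound (X ^ n) ⟩
    2 * bound * X ^ n ∎)

  counts : Table n → ℕ
  counts t = ∑ₗ (allFin 3) (λ i → cliqueCount (colourGraph (colouring₃ t) i))

  ∑-counts : ∑ₗ (tables n) counts ≤ length (tables n) * (6 * 3 ^ tri (suc a))
  ∑-counts = begin
    ∑ₗ (tables n) counts
      ≤⟨ ∑ₗ-mono (tables n) (λ t → ∑ₗ-mono (allFin 3) λ i →
           length-filter-≤ (isClique? (colourGraph (colouring₃ t) i)) (monochromatic i t) (clique⇒monochromatic i t) (subsets n)) ⟩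
    ∑ₗ (tables n) (λ t → ∑ₗ (allFin 3) (λ i → ∑ₗ (subsets n) (λ s → ⟪ monochromatic i t s ⟫)))
      ≡⟨ ∑ₗ-comm (tables n) (allFin 3) (λ t i → ∑ₗ (subsets n) (λ s → ⟪ monochromatic i t s ⟫)) ⟩
    ∑ₗ (allFin 3) (λ i → ∑ₗ (tables n) (λ t → ∑ₗ (subsets n) (λ s → ⟪ monochromatic i t s ⟫)))
      ≡⟨ ∑ₗ-cong (allFin 3) (λ i → ∑ₗ-comm (tables n) (subsets n) (λ t s → ⟪ monochromatic i t s ⟫)) ⟩
    ∑ₗ (allFin 3) (λ i → ∑ₗ (subsets n) (hits i))
      ≤⟨ ∑ₗ-mono (allFin 3) ∑-hits ⟩
    ∑ₗ (allFin 3) (λ _ → 2 * bound)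
      ≡⟨ ∑ₗ-const (allFin 3) (2 * bound) ⟩
    3 * (2 * (3 ^ tri n * 3 ^ tri (suc a)))
      ≡⟨ solve 2 (λ x y → con 3 :* (con 2 :* (x :* y)) := x :* (con 6 :* y)) refl (3 ^ tri n) (3 ^ tri (suc a)) ⟩
    3 ^ tri n * (6 * 3 ^ tri (suc a))
      ≡⟨ cong (_* (6 * 3 ^ tri (suc a))) (length-tables n) ⟨
    length (tables n) * (6 * 3 ^ tri (suc a)) ∎

  -- Averaging the sum of the three counts, instead of each count, yields one table that is good for
  -- all three colours; hence 6 = 3 · 2.
  few-cliques : ∃[ t ] ∀ i → cliqueCount (colourGraph (colouring₃ {n} t) i) ≤ 6 * 3 ^ tri (suc a)
  few-cliques = proj₁ found , λ i → ≤-trans (member (proj₁ found) i) (proj₂ found)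
    where
    found : ∃[ t ] counts t ≤ 6 * 3 ^ tri (suc a)
    found = below-average (tables n) counts (6 * 3 ^ tri (suc a))
      (≤-trans (m^n>0 3 (tri n)) (≤-reflexive (sym (length-tables n)))) ∑-counts
    member : ∀ t i → cliqueCount (colourGraph (colouring₃ {n} t) i) ≤ counts t
    member t zero             = m≤m+n _ _
    member t (suc zero)       = ≤-trans (m≤m+n _ _) (m≤n+m _ (cliqueCount (colourGraph (colouring₃ t) zero)))
    member t (suc (suc zero)) = ≤-trans (≤-trans (m≤m+n _ 0) (m≤n+m _ (cliqueCount (colourGraph (colouring₃ t) (suc zero)))))
      (m≤n+m _ (cliqueCount (colourGraph (colouring₃ t) zero)))

cliques-edgeless : ∀ {n} {R : Fin n → Fin n → Bool} (P : Fin n → Bool) → (∀ u v → R u v ≡ false) → cliques R P ≤ suc n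
cliques-edgeless {zero}      P h = ≤-refl
cliques-edgeless {suc n} {R} P h = ≤-trans (+-mono-≤ (cliques-edgeless (P ∘ suc) (λ u v → h (suc u) (suc v))) (aux (P zero))) (≤-reflexive (+-comm (suc n) 1))
  where
  R′ : Fin n → Fin n → Bool
  R′ u v = R (suc u) (suc v)
  lonely : ∀ {n} {R : Fin n → Fin n → Bool} P → (∀ u → P u ≡ false) → cliques R P ≡ 1
  lonely {zero}  P e = refl
  lonely {suc n} P e rewrite e zero = trans (+-identityʳ _) (lonely (P ∘ suc) (e ∘ suc))
  ∧-false : ∀ a {b} → b ≡ false → a ∧ b ≡ false
  ∧-false false e = refl
  ∧-false true  e = e
  aux : ∀ p → (if p then cliques R′ (λ v → P (suc v) ∧ R zero (suc v)) else 0) ≤ 1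
  aux false = z≤n
  aux true  = ≤-reflexive (lonely (λ v → P (suc v) ∧ R zero (suc v)) (λ v → ∧-false (P (suc v)) (h zero (suc v))))

module _ (r : ℕ) {n : ℕ} (c : Colouring 3 n) where

  open Colouring

  padded : Colouring (3 + r) n
  padded = record { colour = λ u v → colour c u v ↑ˡ r ; colour-sym = λ u v → cong (_↑ˡ r) (colour-sym c u v) }

  private
    k : Fin (3 + r) → ℕ
    k i = cliques (edges (colour padded) i) everything

    used : ∀ {b} i → (∀ x → does ((x ↑ˡ r) Fin.≟ (i ↑ˡ r)) ≡ does (x Fin.≟ i)) →
           cliqueCount (colourGraph c i) ≤ b → k (i ↑ˡ r) ≤ b
    used i h = ≤-trans (≤-reflexive (trans
      (cliques-cong {P = everything} {Q = everything} (λ u v → h (colour c u v)) (λ _ → refl))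
      (sym (cliqueCount-cliques c i))))

    unused : ∀ i → k (suc (suc (suc i))) ≤ suc n
    unused i = cliques-edgeless everything λ u v → none (colour c u v)
      where
      none : ∀ (x : Fin 3) → does ((x ↑ˡ r) Fin.≟ suc (suc (suc i))) ≡ false
      none zero             = refl
      none (suc zero)       = refl
      none (suc (suc zero)) = refl

  cliqueProduct-padded : ∀ b → (∀ i → cliqueCount (colourGraph c i) ≤ b) → cliqueProduct padded ≤ b ^ 3 * suc n ^ r
  cliqueProduct-padded b few = begin
    cliqueProduct padded
      ≡⟨ cliqueProduct-∏ padded ⟩
    k zero * (k (suc zero) * (k (suc (suc zero)) * ∏ (λ i → k (suc (suc (suc i))))))
      ≤⟨ *-mono-≤ (used zero (λ { zero → refl ; (suc zero) → refl ; (suc (suc zero)) → refl }) (few zero))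
          (*-mono-≤ (used (suc zero) (λ { zero → refl ; (suc zero) → refl ; (suc (suc zero)) → refl }) (few (suc zero)))
           (*-mono-≤ (used (suc (suc zero)) (λ { zero → refl ; (suc zero) → refl ; (suc (suc zero)) → refl }) (few (suc (suc zero))))
            (≤-trans (∏-mono unused) (≤-reflexive (∏-const r (suc n)))))) ⟩
    b * (b * (b * suc n ^ r))
      ≡⟨ solve 2 (λ b m → b :* (b :* (b :* m)) := b :* (b :* (b :* con 1)) :* m) refl b (suc n ^ r) ⟩
    b ^ 3 * suc n ^ r ∎
    where
    open ≤-Reasoning
    open +-*-Solver

few-cliques-product : ∀ r n a → 2 * n ≤ suc (3 ^ a) →
  ∃[ c ] cliqueProduct {3 + r} {n} c ≤ (6 * 3 ^ tri (suc a)) ^ 3 * suc n ^ r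
few-cliques-product r n a 2n≤ =
  let t , few = Average.few-cliques n a 2n≤
  in padded r (colouring₃ t) , cliqueProduct-padded r (colouring₃ t) (6 * 3 ^ tri (suc a)) few

-- The upper bound

-- This reduces the upper bound to finding a short list that contains every tuple; that list may
-- have repetitions and extra entries.
unique-⊆-length : ∀ {xs ys : List A} → Unique xs → (∀ {x} → x ∈ₗ xs → x ∈ₗ ys) → length xs ≤ length ys
unique-⊆-length {xs = []}     _          _     = z≤n
unique-⊆-length {xs = x ∷ xs} (x∉ ∷ uxs) xs⊆ys with ∈-∃++ (xs⊆ys (here refl))
... | as , bs , refl = begin
  suc (length xs)               ≤⟨ s≤s (unique-⊆-length uxs remaining) ⟩
  suc (length (as ++ bs))       ≡⟨ cong suc (List.length-++ as) ⟩
  suc (length as + length bs)   ≡⟨ +-suc (length as) (length bs) ⟨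
  length as + suc (length bs)   ≡⟨ List.length-++ as ⟨
  length (as ++ x ∷ bs)         ∎
  where
  open ≤-Reasoning
  remaining : ∀ {y} → y ∈ₗ xs → y ∈ₗ as ++ bs
  remaining {y} y∈xs with ∈-++⁻ as (xs⊆ys (there y∈xs))
  ... | inj₁ y∈as         = ∈-++⁺ˡ y∈as
  ... | inj₂ (here refl)  = ⊥-elim (All.lookup x∉ y∈xs refl)
  ... | inj₂ (there y∈bs) = ∈-++⁺ʳ as y∈bs

choices : ∀ {m} → (Fin m → List A) → List (Vec A m)
choices {m = zero}  L = [] ∷ []
choices {m = suc m} L = cartesianProductWith _∷_ (L zero) (choices (L ∘ suc))

length-cartesian : ∀ (g : A → B → A′) xs ys → length (cartesianProductWith g xs ys) ≡ length xs * length ys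
length-cartesian g xs ys = begin
  length (cartesianProductWith g xs ys)         ≡⟨ ∑-1 (cartesianProductWith g xs ys) ⟨
  ∑ₗ (cartesianProductWith g xs ys) (λ _ → 1)   ≡⟨ ∑ₗ-cartesian g xs ys ⟩
  ∑ₗ xs (λ _ → ∑ₗ ys (λ _ → 1))                 ≡⟨ ∑ₗ-const xs (∑ₗ ys (λ _ → 1)) ⟩
  length xs * ∑ₗ ys (λ _ → 1)                   ≡⟨ cong (length xs *_) (∑-1 ys) ⟩
  length xs * length ys                         ∎
  where open ≡-Reasoning

length-choices : ∀ {m} (L : Fin m → List A) → length (choices L) ≡ ∏ (length ∘ L)
length-choices {m = zero}  L = refl
length-choices {m = suc m} L = trans (length-cartesian _∷_ (L zero) (choices (L ∘ suc)))
  (cong (length (L zero) *_) (length-choices (L ∘ suc)))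

∈-choices⁺ : ∀ {m} {L : Fin m → List A} (v : Vec A m) → (∀ i → lookup v i ∈ₗ L i) → v ∈ₗ choices L
∈-choices⁺ []      h = here refl
∈-choices⁺ (x ∷ v) h = ∈-cartesianProductWith⁺ _∷_ (h zero) (∈-choices⁺ v (h ∘ suc))

∈-choices⁻ : ∀ {m} {L : Fin m → List A} {v : Vec A m} → v ∈ₗ choices L → ∀ i → lookup v i ∈ₗ L i
∈-choices⁻ {m = suc m} {L} h i with ∈-cartesianProductWith⁻ _∷_ (L zero) (choices (L ∘ suc)) h
∈-choices⁻ {m = suc m} {L} h zero    | _ , _ , x∈ , v∈ , refl = x∈
∈-choices⁻ {m = suc m} {L} h (suc i) | _ , _ , x∈ , v∈ , refl = ∈-choices⁻ v∈ i

choices-unique : ∀ {m} {L : Fin m → List A} → (∀ i → Unique (L i)) → Unique (choices L)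
choices-unique {m = zero}  u = [] ∷ []
choices-unique {m = suc m} u = Unique.cartesianProductWith⁺ _∷_ Vec.∷-injective (u zero) (choices-unique (u ∘ suc))

∈-subsets : ∀ {n} (s : Subset n) → s ∈ₗ subsets n
∈-subsets []            = here refl
∈-subsets (inside ∷ s)  = ∈-++⁺ˡ (∈-map⁺ (inside ∷_) (∈-subsets s))
∈-subsets (outside ∷ s) = ∈-++⁺ʳ (map (inside ∷_) (subsets _)) (∈-map⁺ (outside ∷_) (∈-subsets s))

subsets-unique : ∀ n → Unique (subsets n)
subsets-unique zero    = [] ∷ []
subsets-unique (suc n) = Unique.++⁺ (Unique.map⁺ Vec.∷-injectiveʳ (subsets-unique n))
  (Unique.map⁺ Vec.∷-injectiveʳ (subsets-unique n)) disjoint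
  where
  disjoint : ∀ {s} → ¬ (s ∈ₗ map (inside ∷_) (subsets n) × s ∈ₗ map (outside ∷_) (subsets n))
  disjoint (p , q) with ∈-map⁻ (inside ∷_) p | ∈-map⁻ (outside ∷_) q
  ... | _ , _ , refl | _ , _ , ()

length-subsets : ∀ n → length (subsets n) ≡ 2 ^ n
length-subsets zero    = refl
length-subsets (suc n) = begin
  length (map (inside ∷_) (subsets n) ++ map (outside ∷_) (subsets n))
    ≡⟨ List.length-++ (map (inside ∷_) (subsets n)) ⟩
  length (map (inside ∷_) (subsets n)) + length (map (outside ∷_) (subsets n))
    ≡⟨ cong₂ _+_ (trans (List.length-map (inside ∷_) (subsets n)) (length-subsets n)) (trans (List.length-map (outside ∷_) (subsets n)) (length-subsets n)) ⟩
  2 ^ n + 2 ^ n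
    ≡⟨ cong (2 ^ n ℕ.+_) (+-identityʳ (2 ^ n)) ⟨
  2 ^ suc n ∎
  where open ≡-Reasoning

length-concatMap-≤ : ∀ (f : A → List B) b xs → (∀ x → length (f x) ≤ b) → length (concatMap f xs) ≤ length xs * b
length-concatMap-≤ f b []       h = z≤n
length-concatMap-≤ f b (x ∷ xs) h = ≤-trans (≤-reflexive (List.length-++ (f x)))
  (+-mono-≤ (h x) (length-concatMap-≤ f b xs h))

comprehension : (Fin n → Bool) → Subset n
comprehension = tabulate

comprehension-≡ : ∀ {P : Fin n → Set} (P? : ∀ x → Dec (P x)) (s : Subset n) →
  (∀ x → x ∈ s → P x) → (∀ x → P x → x ∈ s) → comprehension (λ x → does (P? x)) ≡ s
comprehension-≡ P? s ⇒ ⇐ = trans (Vec.tabulate-cong pointwise) (Vec.tabulate∘lookup s)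
  where
  pointwise : ∀ x → does (P? x) ≡ lookup s x
  pointwise x with P? x
  ... | yes p = sym (Vec.[]=⇒lookup (⇐ x p))
  ... | no ¬p with lookup s x in eq
  ...   | true  = ⊥-elim (¬p (⇒ x (Vec.lookup⇒[]= x s eq)))
  ...   | false = refl

-- The entries (i , j) and (j , i) are grouped: one of them alone may be large, only their product
-- is controlled.
∏∏-pairs : ∀ {r} (f : Fin r → Fin r → ℕ) b → (∀ i → f i i ≤ 1) → (∀ i j → i ≢ j → f i j * f j i ≤ b) →
           ∏ (λ i → ∏ (f i)) ≤ b ^ tri r
∏∏-pairs {zero}  f b diag off = ≤-refl
∏∏-pairs {suc r} f b diag off = begin
  f zero zero * ∏ (λ j → f zero (suc j)) * ∏ (λ i → f (suc i) zero * ∏ (λ j → f (suc i) (suc j)))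
    ≤⟨ *-monoˡ-≤ _ (≤-trans (*-monoˡ-≤ _ (diag zero)) (≤-reflexive (*-identityˡ _))) ⟩
  ∏ (λ j → f zero (suc j)) * ∏ (λ i → f (suc i) zero * ∏ (λ j → f (suc i) (suc j)))
    ≡⟨ cong (∏ (λ j → f zero (suc j)) *_) (∏-* (λ i → f (suc i) zero) (λ i → ∏ (λ j → f (suc i) (suc j)))) ⟩
  ∏ (λ j → f zero (suc j)) * (∏ (λ i → f (suc i) zero) * ∏ (λ i → ∏ (λ j → f (suc i) (suc j))))
    ≡⟨ *-assoc (∏ (λ j → f zero (suc j))) _ _ ⟨
  ∏ (λ j → f zero (suc j)) * ∏ (λ i → f (suc i) zero) * ∏ (λ i → ∏ (λ j → f (suc i) (suc j)))
    ≡⟨ cong (_* ∏ (λ i → ∏ (λ j → f (suc i) (suc j)))) (∏-* (λ j → f zero (suc j)) (λ j → f (suc j) zero)) ⟨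
  ∏ (λ j → f zero (suc j) * f (suc j) zero) * ∏ (λ i → ∏ (λ j → f (suc i) (suc j)))
    ≤⟨ *-mono-≤ (≤-trans (∏-mono (λ j → off zero (suc j) λ ())) (≤-reflexive (∏-const r b)))
         (∏∏-pairs (λ i j → f (suc i) (suc j)) b (diag ∘ suc) (λ i j i≢j → off (suc i) (suc j) (i≢j ∘ Fin.suc-injective))) ⟩
  b ^ r * b ^ tri r
    ≡⟨ ^-distribˡ-+-* b r (tri r) ⟨
  b ^ tri (suc r) ∎
  where open ≤-Reasoning

∑ₗ-filter : ∀ {P : Pred A 0ℓ} (P? : Decidable P) xs → ∑ₗ xs (λ x → ⟪ does (P? x) ⟫) ≡ length (filter P? xs)
∑ₗ-filter P? []       = refl
∑ₗ-filter P? (x ∷ xs) with does (P? x)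
... | true  = cong suc (∑ₗ-filter P? xs)
... | false = ∑ₗ-filter P? xs

∑ₗ-≤ : ∀ (xs : List A) f b → (∀ x → x ∈ₗ xs → f x ≤ b) → ∑ₗ xs f ≤ length xs * b
∑ₗ-≤ []       f b h = z≤n
∑ₗ-≤ (x ∷ xs) f b h = +-mono-≤ (h x (here refl)) (∑ₗ-≤ xs f b λ y y∈ → h y (there y∈))

-- Each pair is charged to x when P holds and otherwise to y, and no element is charged more than d
-- times.
double-count : {P Q : A → B → Set} (P? : ∀ x y → Dec (P x y)) (Q? : ∀ x y → Dec (Q x y)) →
  (∀ x y → P x y ⊎ Q x y) → ∀ xs ys d →
  (∀ x → x ∈ₗ xs → length (filter (P? x) ys) ≤ d) →
  (∀ y → y ∈ₗ ys → length (filter (λ x → Q? x y) xs) ≤ d) →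
  length xs * length ys ≤ length xs * d + length ys * d
double-count P? Q? total xs ys d hP hQ = begin
  length xs * length ys
    ≡⟨ cong (length xs *_) (∑-1 ys) ⟨
  length xs * ∑ₗ ys (λ _ → 1)
    ≡⟨ ∑ₗ-const xs (∑ₗ ys (λ _ → 1)) ⟨
  ∑ₗ xs (λ x → ∑ₗ ys (λ y → 1))
    ≤⟨ ∑ₗ-mono xs (λ x → ∑ₗ-mono ys (λ y → one x y (P? x y) (Q? x y))) ⟩
  ∑ₗ xs (λ x → ∑ₗ ys (λ y → ⟪ does (P? x y) ⟫ + ⟪ does (Q? x y) ⟫))
    ≡⟨ trans (∑ₗ-cong xs λ x → ∑ₗ-+ ys (λ y → ⟪ does (P? x y) ⟫) (λ y → ⟪ does (Q? x y) ⟫))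
             (∑ₗ-+ xs (λ x → ∑ₗ ys (λ y → ⟪ does (P? x y) ⟫)) (λ x → ∑ₗ ys (λ y → ⟪ does (Q? x y) ⟫))) ⟩
  ∑ₗ xs (λ x → ∑ₗ ys (λ y → ⟪ does (P? x y) ⟫)) + ∑ₗ xs (λ x → ∑ₗ ys (λ y → ⟪ does (Q? x y) ⟫))
    ≡⟨ cong (∑ₗ xs (λ x → ∑ₗ ys (λ y → ⟪ does (P? x y) ⟫)) ℕ.+_) (∑ₗ-comm xs ys (λ x y → ⟪ does (Q? x y) ⟫)) ⟩
  ∑ₗ xs (λ x → ∑ₗ ys (λ y → ⟪ does (P? x y) ⟫)) + ∑ₗ ys (λ y → ∑ₗ xs (λ x → ⟪ does (Q? x y) ⟫))
    ≤⟨ +-mono-≤ (∑ₗ-≤ xs _ d λ x x∈ → ≤-trans (≤-reflexive (∑ₗ-filter (P? x) ys)) (hP x x∈))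
                (∑ₗ-≤ ys _ d λ y y∈ → ≤-trans (≤-reflexive (∑ₗ-filter (λ x → Q? x y) xs)) (hQ y y∈)) ⟩
  length xs * d + length ys * d ∎
  where
  open ≤-Reasoning
  one : ∀ x y (p : Dec _) (q : Dec _) → 1 ≤ ⟪ does p ⟫ + ⟪ does q ⟫
  one x y (yes _) q       = s≤s z≤n
  one x y (no ¬p) (yes _) = s≤s z≤n
  one x y (no ¬p) (no ¬q) with total x y
  ... | inj₁ p = ⊥-elim (¬p p)
  ... | inj₂ q = ⊥-elim (¬q q)

-- If both exceeded 2 d, each summand on the right would be less than half of x y.
one-small : ∀ x y d → x * y ≤ x * d + y * d → x ≤ 2 * d ⊎ y ≤ 2 * d
one-small x y d h with x ≤? 2 * d | y ≤? 2 * d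
... | yes x≤ | _      = inj₁ x≤
... | no  _  | yes y≤ = inj₂ y≤
... | no x≰  | no y≰  = ⊥-elim (<-irrefl refl (begin-strict
  2 * (x * y)                   ≤⟨ *-monoʳ-≤ 2 h ⟩
  2 * (x * d + y * d)           ≡⟨ solve 3 (λ x y d → con 2 :* (x :* d :+ y :* d) := x :* (con 2 :* d) :+ (con 2 :* d) :* y) refl x y d ⟩
  x * (2 * d) + 2 * d * y       <⟨ +-mono-≤-< (*-monoʳ-≤ x (<⇒≤ (≰⇒> y≰))) (*-monoˡ-< y {{>-nonZero (≤-trans (s≤s z≤n) (≰⇒> y≰))}} (≰⇒> x≰)) ⟩
  x * y + x * y                 ≡⟨ cong (x * y ℕ.+_) (+-identityʳ (x * y)) ⟨
  2 * (x * y)                   ∎))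
  where
  open ≤-Reasoning
  open +-*-Solver

one-small-product : ∀ x y d m → x ≤ m → y ≤ m → x ≤ d ⊎ y ≤ d → suc (2 * x) * suc (2 * y) ≤ suc (2 * d) * suc (2 * m)
one-small-product x y d m x≤ y≤ (inj₁ x≤d) = *-mono-≤ (s≤s (*-monoʳ-≤ 2 x≤d)) (s≤s (*-monoʳ-≤ 2 y≤))
one-small-product x y d m x≤ y≤ (inj₂ y≤d) = ≤-trans (≤-reflexive (*-comm (suc (2 * x)) (suc (2 * y))))
  (*-mono-≤ (s≤s (*-monoʳ-≤ 2 y≤d)) (s≤s (*-monoʳ-≤ 2 x≤)))

-- Encoding the tuples of cliques with a given union

module Codes {r n : ℕ} (c : Colouring r n) where

  open Colouring

  Tuple : Set
  Tuple = Vec (Subset n) r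

  Cliques : Tuple → Set
  Cliques S = ∀ i → IsClique (colourGraph c i) (lookup S i)

  infix 4 _∈ᵁ_

  _∈ᵁ_ : Fin n → Tuple → Set
  x ∈ᵁ S = ∃[ i ] x ∈ lookup S i

  -- Every vertex is far from itself, as `colourGraph` has no loops.
  Far : Fin r → Fin n → Fin n → Set
  Far j x y = ¬ Graph.Adj (colourGraph c j) x y

  far? : ∀ j x y → Dec (Far j x y)
  far? j x y = ¬? (Graph.adj? (colourGraph c j) x y)

  far : Tuple → Fin r → Fin n → List (Fin n)
  far S j x = filter (λ y → (y ∈? lookup S j) ×-dec far? j x y) (allFin n)

  movable? : ∀ S i j x → Dec (x ∈ lookup S i × length (far S j x) ≤ r)
  movable? S i j x = (x ∈? lookup S i) ×-dec (length (far S j x) ≤? r)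

  -- The vertices of the i-th clique that may lie in the j-th clique of another tuple with the same union.
  movable : Tuple → Fin r → Fin r → List (Fin n)
  movable S i j = filter (movable? S i j) (allFin n)

  -- Entry (i , j) records the vertex of S_i ∩ T_j for i ≢ j, if there is one, and whether it also
  -- stays in T_i.
  Code : Set
  Code = Maybe (Fin n × Bool)

  moves : Bool → Tuple → Fin r → Fin r → List Code
  moves true  S i j = nothing ∷ []
  moves false S i j = nothing ∷ cartesianProductWith (λ x b → just (x , b)) (movable S i j) (true ∷ false ∷ [])

  codes : Tuple → Fin r → Fin r → List Code
  codes S i j = moves (does (i Fin.≟ j)) S i j

  movable-unique : ∀ S i j → Unique (movable S i j)
  movable-unique S i j = Unique.filter⁺ (movable? S i j) (Unique.allFin⁺ n)

  few-far : ∀ S i j k x → x ∈ₗ movable S i j → length (filter (far? j x) (movable S j k)) ≤ r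
  few-far S i j k x x∈ = ≤-trans
    (unique-⊆-length (Unique.filter⁺ (far? j x) (movable-unique S j k)) λ {y} y∈ →
      let y∈movable , y-far = ∈-filter⁻ (far? j x) {xs = movable S j k} y∈
          _ , y∈S , _       = ∈-filter⁻ (movable? S j k) {xs = allFin n} y∈movable
      in ∈-filter⁺ (λ y → (y ∈? lookup S j) ×-dec far? j x y) (∈-allFin y) (y∈S , y-far))
    (proj₂ (proj₂ (∈-filter⁻ (movable? S i j) {xs = allFin n} x∈)))

  -- The edge between x and y cannot have both colour i and colour j.
  total : ∀ i j → i ≢ j → ∀ x y → Far j x y ⊎ Far i y x
  total i j i≢j x y with far? j x y
  ... | yes far-j = inj₁ far-j
  ... | no ¬far-j = inj₂ λ (_ , cyx≡i) → ¬far-j λ (_ , cxy≡j) →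
    i≢j (trans (sym cyx≡i) (trans (colour-sym c y x) cxy≡j))

  movable-small : ∀ S i j → i ≢ j → length (movable S i j) ≤ 2 * r ⊎ length (movable S j i) ≤ 2 * r
  movable-small S i j i≢j = one-small (length (movable S i j)) (length (movable S j i)) r
    (double-count (far? j) (λ x y → far? i y x) (total i j i≢j) (movable S i j) (movable S j i) r
      (few-far S i j i) (few-far S j i j))

  length-codes-≢ : ∀ S i j → i ≢ j → length (codes S i j) ≡ suc (2 * length (movable S i j))
  length-codes-≢ S i j i≢j rewrite dec-false (i Fin.≟ j) i≢j =
    cong suc (trans (length-cartesian _ (movable S i j) (true ∷ false ∷ [])) (*-comm (length (movable S i j)) 2))

  length-codes-≡ : ∀ S i → length (codes S i i) ≤ 1
  length-codes-≡ S i rewrite dec-true (i Fin.≟ i) refl = ≤-refl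

  length-movable : ∀ S i j → length (movable S i j) ≤ n
  length-movable S i j = ≤-trans (List.length-filter (movable? S i j) (allFin n)) (≤-reflexive (List.length-tabulate id))

  matrices : Tuple → List (Vec (Vec Code r) r)
  matrices S = choices (λ i → choices (codes S i))

  bound : ℕ
  bound = (suc (2 * (2 * r)) * suc (2 * n)) ^ tri r

  length-matrices : ∀ S → length (matrices S) ≤ bound
  length-matrices S = begin
    length (matrices S)                        ≡⟨ length-choices (λ i → choices (codes S i)) ⟩
    ∏ (λ i → length (choices (codes S i)))     ≡⟨ ∏-cong (λ i → length-choices (codes S i)) ⟩
    ∏ (λ i → ∏ (λ j → length (codes S i j)))   ≤⟨ ∏∏-pairs (λ i j → length (codes S i j)) _ (length-codes-≡ S) (λ i j i≢j → begin
      length (codes S i j) * length (codes S j i)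
        ≡⟨ cong₂ _*_ (length-codes-≢ S i j i≢j) (length-codes-≢ S j i (i≢j ∘ sym)) ⟩
      suc (2 * length (movable S i j)) * suc (2 * length (movable S j i))
        ≤⟨ one-small-product _ _ (2 * r) n (length-movable S i j) (length-movable S j i) (movable-small S i j i≢j) ⟩
      suc (2 * (2 * r)) * suc (2 * n) ∎) ⟩
    bound                                      ∎
    where open ≤-Reasoning

  -- T_i arises from S_i by removing the vertices that some entry (i , j) marks as not staying, and
  -- adding every vertex named by an entry (j , i), whatever its flag says about T_j.
  Decodes : Tuple → (Fin r → Fin r → Code) → Fin r → Fin n → Set
  Decodes S Z i x = (x ∈ lookup S i × (∀ j → Z i j ≢ just (x , false))) ⊎
                    (∃[ j ] (Z j i ≡ just (x , true) ⊎ Z j i ≡ just (x , false)))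

  _≟ᶜ_ : (a b : Code) → Dec (a ≡ b)
  _≟ᶜ_ = Maybe.≡-dec (Product.≡-dec Fin._≟_ Bool._≟_)

  decodes? : ∀ S Z i x → Dec (Decodes S Z i x)
  decodes? S Z i x = ((x ∈? lookup S i) ×-dec Fin.all? (λ j → ¬? (Z i j ≟ᶜ just (x , false)))) ⊎-dec
    Fin.any? (λ j → (Z j i ≟ᶜ just (x , true)) ⊎-dec (Z j i ≟ᶜ just (x , false)))

  decode : Tuple → (Fin r → Fin r → Code) → Tuple
  decode S Z = tabulate (λ i → comprehension (λ x → does (decodes? S Z i x)))

  module Encode (S T : Tuple) (S-cliques : Cliques S) (T-cliques : Cliques T)
                (S⊆T : ∀ x → x ∈ᵁ S → x ∈ᵁ T) (T⊆S : ∀ x → x ∈ᵁ T → x ∈ᵁ S) where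

    common? : ∀ i j → Dec (∃[ x ] (x ∈ lookup S i × x ∈ lookup T j))
    common? i j = Fin.any? λ x → (x ∈? lookup S i) ×-dec (x ∈? lookup T j)

    encode : Fin r → Fin r → Code
    encode i j with i Fin.≟ j | common? i j
    ... | yes _ | _           = nothing
    ... | no  _ | no _        = nothing
    ... | no  _ | yes (x , _) = just (x , does (x ∈? lookup T i))

    -- The vertex picked by `common?` must be x: two different vertices of S_i ∩ T_j would span an
    -- edge of both colours i and j.
    encode-just : ∀ i j x → i ≢ j → x ∈ lookup S i → x ∈ lookup T j → encode i j ≡ just (x , does (x ∈? lookup T i))
    encode-just i j x i≢j x∈S x∈T with i Fin.≟ j | common? i j
    ... | yes i≡j | _ = ⊥-elim (i≢j i≡j)
    ... | no  _   | no none = ⊥-elim (none (x , x∈S , x∈T))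
    ... | no  _   | yes (y , y∈S , y∈T) with y Fin.≟ x
    ...   | yes refl = refl
    ...   | no  y≢x  = ⊥-elim (i≢j (trans (sym (proj₂ (S-cliques i y x y∈S x∈S y≢x))) (proj₂ (T-cliques j y x y∈T x∈T y≢x))))

    encode-just⁻ : ∀ i j {x b} → encode i j ≡ just (x , b) →
                   i ≢ j × x ∈ lookup S i × x ∈ lookup T j × does (x ∈? lookup T i) ≡ b
    encode-just⁻ i j eq with i Fin.≟ j | common? i j
    encode-just⁻ i j refl | no i≢j | yes (x , x∈S , x∈T) = i≢j , x∈S , x∈T , refl

    -- A vertex of T_i outside S_i lies in some S_k, so entry (k , i) names it; a vertex of S_i
    -- outside T_i lies in some T_k, so entry (i , k) names it with flag `false`. Both use that the
    -- unions agree.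
    decode-encode : ∀ Z → (∀ i j → Z i j ≡ encode i j) → decode S Z ≡ T
    decode-encode Z Z≡ = trans (Vec.tabulate-cong λ i → comprehension-≡ (decodes? S Z i) (lookup T i) (sound i) (complete i))
                               (Vec.tabulate∘lookup T)
      where
      either : ∀ {z x} b → z ≡ just (x , b) → z ≡ just (x , true) ⊎ z ≡ just (x , false)
      either true  eq = inj₁ eq
      either false eq = inj₂ eq
      sound : ∀ i x → x ∈ lookup T i → Decodes S Z i x
      sound i x x∈T with x ∈? lookup S i
      ... | yes x∈S = inj₁ (x∈S , λ j eq →
        let _ , _ , _ , b = encode-just⁻ i j (trans (sym (Z≡ i j)) eq)
        in case (trans (sym b) (dec-true (x ∈? lookup T i) x∈T)))
        where
        case : ¬ false ≡ true
        case ()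
      ... | no x∉S with T⊆S x (i , x∈T)
      ...   | k , x∈Sk = inj₂ (k , either (does (x ∈? lookup T k)) (trans (Z≡ k i)
                (encode-just k i x (λ { refl → x∉S x∈Sk }) x∈Sk x∈T)))
      complete : ∀ i x → Decodes S Z i x → x ∈ lookup T i
      complete i x (inj₁ (x∈S , h)) with S⊆T x (i , x∈S)
      ... | k , x∈Tk with i Fin.≟ k
      ...   | yes refl = x∈Tk
      ...   | no  i≢k with x ∈? lookup T i | encode-just i k x i≢k x∈S x∈Tk
      ...     | yes x∈T | _  = x∈T
      ...     | no  _   | eq = ⊥-elim (h k (trans (Z≡ i k) eq))
      complete i x (inj₂ (j , inj₁ eq)) = proj₁ (proj₂ (proj₂ (encode-just⁻ j i (trans (sym (Z≡ j i)) eq))))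
      complete i x (inj₂ (j , inj₂ eq)) = proj₁ (proj₂ (proj₂ (encode-just⁻ j i (trans (sym (Z≡ j i)) eq))))

    -- A vertex of the j-th clique of S that is far from x lies in another clique
    -- of T, and each of those meets the j-th clique of S in at most one vertex.
    far-≤ : ∀ i j x → i ≢ j → x ∈ lookup S i → x ∈ lookup T j → length (far S j x) ≤ r
    far-≤ i j x i≢j x∈S x∈T = ≤-trans
      (unique-⊆-length (Unique.filter⁺ (λ y → (y ∈? lookup S j) ×-dec far? j x y) (Unique.allFin⁺ n)) covered)
      (≤-reflexive (List.length-tabulate representative))
      where
      vertex : Code → Fin n
      -- The default covers k = j, where the code is `nothing`: a vertex of T_j far from x in colour
      -- j can only be x itself, since x lies in the clique T_j.
      vertex nothing        = x
      vertex (just (y , _)) = y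
      representative : Fin r → Fin n
      representative k = vertex (encode j k)
      covered : ∀ {y} → y ∈ₗ far S j x → y ∈ₗ List.tabulate representative
      covered {y} y∈ with ∈-filter⁻ (λ y → (y ∈? lookup S j) ×-dec far? j x y) {xs = allFin n} y∈
      ... | _ , y∈S , y-far with S⊆T y (j , y∈S)
      ...   | k , y∈T = subst (_∈ₗ List.tabulate representative) (eq (j Fin.≟ k)) (∈-tabulate⁺ k)
        where
        diagonal : encode j j ≡ nothing
        diagonal with encode j j in eq
        ... | nothing = refl
        ... | just _  = ⊥-elim (proj₁ (encode-just⁻ j j eq) refl)
        eq : Dec (j ≡ k) → representative k ≡ y
        eq (no j≢k)   = cong vertex (encode-just j k y j≢k y∈S y∈T)
        eq (yes refl) with x Fin.≟ y
        ... | yes refl = cong vertex diagonal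
        ... | no  x≢y  = ⊥-elim (y-far (T-cliques j x y x∈T y∈T x≢y))

    encode-∈-codes : ∀ i j → encode i j ∈ₗ codes S i j
    encode-∈-codes i j = member (encode i j) refl (i Fin.≟ j)
      where
      bool : ∀ b → b ∈ₗ true ∷ false ∷ []
      bool true  = here refl
      bool false = there (here refl)
      member : ∀ z → encode i j ≡ z → (d : Dec (i ≡ j)) → z ∈ₗ moves (does d) S i j
      member nothing        eq (yes _)   = here refl
      member nothing        eq (no  _)   = here refl
      member (just (x , b)) eq (yes i≡j) = ⊥-elim (proj₁ (encode-just⁻ i j eq) i≡j)
      member (just (x , b)) eq (no  i≢j) =
        let _ , x∈S , x∈T , _ = encode-just⁻ i j eq
        in there (∈-cartesianProductWith⁺ (λ x b → just (x , b))
             (∈-filter⁺ (movable? S i j) (∈-allFin x) (x∈S , far-≤ i j x i≢j x∈S x∈T)) (bool b))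

  entryᶜ : Vec (Vec Code r) r → Fin r → Fin r → Code
  entryᶜ M i j = lookup (lookup M i) j

  tuples : List Tuple
  tuples = choices (λ i → filter (isClique? (colourGraph c i)) (subsets n))

  tuples-unique : Unique tuples
  tuples-unique = choices-unique λ i → Unique.filter⁺ (isClique? (colourGraph c i)) (subsets-unique n)

  length-tuples : length tuples ≡ cliqueProduct c
  length-tuples = trans (length-choices (λ i → filter (isClique? (colourGraph c i)) (subsets n)))
    (sym (product-allFin (λ i → cliqueCount (colourGraph c i))))

  tuples-cliques : ∀ {S} → S ∈ₗ tuples → Cliques S
  tuples-cliques S∈ i = proj₂ (∈-filter⁻ (isClique? (colourGraph c i)) {xs = subsets n} (∈-choices⁻ S∈ i))

  ∈ᵁ? : ∀ S x → Dec (x ∈ᵁ S)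
  ∈ᵁ? S x = Fin.any? (λ i → x ∈? lookup S i)

  union : Tuple → Subset n
  union S = comprehension (λ x → does (∈ᵁ? S x))

  union-⊆ : ∀ S T → union S ≡ union T → ∀ x → x ∈ᵁ S → x ∈ᵁ T
  union-⊆ S T eq x x∈S = does-true (∈ᵁ? T x) (begin
    does (∈ᵁ? T x)        ≡⟨ Vec.lookup∘tabulate (λ x → does (∈ᵁ? T x)) x ⟨
    lookup (union T) x    ≡⟨ cong (λ U → lookup U x) eq ⟨
    lookup (union S) x    ≡⟨ Vec.lookup∘tabulate (λ x → does (∈ᵁ? S x)) x ⟩
    does (∈ᵁ? S x)        ≡⟨ dec-true (∈ᵁ? S x) x∈S ⟩
    true                  ∎)
    where open ≡-Reasoning

  union≟ : ∀ U S → Dec (union S ≡ U)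
  union≟ U S = Vec.≡-dec Bool._≟_ (union S) U

  -- The head of the list is the reference tuple S from which all tuples with the same union are
  -- decoded. Matrices that encode no tuple are decoded as well, which only lengthens the list.
  reconstruct : List Tuple → List Tuple
  reconstruct []      = []
  reconstruct (S ∷ _) = map (λ M → decode S (entryᶜ M)) (matrices S)

  candidates : List Tuple
  candidates = concatMap (λ U → reconstruct (filter (union≟ U) tuples)) (subsets n)

  length-reconstruct : ∀ Ss → length (reconstruct Ss) ≤ bound
  length-reconstruct []      = z≤n
  length-reconstruct (S ∷ _) = ≤-trans (≤-reflexive (List.length-map _ (matrices S))) (length-matrices S)

  reconstructs : ∀ {T} Ss → T ∈ₗ Ss → (∀ {S} → S ∈ₗ Ss → Cliques S) → (∀ {S} → S ∈ₗ Ss → union S ≡ union T) →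
                 T ∈ₗ reconstruct Ss
  reconstructs {T} Ss@(S ∷ _) T∈ cliques same = subst (_∈ₗ reconstruct Ss) (decode-encode (entryᶜ M) entry≡)
    (∈-map⁺ (λ M → decode S (entryᶜ M)) (∈-choices⁺ M λ i → ∈-choices⁺ (lookup M i) λ j →
      subst (_∈ₗ codes S i j) (sym (entry≡ i j)) (encode-∈-codes i j)))
    where
    open Encode S T (cliques (here refl)) (cliques T∈)
      (union-⊆ S T (same (here refl))) (union-⊆ T S (sym (same (here refl))))
    M : Vec (Vec Code r) r
    M = tabulate (λ i → tabulate (encode i))
    entry≡ : ∀ i j → entryᶜ M i j ≡ encode i j
    entry≡ i j = trans (cong (λ v → lookup v j) (Vec.lookup∘tabulate (λ i → tabulate (encode i)) i))
                       (Vec.lookup∘tabulate (encode i) j)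

  tuples⊆candidates : ∀ {T} → T ∈ₗ tuples → T ∈ₗ candidates
  tuples⊆candidates {T} T∈ = ∈-concatMap⁺ (λ U → reconstruct (filter (union≟ U) tuples))
    (Any.map (λ { refl → found }) (∈-subsets (union T)))
    where
    found : T ∈ₗ reconstruct (filter (union≟ (union T)) tuples)
    found = reconstructs (filter (union≟ (union T)) tuples) (∈-filter⁺ (union≟ (union T)) T∈ refl)
      (λ S∈ → tuples-cliques (proj₁ (∈-filter⁻ (union≟ (union T)) {xs = tuples} S∈)))
      (λ S∈ → proj₂ (∈-filter⁻ (union≟ (union T)) {xs = tuples} S∈))

  cliqueProduct-≤ : cliqueProduct c ≤ 2 ^ n * bound
  cliqueProduct-≤ = begin
    cliqueProduct c             ≡⟨ length-tuples ⟨
    length tuples               ≤⟨ unique-⊆-length tuples-unique tuples⊆candidates ⟩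
    length candidates           ≤⟨ length-concatMap-≤ _ bound (subsets n) (λ U → length-reconstruct (filter (union≟ U) tuples)) ⟩
    length (subsets n) * bound  ≡⟨ cong (_* bound) (length-subsets n) ⟩
    2 ^ n * bound               ∎
    where open ≤-Reasoning

-- For each pair of colours there are at most 4 r + 1 codes on the small side and 2 n + 1 ≤ 3 n on
-- the other, the last step by n ≥ 1.
cliqueProduct-upper : ∀ {r n} .{{_ : NonZero n}} (c : Colouring r n) →
  cliqueProduct c ≤ (suc (2 * (2 * r)) * 3) ^ tri r * (n ^ tri r * 2 ^ n)
cliqueProduct-upper {r} {n} c = begin
  cliqueProduct c                                        ≤⟨ Codes.cliqueProduct-≤ c ⟩
  2 ^ n * (d * suc (2 * n)) ^ tri r                      ≤⟨ *-monoʳ-≤ (2 ^ n) (^-monoˡ-≤ (tri r) (*-monoʳ-≤ d (+-monoˡ-≤ (2 * n) (>-nonZero⁻¹ n)))) ⟩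
  2 ^ n * (d * (3 * n)) ^ tri r                          ≡⟨ cong (λ x → 2 ^ n * x ^ tri r) (*-assoc d 3 n) ⟨
  2 ^ n * (d * 3 * n) ^ tri r                            ≡⟨ cong (2 ^ n *_) (ℕ-Lemmas.^-distribʳ-* (d * 3) n (tri r)) ⟩
  2 ^ n * ((d * 3) ^ tri r * n ^ tri r)                  ≡⟨ solve 3 (λ x y z → x :* (y :* z) := y :* (z :* x)) refl (2 ^ n) ((d * 3) ^ tri r) (n ^ tri r) ⟩
  (d * 3) ^ tri r * (n ^ tri r * 2 ^ n)                  ∎
  where
  open ≤-Reasoning
  open +-*-Solver
  d : ℕ
  d = suc (2 * (2 * r))

-- For 3 ^ (t + 1) ≤ n < 3 ^ (t + 2), three colours have at most 6 * 3 ^ tri (t + 4) cliques each,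
-- and the other r colours n + 1 ≤ 3 ^ (t + 2) each.
totalExponent : (r t : ℕ) → ℕ
totalExponent r t = (2 + tri (4 + t)) * 3 + (2 + t) * r

-- The terms 3 t² agree on both sides. The constant `8 + r` is what the lower-order terms require:
-- at r = t = 0 the two sides are 50 and 51.
totalExponent-≤ : ∀ r t → 2 * totalExponent r t + 2 ≤ 3 * (suc t + 2 * (8 + r)) * suc t
totalExponent-≤ r t = begin
  2 * totalExponent r t + 2
    ≡⟨ solve 3 (λ r t x → con 2 :* ((con 2 :+ x) :* con 3 :+ (con 2 :+ t) :* r) :+ con 2 :=
         con 3 :* (x :+ x) :+ con 2 :* (con 2 :+ t) :* r :+ con 14) refl r t (tri (4 + t)) ⟩
  3 * (tri (4 + t) + tri (4 + t)) + 2 * (2 + t) * r + 14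
    ≡⟨ cong (λ x → 3 * x + 2 * (2 + t) * r + 14) (tri-double (3 + t)) ⟩
  3 * ((3 + t) * (3 + t) + (3 + t)) + 2 * (2 + t) * r + 14
    ≤⟨ m≤m+n _ (33 * t + 1 + 4 * (r * t) + 2 * r) ⟩
  3 * ((3 + t) * (3 + t) + (3 + t)) + 2 * (2 + t) * r + 14 + (33 * t + 1 + 4 * (r * t) + 2 * r)
    ≡⟨ solve 2 (λ r t → con 3 :* ((con 3 :+ t) :* (con 3 :+ t) :+ (con 3 :+ t)) :+ con 2 :* (con 2 :+ t) :* r :+ con 14
           :+ (con 33 :* t :+ con 1 :+ con 4 :* (r :* t) :+ con 2 :* r) :=
         con 3 :* ((con 1 :+ t) :+ con 2 :* (con 8 :+ r)) :* (con 1 :+ t)) refl r t ⟩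
  3 * (suc t + 2 * (8 + r)) * suc t ∎
  where
  open ≤-Reasoning
  open +-*-Solver

six-power-≤ : ∀ e u r {s} → s ≤ 3 ^ u → (6 * 3 ^ e) ^ 3 * s ^ r ≤ 3 ^ ((2 + e) * 3 + u * r)
six-power-≤ e u r {s} s≤ = begin
  (6 * 3 ^ e) ^ 3 * s ^ r              ≤⟨ *-mono-≤ (^-monoˡ-≤ 3 (*-monoˡ-≤ (3 ^ e) (m≤m+n 6 3))) (^-monoˡ-≤ r s≤) ⟩
  (3 ^ 2 * 3 ^ e) ^ 3 * (3 ^ u) ^ r    ≡⟨ cong (λ x → x ^ 3 * (3 ^ u) ^ r) (^-distribˡ-+-* 3 2 e) ⟨
  (3 ^ (2 + e)) ^ 3 * (3 ^ u) ^ r      ≡⟨ cong₂ _*_ (^-*-assoc 3 (2 + e) 3) (^-*-assoc 3 u r) ⟩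
  3 ^ ((2 + e) * 3) * 3 ^ (u * r)      ≡⟨ ^-distribˡ-+-* 3 ((2 + e) * 3) (u * r) ⟨
  3 ^ ((2 + e) * 3 + u * r)            ∎
  where open ≤-Reasoning

double-≤ : ∀ {n} u → n < 3 ^ u → 2 * n ≤ suc (3 ^ suc u)
double-≤ u n< = ≤-trans (*-mono-≤ 2≤3 (<⇒≤ n<)) (n≤1+n (3 ^ suc u))

few-cliques-power : ∀ r n a u Q → 2 * n ≤ suc (3 ^ a) → suc n ≤ 3 ^ u → (2 + tri (suc a)) * 3 + u * r ≡ Q →
  ∃[ c ] cliqueProduct {3 + r} {n} c ≤ 3 ^ Q
few-cliques-power r n a u Q 2n≤ n< eq =
  proj₁ few , subst (λ Q → cliqueProduct (proj₁ few) ≤ 3 ^ Q) eq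
    (≤-trans (proj₂ few) (six-power-≤ (tri (suc a)) u r {suc n} n<))
  where
  few : ∃[ c ] cliqueProduct {3 + r} {n} c ≤ (6 * 3 ^ tri (suc a)) ^ 3 * suc n ^ r
  few = few-cliques-product r n a 2n≤

few-cliques-exponent : ∀ r n → ∃[ c ] cliqueProduct {3 + r} {n} c ≤ 3 ^ totalExponent r (UpperExponent.ilog n)
few-cliques-exponent r n = few-cliques-power r n (suc u) u (totalExponent r (UpperExponent.ilog n))
  (double-≤ u (UpperExponent.ilog-upper n)) (UpperExponent.ilog-upper n) refl
  where
  u : ℕ
  u = suc (suc (UpperExponent.ilog n))

-- The three claims in terms of real numbers

module _ (r : ℕ) (r≥3 : 3 ≤ r) where

  private
    instance
      r>1 : NonTrivial r
      r>1 = ≥3⇒nonTrivial r≥3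
      r>0 : NonZero r
      r>0 = ≥3⇒nonZero r≥3

    r≥2 : 2 ≤ r
    r≥2 = <⇒≤ r≥3

  bounds : ∃[ K ] ∃[ ε ] fromℕ 0 <ᴿ K × ε ⟶0 ×
    ((n : ℕ) .{{_ : NonZero n}} (c : Colouring r n) →
      n ^ᴿ ((fromℚ ½ +ᴿ ε n) *ᴿ log r n) ≤ᴿ fromℕ (cliqueProduct c) ×
      fromℕ (cliqueProduct c) ≤ᴿ K *ᴿ fromℕ (n ^ (r C 2) * 2 ^ n))
  bounds = fromℕ K , ε , 0<fromℕ K (m^n>0 (d * 3) (r C 2)) , ε⟶0 , λ n c →
    power-≤ n (cliqueProduct c) (cliqueProduct-lower c) ,
    fromℕ-*-≤ (cliqueProduct c) K (n ^ (r C 2) * 2 ^ n)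
      (subst (λ e → cliqueProduct c ≤ (d * 3) ^ e * (n ^ e * 2 ^ n)) (tri≡C r) (cliqueProduct-upper c))
    where
    open LowerExponent r r≥2
    d K : ℕ
    d = suc (2 * (2 * r))
    K = (d * 3) ^ (r C 2)

  upper-tight : ∃[ k ] fromℕ 0 <ᴿ k ×
    ((n : ℕ) .{{_ : NonZero n}} → ∃[ c ]
      k *ᴿ fromℕ (n ^ (r C 2) * 2 ^ n) ≤ᴿ fromℕ (cliqueProduct {r} {n} c))
  upper-tight = fromℚ (+ 1 / suc D) , 0<1/ D , λ n → let c , le = blowup r n in
    c , 1/-*-≤ D (n ^ (r C 2) * 2 ^ n) (cliqueProduct c)
      (subst (λ d → n ^ (r C 2) * 2 ^ n ≤ cliqueProduct c * d) (sym (suc-pred ((r * r) ^ (r C 2)) {{m^n≢0 (r * r) (r C 2) {{m*n≢0 r r}}}}))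
        (subst (λ e → n ^ e * 2 ^ n ≤ cliqueProduct c * (r * r) ^ e) (tri≡C r) le))
    where
    D : ℕ
    D = pred ((r * r) ^ (r C 2))

  lower-tight : ∃[ δ ] δ ⟶0 ×
    (∃[ N ] ((n : ℕ) .{{_ : NonZero n}} → N ≤ n → ∃[ c ]
      fromℕ (cliqueProduct {r} {n} c) ≤ᴿ
        n ^ᴿ ((fromℕ 3 *ᴿ log 3 r) *ᴿ (fromℚ ½ +ᴿ δ n) *ᴿ log r n)))
  -- From n = 3 on, 3 ^ (`ilog n` + 1) ≤ n.
  lower-tight = δ , δ⟶0 , 3 , λ n 3≤n → let c , le = few n in
    c , ≤-power r n r≥2 3≤n (cliqueProduct c) (totalExponent r′ (ilog n)) (totalExponent-≤ r′ (ilog n)) le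
    where
    r′ : ℕ
    r′ = r ∸ 3
    open UpperExponent using (ilog)
    open UpperExponent.Exponent (8 + r′)
    few : ∀ n → ∃[ c ] cliqueProduct {r} {n} c ≤ 3 ^ totalExponent r′ (ilog n)
    few n = subst (λ r → ∃[ c ] cliqueProduct {r} {n} c ≤ 3 ^ totalExponent r′ (ilog n)) (m+[n∸m]≡n r≥3)
      (few-cliques-exponent r′ n)

theorem1p10 : (r : ℕ) (r≥3 : 3 ≤ r) →
    let instance
          r>1 : NonTrivial r
          r>1 = ≥3⇒nonTrivial r≥3
          r>0 : NonZero r
          r>0 = ≥3⇒nonZero r≥3
    in
    (∃[ K ] ∃[ ε ] fromℕ 0 <ᴿ K × ε ⟶0 ×
       ((n : ℕ) .{{_ : NonZero n}} (c : Colouring r n) →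
          n ^ᴿ ((fromℚ ½ +ᴿ ε n) *ᴿ log r n) ≤ᴿ fromℕ (cliqueProduct c) ×
          fromℕ (cliqueProduct c) ≤ᴿ K *ᴿ fromℕ (n ^ (r C 2) * 2 ^ n))) ×
    (∃[ k ] fromℕ 0 <ᴿ k ×
       ((n : ℕ) .{{_ : NonZero n}} → ∃[ c ]
          k *ᴿ fromℕ (n ^ (r C 2) * 2 ^ n) ≤ᴿ fromℕ (cliqueProduct {r} {n} c))) ×
    (∃[ δ ] δ ⟶0 ×
       (∃[ N ] ((n : ℕ) .{{_ : NonZero n}} → N ≤ n → ∃[ c ]
          fromℕ (cliqueProduct {r} {n} c) ≤ᴿ
            n ^ᴿ ((fromℕ 3 *ᴿ log 3 r) *ᴿ (fromℚ ½ +ᴿ δ n) *ᴿ log r n))))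
theorem1p10 r r≥3 = bounds r r≥3 , upper-tight r r≥3 , lower-tight r r≥3
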